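{- Let $p\equiv 1\pmod 4$ be a prime and let $\alpha$ be a positive integer. Let $p=a^2+b^2$, where $a$ and $b$ are integers such that $a$ is even. Then the number $\mathcal{K}_4(G_{p^\alpha})$ of cliques of order four in the Paley-type graph $G_{p^\alpha}$ is $$\mathcal{K}_4(G_{p^\alpha})=\frac{p^{4\alpha-3}(p-1)\{(p-9)^2-4a^2\}}{1536}.$$
   Context: For a prime $p\equiv 1\pmod 4$ and $\alpha\geq 1$, let $n=p^\alpha$ and let $\mathbb{Z}_n^\ast$ be the group of units of $\mathbb{Z}_n=\mathbb{Z}/n\mathbb{Z}$. The Paley-type graph $G_n$ is the simple undirected graph with vertex set $\mathbb{Z}_n$ in which $xy$ is an edge if and only if $x-y\equiv c^2\pmod n$ for some $c\in\mathbb{Z}_n^\ast$ (this is symmetric since $-1$ is a square in $\mathbb{Z}_n^\ast$). For a graph $G$, $\mathcal{K}_m(G)$ denotes the number of cliques of order $m$ in $G$, i.e. the number of $m$-element sets of pairwise adjacent vertices. -}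

module Defs where

open import Data.Bool.Base using (true; false)
open import Data.Fin.Base using (Fin; toℕ)
open import Data.Fin.Properties using (any?; all?)
  renaming (_≟_ to _≟ᶠ_)
open import Data.Fin.Subset using (Subset; _∈_; ∣_∣; inside; outside)
open import Data.Fin.Subset.Properties using (_∈?_)
open import Data.Integer.Base using (ℤ; +_; 1ℤ; _-_; _*_)
open import Data.Integer.Divisibility.Signed using (_∣_; _∣?_)
open import Data.List.Base using (List; []; _∷_; _++_; map; filter; length)
open import Data.Nat.Base using (ℕ; zero; suc)
open import Data.Nat.Properties using (_≟_)
open import Data.Product.Base using (∃-syntax; _×_)
import Data.Vec.Base as Vec
open import Relation.Binary.Core using (Rel)
open import Relation.Binary.Definitions using (Decidable)
open import Relation.Binary.PropositionalEquality.Core using (_≡_; _≢_)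
open import Relation.Nullary.Decidable using (Dec; _×-dec_; _→-dec_; ¬?)
open import Level using (0ℓ)

------------------------------------------------------------------------
-- Cliques

-- Adjacency is required for both orders of each pair of distinct
-- vertices, so the definition makes sense for any relation and is the
-- usual one when the relation is symmetric.

IsClique : ∀ {n} → Rel (Fin n) 0ℓ → Subset n → Set
IsClique Adj S = ∀ x → x ∈ S → ∀ y → y ∈ S → x ≢ y → Adj x y

isClique? : ∀ {n} {Adj : Rel (Fin n) 0ℓ} → Decidable Adj →
            (S : Subset n) → Dec (IsClique Adj S)
isClique? adj? S =
  all? λ x → (x ∈? S) →-dec
  all? λ y → (y ∈? S) →-dec (¬? (x ≟ᶠ y) →-dec adj? x y)

-- Every subset of Fin n is listed exactly once.

allSubsets : ∀ n → List (Subset n)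
allSubsets zero    = Vec.[] ∷ []
allSubsets (suc n) = map (inside Vec.∷_) (allSubsets n)
                  ++ map (outside Vec.∷_) (allSubsets n)

𝒦 : ∀ {n} {Adj : Rel (Fin n) 0ℓ} → ℕ → Decidable Adj → ℕ
𝒦 m adj? =
  length (filter (λ S → (∣ S ∣ ≟ m) ×-dec isClique? adj? S) (allSubsets _))

------------------------------------------------------------------------
-- The Paley-type graph on ℤ/n

infix 4 _≡_[mod_] _≡?_[mod_]

_≡_[mod_] : ℤ → ℤ → ℕ → Set
i ≡ j [mod n ] = + n ∣ i - j

_≡?_[mod_] : ∀ i j n → Dec (i ≡ j [mod n ])
i ≡? j [mod n ] = + n ∣? (i - j)

-- The residue class x ∈ ℤ/n is given by its representative in {0,…,n-1}.

rep : ∀ {n} → Fin n → ℤ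
rep x = + toℕ x

IsUnit : ∀ {n} → Fin n → Set
IsUnit {n} c = ∃[ d ] rep c * rep {n} d ≡ 1ℤ [mod n ]

isUnit? : ∀ {n} (c : Fin n) → Dec (IsUnit c)
isUnit? {n} c = any? λ d → rep c * rep d ≡? 1ℤ [mod n ]

-- Adjacency in G n.  It is symmetric when -1 is the square of a unit
-- modulo n, in particular for powers of a prime congruent to 1 modulo 4.

PaleyAdj : ∀ n → Rel (Fin n) 0ℓ
PaleyAdj n x y =
  ∃[ c ] IsUnit {n} c × rep x - rep y ≡ rep c * rep c [mod n ]

G : ∀ n → Decidable (PaleyAdj n)
G n x y =
  any? λ c → isUnit? c ×-dec (rep x - rep y ≡? rep c * rep c [mod n ])

{-# OPTIONS --safe #-}

-- Let χ be the quadratic character of 𝔽 = ℤ/p and e d = 1 - δ d 0 + χ d, which is 2 on the nonzero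
-- squares and 0 elsewhere.  By Hensel's lemma x and y are adjacent in G (p ^ α) iff x - y is a nonzero
-- square modulo p, so counting ordered 4-cliques gives
--   24 · 64 · 𝒦₄ = p ^ (4 (α - 1)) · ∑ e(w-x) e(w-y) e(w-z) e(x-y) e(x-z) e(y-z),
-- summed over 𝔽⁴.  Moving w to 0 and scaling x to 1 turns the sum into p (p - 1) Q, where
--   Q = ∑ k(y) k(z) e(y-z),  k(y) = e(y) e(y-1).
-- Expanding Q leaves one nontrivial character sum,
--   W = ∑ χ (y (y-1) z (z-1) (y-z)) = T₁² - 2 p,  T_k = ∑ χ (x (x² - k)),
-- and Q = p² - 22 p + 81 + T₁².  By Jacobsthal's theorem T₁² = 4 b²: summing T_k² over all k yields
-- T₁² + T_n² = 4 p for every nonsquare n, with T₁ / 2 odd and T_n / 2 even, and p is a sum of an even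
-- and an odd square in only one way.
module Submission where

open import Defs
open import Algebra.Bundles using (CommutativeRing)
import Algebra.Properties.Semiring.Sum as SemiringSum
import Algebra.Solver.Ring as RingSolver
open import Algebra.Solver.Ring.AlmostCommutativeRing
  using (fromCommutativeRing; _-Raw-AlmostCommutative⟶_)
open import Algebra.Structures using (IsCommutativeRing)
open import Data.Bool.Base using (Bool; true; false; _∧_; if_then_else_)
open import Data.Bool.Properties using (∧-conicalˡ; ∧-conicalʳ)
open import Data.Fin.Base using (Fin; zero; suc; toℕ; fromℕ<; _↑ˡ_; _↑ʳ_)
open import Data.Fin.Permutation using (permutation)
open import Data.Fin.Properties
  using (_≟_; any?; suc-injective; toℕ-injective; toℕ<n; toℕ-fromℕ<; toℕ-↑ˡ; toℕ-↑ʳ)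
open import Data.Fin.Subset as Subset using (Subset; _∈_; inside; outside)
open import Data.Integer.Base as ℤ
  using (ℤ; +_; -[1+_]; -_; _+_; _-_; _*_; _^_; 0ℤ; 1ℤ; -1ℤ; ∣_∣; _≤_; -≤+; +≤+)
open import Data.Integer.Divisibility.Signed
open import Data.Integer.DivMod using (_%ℕ_; _/ℕ_; n%ℕd<d; a≡a%ℕn+[a/ℕn]*n)
open import Data.Integer.Properties as ℤ using ()
open import Data.Integer.Tactic.RingSolver using (solve-∀)
open import Data.List.Base using (List; []; _∷_; _++_; map; filter; length)
open import Data.Maybe.Base using (Maybe; just; nothing)
open import Data.Nat.Base as ℕ using (ℕ; zero; suc; _!)
open import Data.Nat.Coprimality using (coprime-Bézout; prime⇒coprime)
open import Data.Nat.Divisibility as ℕ∣ using ()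
open import Data.Nat.DivMod using (m≡m%n+[m/n]*n)
open import Data.Nat.GCD using (module Bézout)
open import Data.Nat.Primality
  using (Prime; ¬prime[1]; euclidsLemma; prime⇒nonZero; prime⇒nonTrivial)
open import Data.Nat.Properties as ℕ using ()
open import Data.Product.Base using (_×_; _,_; proj₁; proj₂; ∃-syntax)
open import Data.Rational.Base using (_/_)
open import Data.Rational.Properties using (fromℚᵘ-cong)
open import Data.Rational.Unnormalised.Base using (mkℚᵘ; *≡*)
open import Data.Sum.Base using (_⊎_; inj₁; inj₂; [_,_]′)
open import Data.Vec.Base using ([]; _∷_; here; there)
open import Function.Base using (_∘_)
open import Level using (0ℓ)
open import Relation.Binary.Core using (Rel)
open import Relation.Binary.Definitions using (Decidable; Symmetric)
open import Relation.Binary.PropositionalEquality hiding (J)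
open import Relation.Nullary.Decidable using (Dec; yes; no; does; _×-dec_; dec-true; dec-false)
open import Relation.Nullary.Negation using (¬_; contradiction)
open SemiringSum ℤ.+-*-semiring
  using (sum; sum-cong-≗; ∑-distrib-+; *-distribˡ-sum; sum-permute) renaming (∑-comm to sum-comm)
open ≡-Reasoning

-- Cliques and tuples

-- A single device drives the character sums: `χ` is one less than a number of square roots, so a
-- substitution amounts to counting fibres, and the fibres of a quadratic map are again counted by 1
-- + `χ` of a discriminant. This is what ties W to T₁². Expand T₁² over s and r and group by the
-- product c = s r and the sum m = s + r. Apart from a complete quadratic sum, the summand depends
-- on m only through n = m², which carries the weight 1 + χ n; its χ n part is W, once the cubic sum
-- inside W has been parametrized by c as well.
--
-- Parity in Jacobsthal's theorem comes from the involution x ↦ -x: it preserves χ (x (x² - k)), so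
-- the nonzero square values of this cubic come in pairs. Hence T_k modulo 4 depends only on p and
-- on the number 2 + χ k of zeros, and this separates T₁ from T_n when p ≡ 1 modulo 4.
--
-- The root of -1 that makes `χ` even and adjacency symmetric is a / b, taken from the given
-- representation of p.

ι : Bool → ℤ
ι b = if b then 1ℤ else 0ℤ

ι-∧ : ∀ b c → ι (b ∧ c) ≡ ι b * ι c
ι-∧ true  c = sym (ℤ.*-identityˡ (ι c))
ι-∧ false c = refl

-- The sum over all m-element subsets S of ∏_{x ∈ S} P x · ∏_{x < y ∈ S} A x y.
cliqueSum : ∀ {n} → ℕ → (Fin n → ℤ) → (Fin n → Fin n → ℤ) → ℤ
cliqueSum zero P A = 1ℤ
cliqueSum {zero} (suc m) P A = 0ℤ
cliqueSum {suc n} (suc m) P A =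
  P zero * cliqueSum m (λ i → P (suc i) * A zero (suc i)) (λ i j → A (suc i) (suc j))
    + cliqueSum (suc m) (P ∘ suc) (λ i j → A (suc i) (suc j))

-- Choosing `x` multiplies the weight of every later vertex `y` by `A x y`. The product over all
-- pairs is thus built up through `P` alone, exactly as in `cliqueSum`.
tupleSum : ∀ {n} → ℕ → (Fin n → ℤ) → (Fin n → Fin n → ℤ) → ℤ
tupleSum zero P A = 1ℤ
tupleSum (suc m) P A = sum λ x → P x * tupleSum m (λ y → P y * A x y) A

cliqueSum-cong : ∀ {n} m {P Q : Fin n → ℤ} (A : Fin n → Fin n → ℤ) → P ≗ Q →
  cliqueSum m P A ≡ cliqueSum m Q A
cliqueSum-cong zero A P≗Q = refl
cliqueSum-cong {zero} (suc m) A P≗Q = refl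
cliqueSum-cong {suc n} (suc m) A P≗Q = cong₂ _+_
  (cong₂ _*_ (P≗Q zero) (cliqueSum-cong m _ λ i → cong (_* A zero (suc i)) (P≗Q (suc i))))
  (cliqueSum-cong (suc m) _ (P≗Q ∘ suc))

-- Double counting of subsets with a marked element: a subset of order `suc m` can be marked in
-- `suc m` ways. Since `A x x` vanishes, the weight `P y * A x y` is 0 at `y = x`, so the unmarked
-- part automatically avoids the mark.
cliqueSum-suc : ∀ {n} m (P : Fin n → ℤ) (A : Fin n → Fin n → ℤ) →
  (∀ x y → A x y ≡ A y x) → (∀ x → A x x ≡ 0ℤ) →
  + suc m * cliqueSum (suc m) P A ≡ sum λ x → P x * cliqueSum m (λ y → P y * A x y) A
cliqueSum-suc {zero} m P A A-sym A-irr = ℤ.*-zeroʳ (+ suc m)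
cliqueSum-suc {suc n} m P A A-sym A-irr = begin
  + suc m * (p * C m + cliqueSum (suc m) P′ A′)
    ≡⟨ ℤ.*-distribˡ-+ (+ suc m) (p * C m) _ ⟩
  + suc m * (p * C m) + + suc m * cliqueSum (suc m) P′ A′
    ≡⟨ cong (λ z → + suc m * (p * C m) + z)
         (cliqueSum-suc m P′ A′ (λ x y → A-sym (suc x) (suc y)) (A-irr ∘ suc)) ⟩
  + suc m * (p * C m) + sum (λ x → P′ x * cliqueSum m (λ y → P′ y * A′ x y) A′)
    ≡⟨ step m ⟩
  P zero * cliqueSum m (λ y → P y * A zero y) A
    + sum (λ x → P′ x * cliqueSum m (λ y → P y * A (suc x) y) A) ∎
  where
  p = P zero
  P′ = P ∘ suc
  A′ : Fin n → Fin n → ℤ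
  A′ i j = A (suc i) (suc j)
  P₀ : Fin n → ℤ
  P₀ i = P′ i * A zero (suc i)
  C : ℕ → ℤ
  C k = cliqueSum k P₀ A′

  move : ∀ m x → p * (P₀ x * cliqueSum m (λ y → P₀ y * A′ x y) A′) +
                 P′ x * cliqueSum (suc m) (λ y → P′ y * A′ x y) A′ ≡
                 P′ x * cliqueSum (suc m) (λ y → P y * A (suc x) y) A
  move m x = begin
    p * (P₀ x * cliqueSum m (λ y → P₀ y * A′ x y) A′) + P′ x * D
      ≡⟨ cong (λ z → p * (P₀ x * z) + P′ x * D) (cliqueSum-cong m A′ λ y →
           swap (P′ y) (A zero (suc y)) (A′ x y)) ⟩
    p * (P₀ x * B) + P′ x * D
      ≡⟨ cong (λ a → p * (P′ x * a * B) + P′ x * D) (A-sym zero (suc x)) ⟩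
    p * (P′ x * A (suc x) zero * B) + P′ x * D
      ≡⟨ collect p (P′ x) (A (suc x) zero) B D ⟩
    P′ x * (p * A (suc x) zero * B + D) ∎
    where
    B = cliqueSum m (λ y → P′ y * A′ x y * A zero (suc y)) A′
    D = cliqueSum (suc m) (λ y → P′ y * A′ x y) A′
    swap : ∀ a b c → a * b * c ≡ a * c * b
    swap = solve-∀
    collect : ∀ a b c d e → a * (b * c * d) + b * e ≡ b * (a * c * d + e)
    collect = solve-∀

  step : ∀ m →
    + suc m * (p * C m) + sum (λ x → P′ x * cliqueSum m (λ y → P′ y * A′ x y) A′) ≡
    P zero * cliqueSum m (λ y → P y * A zero y) A
      + sum (λ x → P′ x * cliqueSum m (λ y → P y * A (suc x) y) A)
  step zero = cong (_+ sum (λ x → P′ x * 1ℤ)) (ℤ.*-identityˡ (p * 1ℤ))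
  step (suc m) = begin
    + suc (suc m) * (p * C (suc m)) + S
      -- Among the subsets containing `zero`, one copy stands for the mark at `zero`; the other
      -- `suc m` copies stand for a mark elsewhere and are resolved by the induction hypothesis with
      -- weights `P₀`.
      ≡⟨ split (+ suc m) p (C (suc m)) S ⟩
    p * C (suc m) + (p * (+ suc m * C (suc m)) + S)
      ≡⟨ cong (λ z → p * C (suc m) + (p * z + S))
           (cliqueSum-suc m P₀ A′ (λ x y → A-sym (suc x) (suc y)) (A-irr ∘ suc)) ⟩
    p * C (suc m) + (p * sum (λ x → P₀ x * cliqueSum m (λ y → P₀ y * A′ x y) A′) + S)
      ≡⟨ cong (λ z → p * C (suc m) + (z + S)) (*-distribˡ-sum p (λ x → P₀ x * cliqueSum m (λ y → P₀ y * A′ x y) A′)) ⟩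
    p * C (suc m) + (sum (λ x → p * (P₀ x * cliqueSum m (λ y → P₀ y * A′ x y) A′)) + S)
      ≡⟨ cong (λ z → p * C (suc m) + z) (trans
           (sym (∑-distrib-+ (λ x → p * (P₀ x * cliqueSum m (λ y → P₀ y * A′ x y) A′))
                             (λ x → P′ x * cliqueSum (suc m) (λ y → P′ y * A′ x y) A′)))
           (sum-cong-≗ (move m))) ⟩
    p * C (suc m) + R
      -- With the mark at `zero`, the subsets that would contain `zero` a second time carry the
      -- factor `A zero zero`.
      ≡⟨ cong (_+ R) (drop (p) _ _) ⟨
    p * (p * 0ℤ * cliqueSum m (λ y → P′ y * A zero (suc y) * A zero (suc y)) A′ + C (suc m)) + R
      ≡⟨ cong (λ a → p * (p * a * cliqueSum m (λ y → P′ y * A zero (suc y) * A zero (suc y)) A′ + C (suc m)) +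
          R) (A-irr zero) ⟨
    p * (p * A zero zero * cliqueSum m (λ y → P′ y * A zero (suc y) * A zero (suc y)) A′ + C (suc m)) + R ∎
    where
    S = sum (λ x → P′ x * cliqueSum (suc m) (λ y → P′ y * A′ x y) A′)
    R = sum (λ x → P′ x * cliqueSum (suc m) (λ y → P y * A (suc x) y) A)
    split : ∀ k a b c → (1ℤ + k) * (a * b) + c ≡ a * b + (a * (k * b) + c)
    split = solve-∀
    drop : ∀ a b c → a * (a * 0ℤ * b + c) ≡ a * c
    drop = solve-∀

!*cliqueSum : ∀ {n} m (P : Fin n → ℤ) (A : Fin n → Fin n → ℤ) →
  (∀ x y → A x y ≡ A y x) → (∀ x → A x x ≡ 0ℤ) →
  + (m !) * cliqueSum m P A ≡ tupleSum m P A
!*cliqueSum zero P A A-sym A-irr = refl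
!*cliqueSum (suc m) P A A-sym A-irr = begin
  + (suc m ℕ.* m !) * cliqueSum (suc m) P A
    ≡⟨ cong (_* cliqueSum (suc m) P A) (trans (cong +_ (ℕ.*-comm (suc m) (m !))) (ℤ.pos-* (m !) (suc m))) ⟩
  + (m !) * + suc m * cliqueSum (suc m) P A
    ≡⟨ ℤ.*-assoc (+ (m !)) (+ suc m) _ ⟩
  + (m !) * (+ suc m * cliqueSum (suc m) P A)
    ≡⟨ cong (+ (m !) *_) (cliqueSum-suc m P A A-sym A-irr) ⟩
  + (m !) * sum (λ x → P x * cliqueSum m (λ y → P y * A x y) A)
    ≡⟨ *-distribˡ-sum (+ (m !)) (λ x → P x * cliqueSum m (λ y → P y * A x y) A) ⟩
  sum (λ x → + (m !) * (P x * cliqueSum m (λ y → P y * A x y) A))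
    ≡⟨ sum-cong-≗ (λ x → trans (swap (+ (m !)) (P x) _)
         (cong (P x *_) (!*cliqueSum m (λ y → P y * A x y) A A-sym A-irr))) ⟩
  sum (λ x → P x * tupleSum m (λ y → P y * A x y) A) ∎
  where
  swap : ∀ a b c → a * (b * c) ≡ b * (a * c)
  swap = solve-∀

-- Counting subsets by a Boolean clique test

countˡ : ∀ {X : Set} → (X → Bool) → List X → ℤ
countˡ f [] = 0ℤ
countˡ f (x ∷ xs) = ι (f x) + countˡ f xs

length-filter : ∀ {X : Set} {P : X → Set} (P? : ∀ x → Dec (P x)) (f : X → Bool) →
  (∀ x → does (P? x) ≡ f x) → ∀ xs → + length (filter P? xs) ≡ countˡ f xs
length-filter P? f eq [] = refl
length-filter P? f eq (x ∷ xs) with P? x | eq x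
... | yes _ | e = trans (cong (λ z → 1ℤ + z) (length-filter P? f eq xs)) (cong (λ b → ι b + countˡ f xs) e)
... | no _  | e = trans (length-filter P? f eq xs)
                    (trans (sym (ℤ.+-identityˡ _)) (cong (λ b → ι b + countˡ f xs) e))

countˡ-++ : ∀ {X : Set} (f : X → Bool) xs ys → countˡ f (xs ++ ys) ≡ countˡ f xs + countˡ f ys
countˡ-++ f [] ys = sym (ℤ.+-identityˡ _)
countˡ-++ f (x ∷ xs) ys = trans (cong (λ z → ι (f x) + z) (countˡ-++ f xs ys)) (sym (ℤ.+-assoc (ι (f x)) _ _))

countˡ-map : ∀ {X Y : Set} (f : Y → Bool) (g : X → Y) xs → countˡ f (map g xs) ≡ countˡ (f ∘ g) xs
countˡ-map f g [] = refl
countˡ-map f g (x ∷ xs) = cong (λ z → ι (f (g x)) + z) (countˡ-map f g xs)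

countˡ-∧ : ∀ {X : Set} b (f : X → Bool) xs → countˡ (λ x → b ∧ f x) xs ≡ ι b * countˡ f xs
countˡ-∧ b f [] = sym (ℤ.*-zeroʳ (ι b))
countˡ-∧ b f (x ∷ xs) = trans (cong₂ _+_ (ι-∧ b (f x)) (countˡ-∧ b f xs)) (sym (ℤ.*-distribˡ-+ (ι b) _ _))

countˡ-false : ∀ {X : Set} (f : X → Bool) → (∀ x → f x ≡ false) → ∀ xs → countˡ f xs ≡ 0ℤ
countˡ-false f eq [] = refl
countˡ-false f eq (x ∷ xs) = cong₂ (λ b c → ι b + c) (eq x) (countˡ-false f eq xs)

-- Follows the recursion of `cliqueSum`, so that `count-cliqueᵇ` is an induction along `allSubsets`.
-- Agreement with `isClique?` is then a statement about one subset at a time.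
cliqueᵇ : ∀ {n} → ℕ → (Fin n → Bool) → (Fin n → Fin n → Bool) → Subset n → Bool
cliqueᵇ m P A (outside ∷ S) = cliqueᵇ m (P ∘ suc) (λ i j → A (suc i) (suc j)) S
cliqueᵇ zero    P A [] = true
cliqueᵇ (suc m) P A [] = false
cliqueᵇ zero    P A (inside ∷ S) = false
cliqueᵇ (suc m) P A (inside ∷ S) =
  P zero ∧ cliqueᵇ m (λ i → P (suc i) ∧ A zero (suc i)) (λ i j → A (suc i) (suc j)) S

count-cliqueᵇ : ∀ {n} m (P : Fin n → Bool) (A : Fin n → Fin n → Bool) →
  countˡ (cliqueᵇ m P A) (allSubsets n) ≡ cliqueSum m (ι ∘ P) (λ x y → ι (A x y))
count-cliqueᵇ {zero} zero P A = refl
count-cliqueᵇ {zero} (suc m) P A = refl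
count-cliqueᵇ {suc n} zero P A =
  trans (countˡ-++ (cliqueᵇ zero P A) (map (inside ∷_) (allSubsets n)) _)
  (cong₂ _+_
    (trans (countˡ-map _ (inside ∷_) (allSubsets n)) (countˡ-false _ (λ _ → refl) (allSubsets n)))
    (trans (countˡ-map _ (outside ∷_) (allSubsets n)) (count-cliqueᵇ zero (P ∘ suc) _)))
count-cliqueᵇ {suc n} (suc m) P A =
  trans (countˡ-++ (cliqueᵇ (suc m) P A) (map (inside ∷_) (allSubsets n)) _)
  (cong₂ _+_
    (trans (countˡ-map _ (inside ∷_) (allSubsets n))
    (trans (countˡ-∧ (P zero) _ (allSubsets n))
    (cong (ι (P zero) *_)
    (trans (count-cliqueᵇ m _ _) (cliqueSum-cong m _ λ i → ι-∧ (P (suc i)) (A zero (suc i)))))))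
    (trans (countˡ-map _ (outside ∷_) (allSubsets n)) (count-cliqueᵇ (suc m) (P ∘ suc) _)))

-- The condition `P` on single vertices makes the induction possible: after `zero` has been put into
-- the subset, it records adjacency to `zero`.
Clique : ∀ {n} → ℕ → (Fin n → Bool) → (Fin n → Fin n → Bool) → Subset n → Set
Clique m P A S = (Subset.∣ S ∣ ≡ m) × (∀ x → x ∈ S → P x ≡ true) ×
                 (∀ x → x ∈ S → ∀ y → y ∈ S → x ≢ y → A x y ≡ true)

cliqueᵇ-sound : ∀ {n} m P (A : Fin n → Fin n → Bool) → (∀ x y → A x y ≡ A y x) →
  ∀ S → cliqueᵇ m P A S ≡ true → Clique m P A S
cliqueᵇ-sound m P A A-sym (outside ∷ S) e
  with cliqueᵇ-sound m _ _ (λ x y → A-sym (suc x) (suc y)) S e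
... | c , v , a = c , (λ { (suc x) (there x∈S) → v x x∈S })
                    , (λ { (suc x) (there x∈S) (suc y) (there y∈S) x≢y → a x x∈S y y∈S (x≢y ∘ cong suc) })
cliqueᵇ-sound zero P A A-sym [] e = refl , (λ _ ()) , (λ _ ())
cliqueᵇ-sound zero P A A-sym (inside ∷ S) ()
cliqueᵇ-sound (suc m) P A A-sym (inside ∷ S) e
  with cliqueᵇ-sound m _ _ (λ x y → A-sym (suc x) (suc y)) S (∧-conicalʳ (P zero) _ e)
... | c , v , a = cong suc c , vs , as
  where
  vs : ∀ x → x ∈ inside ∷ S → P x ≡ true
  vs zero here = ∧-conicalˡ (P zero) _ e
  vs (suc x) (there x∈S) = ∧-conicalˡ (P (suc x)) _ (v x x∈S)
  as : ∀ x → x ∈ inside ∷ S → ∀ y → y ∈ inside ∷ S → x ≢ y → A x y ≡ true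
  as zero _ zero _ 0≢0 = contradiction refl 0≢0
  as zero _ (suc y) (there y∈S) _ = ∧-conicalʳ (P (suc y)) _ (v y y∈S)
  as (suc x) (there x∈S) zero _ _ = trans (A-sym (suc x) zero) (∧-conicalʳ (P (suc x)) _ (v x x∈S))
  as (suc x) (there x∈S) (suc y) (there y∈S) x≢y = a x x∈S y y∈S (x≢y ∘ cong suc)

cliqueᵇ-complete : ∀ {n} m P (A : Fin n → Fin n → Bool) →
  ∀ S → Clique m P A S → cliqueᵇ m P A S ≡ true
cliqueᵇ-complete m P A (outside ∷ S) (c , v , a) = cliqueᵇ-complete m _ _ S (c
    , (λ x x∈S → v (suc x) (there x∈S))
    , (λ x x∈S y y∈S x≢y → a (suc x) (there x∈S) (suc y) (there y∈S) (x≢y ∘ suc-injective)))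
cliqueᵇ-complete zero P A [] (_ , _ , _) = refl
cliqueᵇ-complete (suc m) P A [] (() , _ , _)
cliqueᵇ-complete zero P A (inside ∷ S) (() , _ , _)
cliqueᵇ-complete (suc m) P A (inside ∷ S) (c , v , a) = cong₂ _∧_ (v zero here)
  (cliqueᵇ-complete m _ _ S (ℕ.suc-injective c
    , (λ x x∈S → cong₂ _∧_ (v (suc x) (there x∈S)) (a zero here (suc x) (there x∈S) λ ()))
    , (λ x x∈S y y∈S x≢y → a (suc x) (there x∈S) (suc y) (there y∈S) (x≢y ∘ suc-injective))))

does-true : ∀ {P : Set} (P? : Dec P) → does P? ≡ true → P
does-true (yes p) _ = p

𝒦-cliqueSum : ∀ {n} {Adj : Rel (Fin n) 0ℓ} (adj? : Decidable Adj) → Symmetric Adj → ∀ m →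
  + 𝒦 m adj? ≡ cliqueSum m (λ _ → 1ℤ) (λ x y → ι (does (adj? x y)))
𝒦-cliqueSum {n} {Adj} adj? Adj-sym m =
  trans (length-filter (λ S → (Subset.∣ S ∣ ℕ.≟ m) ×-dec isClique? adj? S) (cliqueᵇ m (λ _ → true) A) same
      (allSubsets n))
        (count-cliqueᵇ m (λ _ → true) A)
  where
  A : Fin n → Fin n → Bool
  A x y = does (adj? x y)
  A-sym : ∀ x y → A x y ≡ A y x
  A-sym x y with adj? x y | adj? y x
  ... | yes _ | yes _ = refl
  ... | no  _ | no  _ = refl
  ... | yes a | no ¬a = contradiction (Adj-sym a) ¬a
  ... | no ¬a | yes a = contradiction (Adj-sym a) ¬a
  same : ∀ S → does ((Subset.∣ S ∣ ℕ.≟ m) ×-dec isClique? adj? S) ≡ cliqueᵇ m (λ _ → true) A S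
  same S with cliqueᵇ m (λ _ → true) A S in e
  ... | true = let c , _ , a = cliqueᵇ-sound m _ A A-sym S e in
    dec-true ((Subset.∣ S ∣ ℕ.≟ m) ×-dec isClique? adj? S)
      (c , λ x x∈S y y∈S x≢y → does-true (adj? x y) (a x x∈S y y∈S x≢y))
  ... | false = dec-false ((Subset.∣ S ∣ ℕ.≟ m) ×-dec isClique? adj? S) λ (c , a) →
    contradiction (trans (sym e) (cliqueᵇ-complete m _ A S
      (c , (λ _ _ → refl) , λ x x∈S y y∈S x≢y → dec-true (adj? x y) (a x x∈S y y∈S x≢y)))) λ ()

𝒦-tupleSum : ∀ {n} {Adj : Rel (Fin n) 0ℓ} (adj? : Decidable Adj) →
  Symmetric Adj → (∀ x → ¬ Adj x x) → ∀ m →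
  + (m !) * + 𝒦 m adj? ≡ tupleSum m (λ _ → 1ℤ) (λ x y → ι (does (adj? x y)))
𝒦-tupleSum adj? Adj-sym Adj-irr m =
  trans (cong (+ (m !) *_) (𝒦-cliqueSum adj? Adj-sym m))
    (!*cliqueSum m (λ _ → 1ℤ) _
      (λ x y → cong ι (A-sym x y))
      (λ x → cong ι (dec-false (adj? x x) (Adj-irr x))))
  where
  A-sym : ∀ x y → does (adj? x y) ≡ does (adj? y x)
  A-sym x y with adj? x y | adj? y x
  ... | yes _ | yes _ = refl
  ... | no  _ | no  _ = refl
  ... | yes a | no ¬a = contradiction (Adj-sym a) ¬a
  ... | no ¬a | yes a = contradiction (Adj-sym a) ¬a

-- The quadratic character of a finite field

-- A finite field of odd order in which -1 is a square. The carrier is `Fin q` so that sums over the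
-- field are ordinary finite sums; the homomorphism `⟦_⟧` supplies integer coefficients to the ring
-- solver.
record FiniteField (q : ℕ) : Set where
  infixl 6 _⊕_
  infixl 7 _⊗_
  infix  8 ⊖_
  field
    _⊕_ _⊗_ : Fin q → Fin q → Fin q
    ⊖_ : Fin q → Fin q
    ⟦_⟧ : ℤ → Fin q
    isCommutativeRing : IsCommutativeRing _≡_ _⊕_ _⊗_ ⊖_ ⟦ 0ℤ ⟧ ⟦ 1ℤ ⟧
    ⟦⟧-+ : ∀ i j → ⟦ i + j ⟧ ≡ ⟦ i ⟧ ⊕ ⟦ j ⟧
    ⟦⟧-* : ∀ i j → ⟦ i * j ⟧ ≡ ⟦ i ⟧ ⊗ ⟦ j ⟧
    ⟦⟧-neg : ∀ i → ⟦ - i ⟧ ≡ ⊖ ⟦ i ⟧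
    inverse : ∀ x → x ≢ ⟦ 0ℤ ⟧ → ∃[ y ] x ⊗ y ≡ ⟦ 1ℤ ⟧
    1≢0 : ⟦ 1ℤ ⟧ ≢ ⟦ 0ℤ ⟧
    2≢0 : ⟦ + 2 ⟧ ≢ ⟦ 0ℤ ⟧
    √-1 : Fin q
    √-1² : √-1 ⊗ √-1 ≡ ⊖ ⟦ 1ℤ ⟧
  0# 1# : Fin q
  0# = ⟦ 0ℤ ⟧
  1# = ⟦ 1ℤ ⟧

module Character {q : ℕ} (K : FiniteField q) where
  open FiniteField K public

  commutativeRing : CommutativeRing _ _
  commutativeRing = record { isCommutativeRing = isCommutativeRing }

  private
    homomorphism : CommutativeRing.rawRing ℤ.+-*-commutativeRing
                     -Raw-AlmostCommutative⟶ fromCommutativeRing commutativeRing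
    homomorphism = record
      { ⟦_⟧ = ⟦_⟧ ; +-homo = ⟦⟧-+ ; *-homo = ⟦⟧-* ; -‿homo = ⟦⟧-neg ; 0-homo = refl ; 1-homo = refl }

    ⟦⟧-≟ : ∀ i j → Maybe (⟦ i ⟧ ≡ ⟦ j ⟧)
    ⟦⟧-≟ i j with i ℤ.≟ j
    ... | yes refl = just refl
    ... | no _ = nothing

  open RingSolver (CommutativeRing.rawRing ℤ.+-*-commutativeRing) (fromCommutativeRing commutativeRing)
    homomorphism ⟦⟧-≟ public using (solve; con; _:+_; _:*_; :-_; _:-_; _:=_)

  infixl 6 _⊝_
  _⊝_ : Fin q → Fin q → Fin q
  x ⊝ y = x ⊕ ⊖ y

  open CommutativeRing commutativeRing public
    using ()
    renaming (zeroˡ to ⊗-zeroˡ; zeroʳ to ⊗-zeroʳ; *-comm to ⊗-comm; *-identityˡ to ⊗-identityˡ)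

  ⊝≡0⇒≡ : ∀ x y → x ⊝ y ≡ 0# → x ≡ y
  ⊝≡0⇒≡ x y e = trans (solve 2 (λ x y → x := y :+ (x :- y)) refl x y)
    (trans (cong (y ⊕_) e) (solve 1 (λ y → y :+ con 0ℤ := y) refl y))

  ⊗≡0 : ∀ x y → x ⊗ y ≡ 0# → x ≡ 0# ⊎ y ≡ 0#
  ⊗≡0 x y e with x ≟ 0#
  ... | yes x≡0 = inj₁ x≡0
  ... | no x≢0 with inverse x x≢0
  ...   | x⁻¹ , inv = inj₂ (begin
    y               ≡⟨ ⊗-identityˡ y ⟨
    1# ⊗ y          ≡⟨ cong (_⊗ y) inv ⟨
    x ⊗ x⁻¹ ⊗ y     ≡⟨ solve 3 (λ x z y → x :* z :* y := z :* (x :* y)) refl x x⁻¹ y ⟩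
    x⁻¹ ⊗ (x ⊗ y)   ≡⟨ cong (x⁻¹ ⊗_) e ⟩
    x⁻¹ ⊗ 0#        ≡⟨ ⊗-zeroʳ x⁻¹ ⟩
    0#              ∎)
    where open ≡-Reasoning

  ⊗≢0 : ∀ {x y} → x ≢ 0# → y ≢ 0# → x ⊗ y ≢ 0#
  ⊗≢0 {x} {y} x≢0 y≢0 e = [ x≢0 , y≢0 ]′ (⊗≡0 x y e)

  ⊗-cancelˡ : ∀ x y z → x ≢ 0# → x ⊗ y ≡ x ⊗ z → y ≡ z
  ⊗-cancelˡ x y z x≢0 e = ⊝≡0⇒≡ y z ([ (λ x≡0 → contradiction x≡0 x≢0) , (λ p → p) ]′
    (⊗≡0 x (y ⊝ z) (trans (solve 3 (λ x y z → x :* (y :- z) := x :* y :- x :* z) refl x y z)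
      (trans (cong (_⊝ x ⊗ z) e) (solve 1 (λ x → x :- x := con 0ℤ) refl (x ⊗ z))))))

  square≡ : ∀ x y → x ⊗ x ≡ y ⊗ y → x ≡ y ⊎ x ≡ ⊖ y
  square≡ x y e with ⊗≡0 (x ⊝ y) (x ⊕ y)
    (trans (solve 2 (λ x y → (x :- y) :* (x :+ y) := x :* x :- y :* y) refl x y)
      (trans (cong (_⊝ y ⊗ y) e) (solve 1 (λ x → x :- x := con 0ℤ) refl (y ⊗ y))))
  ... | inj₁ p = inj₁ (⊝≡0⇒≡ x y p)
  ... | inj₂ p = inj₂ (⊝≡0⇒≡ x (⊖ y) (trans (solve 2 (λ x y → x :- :- y := x :+ y) refl x y) p))

  ⊖≢0 : ∀ {x} → x ≢ 0# → ⊖ x ≢ 0#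
  ⊖≢0 {x} x≢0 e = x≢0 (trans (solve 1 (λ x → x := :- :- x) refl x)
    (trans (cong ⊖_ e) (solve 0 (:- con 0ℤ := con 0ℤ) refl)))

  x≢⊖x : ∀ {x} → x ≢ 0# → x ≢ ⊖ x
  x≢⊖x {x} x≢0 e = ⊗≢0 2≢0 x≢0 (trans (solve 1 (λ x → con (+ 2) :* x := x :+ x) refl x)
    (trans (cong (x ⊕_) e) (solve 1 (λ x → x :- x := con 0ℤ) refl x)))

  4≢0 : ⟦ + 4 ⟧ ≢ 0#
  4≢0 e = ⊗≢0 2≢0 2≢0 (trans (solve 0 (con (+ 2) :* con (+ 2) := con (+ 4)) refl) e)

  ∑ : (Fin q → ℤ) → ℤ
  ∑ = sum

  ∑-cong : ∀ {f g} → (∀ x → f x ≡ g x) → ∑ f ≡ ∑ g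
  ∑-cong = sum-cong-≗

  ∑-+ : ∀ f g → ∑ (λ x → f x + g x) ≡ ∑ f + ∑ g
  ∑-+ = ∑-distrib-+

  ∑-*ˡ : ∀ c f → ∑ (λ x → c * f x) ≡ c * ∑ f
  ∑-*ˡ c f = sym (*-distribˡ-sum c f)

  ∑-*ʳ : ∀ f c → ∑ (λ x → f x * c) ≡ ∑ f * c
  ∑-*ʳ f c = trans (∑-cong λ x → ℤ.*-comm (f x) c) (trans (∑-*ˡ c f) (ℤ.*-comm c (∑ f)))

  ∑-comm : ∀ (f : Fin q → Fin q → ℤ) → ∑ (λ x → ∑ (f x)) ≡ ∑ (λ y → ∑ (λ x → f x y))
  ∑-comm = sum-comm

  -- Once a summand is expanded into such a list, `∑-lincomb` sums all its terms at once. The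
  -- factors `1ℤ` and the final `0ℤ` in the expansions below are the shape that this encoding
  -- produces.
  lincomb : List (ℤ × (Fin q → ℤ)) → Fin q → ℤ
  lincomb [] x = 0ℤ
  lincomb ((c , f) ∷ fs) x = c * f x + lincomb fs x

  lincomb∑ : List (ℤ × (Fin q → ℤ)) → ℤ
  lincomb∑ [] = 0ℤ
  lincomb∑ ((c , f) ∷ fs) = c * ∑ f + lincomb∑ fs

  ∑-0 : ∑ (λ _ → 0ℤ) ≡ 0ℤ
  ∑-0 = ∑-*ˡ 0ℤ (λ _ → 0ℤ)

  ∑-lincomb : ∀ fs → ∑ (lincomb fs) ≡ lincomb∑ fs
  ∑-lincomb [] = ∑-0
  ∑-lincomb ((c , f) ∷ fs) = trans (∑-+ (λ x → c * f x) (lincomb fs)) (cong₂ _+_ (∑-*ˡ c f) (∑-lincomb fs))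

  ∑-1 : ∑ (λ _ → 1ℤ) ≡ + q
  ∑-1 = sum-1 q
    where
    sum-1 : ∀ n → sum {n} (λ _ → 1ℤ) ≡ + n
    sum-1 zero = refl
    sum-1 (suc n) = cong (λ z → 1ℤ + z) (sum-1 n)

  ∑-reindex : ∀ f (σ τ : Fin q → Fin q) → (∀ x → σ (τ x) ≡ x) → (∀ x → τ (σ x) ≡ x) →
    ∑ f ≡ ∑ (λ x → f (σ x))
  ∑-reindex f σ τ στ τσ = sum-permute f (permutation σ τ στ τσ)

  ∑-affine : ∀ f a b → a ≢ 0# → ∑ f ≡ ∑ (λ x → f (a ⊗ x ⊕ b))
  ∑-affine f a b a≢0 with inverse a a≢0
  ... | a⁻¹ , inv = ∑-reindex f (λ x → a ⊗ x ⊕ b) (λ x → a⁻¹ ⊗ (x ⊝ b))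
    (λ x → begin
      a ⊗ (a⁻¹ ⊗ (x ⊝ b)) ⊕ b ≡⟨ solve 4 (λ a c x b → a :* (c :* (x :- b)) :+ b := a :* c :* (x :- b) :+ b) refl
          a a⁻¹ x b ⟩
      a ⊗ a⁻¹ ⊗ (x ⊝ b) ⊕ b   ≡⟨ cong (λ u → u ⊗ (x ⊝ b) ⊕ b) inv ⟩
      1# ⊗ (x ⊝ b) ⊕ b        ≡⟨ solve 2 (λ x b → con 1ℤ :* (x :- b) :+ b := x) refl x b ⟩
      x ∎)
    (λ x → begin
      a⁻¹ ⊗ (a ⊗ x ⊕ b ⊝ b)   ≡⟨ solve 4 (λ a c x b → c :* (a :* x :+ b :- b) := a :* c :* x) refl a a⁻¹ x b ⟩
      a ⊗ a⁻¹ ⊗ x             ≡⟨ cong (_⊗ x) inv ⟩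
      1# ⊗ x                  ≡⟨ ⊗-identityˡ x ⟩
      x ∎)
    where open ≡-Reasoning

  ∑-shift : ∀ f a → ∑ f ≡ ∑ (λ x → f (x ⊕ a))
  ∑-shift f a = trans (∑-affine f 1# a 1≢0) (∑-cong λ x → cong (λ u → f (u ⊕ a)) (⊗-identityˡ x))

  ∑-scale : ∀ f a → a ≢ 0# → ∑ f ≡ ∑ (λ x → f (a ⊗ x))
  ∑-scale f a a≢0 = trans (∑-affine f a 0# a≢0)
    (∑-cong λ x → cong f (solve 2 (λ a x → a :* x :+ con 0ℤ := a :* x) refl a x))

  δ : ∀ {n} → Fin n → Fin n → ℤ
  δ x y = if does (x ≟ y) then 1ℤ else 0ℤ

  δ-≡ : ∀ {x y : Fin q} → x ≡ y → δ x y ≡ 1ℤ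
  δ-≡ {x} {y} e = cong (λ b → if b then 1ℤ else 0ℤ) (dec-true (x ≟ y) e)

  δ-≢ : ∀ {x y : Fin q} → x ≢ y → δ x y ≡ 0ℤ
  δ-≢ {x} {y} e = cong (λ b → if b then 1ℤ else 0ℤ) (dec-false (x ≟ y) e)

  δ-cong : ∀ {x y u v : Fin q} → (x ≡ y → u ≡ v) → (u ≡ v → x ≡ y) → δ x y ≡ δ u v
  δ-cong {x} {y} {u} {v} to from with u ≟ v
  ... | yes u≡v = δ-≡ (from u≡v)
  ... | no u≢v = δ-≢ (u≢v ∘ to)

  δ-* : ∀ (f : Fin q → ℤ) x y → δ x y * f x ≡ δ x y * f y
  δ-* f x y with x ≟ y
  ... | yes x≡y = cong (λ u → 1ℤ * f u) x≡y
  ... | no _ = refl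

  ∑-δ : ∀ f a → ∑ (λ x → δ x a * f x) ≡ f a
  ∑-δ f a = sum-δ f a
    where
    sum-0 : ∀ n (f : Fin n → ℤ) → sum (λ x → 0ℤ * f x) ≡ 0ℤ
    sum-0 n f = sym (*-distribˡ-sum 0ℤ f)
    sum-δ : ∀ {n} (f : Fin n → ℤ) a → sum (λ x → δ x a * f x) ≡ f a
    sum-δ {suc n} f zero = trans (cong₂ _+_ (ℤ.*-identityˡ (f zero)) (sum-0 n (f ∘ suc))) (ℤ.+-identityʳ _)
    sum-δ {suc n} f (suc a) = trans (ℤ.+-identityˡ _) (sum-δ (f ∘ suc) a)

  ∑-δ-1 : ∀ a → ∑ (λ x → δ x a) ≡ 1ℤ
  ∑-δ-1 a = trans (∑-cong λ x → sym (ℤ.*-identityʳ (δ x a))) (∑-δ (λ _ → 1ℤ) a)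

  δ-comm : ∀ (x y : Fin q) → δ x y ≡ δ y x
  δ-comm x y = δ-cong {x} {y} {y} {x} sym sym

  ∑-δ′ : ∀ f a → ∑ (λ x → δ a x * f x) ≡ f a
  ∑-δ′ f a = trans (∑-cong λ x → cong (_* f x) (δ-comm a x)) (∑-δ f a)

  -- Insert 1 = ∑ `δ (h x) y` over `y` and exchange the sums. Used for non-injective substitutions,
  -- whose fibre sizes are then evaluated by `χ`.
  ∑-fibre : ∀ (h : Fin q → Fin q) (f : Fin q → ℤ) →
    ∑ (λ x → f (h x)) ≡ ∑ (λ y → ∑ (λ x → δ (h x) y) * f y)
  ∑-fibre h f = begin
    ∑ (λ x → f (h x))                         ≡⟨ ∑-cong (λ x → ∑-δ′ f (h x)) ⟨
    ∑ (λ x → ∑ (λ y → δ (h x) y * f y))       ≡⟨ ∑-comm (λ x y → δ (h x) y * f y) ⟩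
    ∑ (λ y → ∑ (λ x → δ (h x) y * f y))       ≡⟨ ∑-cong (λ y → ∑-*ʳ (λ x → δ (h x) y) (f y)) ⟩
    ∑ (λ y → ∑ (λ x → δ (h x) y) * f y)       ∎
    where open ≡-Reasoning

  abstract
    -- An element has 0, 1 or 2 square roots, which gives the values -1, 0 and 1. With the root
    -- count as definition, `∑-square` is immediate from `∑-fibre`.
    χ : Fin q → ℤ
    χ y = ∑ (λ x → δ (x ⊗ x) y) - 1ℤ

    roots≡1+χ : ∀ y → ∑ (λ x → δ (x ⊗ x) y) ≡ 1ℤ + χ y
    roots≡1+χ y = add-sub (∑ (λ x → δ (x ⊗ x) y))
      where
      add-sub : ∀ a → a ≡ 1ℤ + (a - 1ℤ)
      add-sub = solve-∀

    χ≡roots-1 : ∀ y → χ y ≡ ∑ (λ x → δ (x ⊗ x) y) - 1ℤ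
    χ≡roots-1 y = refl

  χ-0 : χ 0# ≡ 0ℤ
  χ-0 = trans (χ≡roots-1 0#) (cong (_- 1ℤ) (trans
    (∑-cong λ x → δ-cong (λ e → [ (λ p → p) , (λ p → p) ]′ (⊗≡0 x x e)) (λ { refl → ⊗-zeroˡ 0# }))
    (∑-δ-1 0#)))

  δ-square : ∀ {y} → y ≢ 0# → ∀ x → δ (x ⊗ x) (y ⊗ y) ≡ δ x y + δ x (⊖ y)
  δ-square {y} y≢0 x with x ≟ y
  ... | yes refl = trans (δ-≡ {y ⊗ y} refl) (cong (λ z → 1ℤ + z) (sym (δ-≢ (x≢⊖x y≢0))))
  ... | no x≢y with x ≟ ⊖ y
  ...   | yes refl = δ-≡ (solve 1 (λ y → :- y :* :- y := y :* y) refl y)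
  ...   | no x≢⊖y = δ-≢ (λ e → [ x≢y , x≢⊖y ]′ (square≡ x y e))

  χ-square : ∀ {y} → y ≢ 0# → χ (y ⊗ y) ≡ 1ℤ
  χ-square {y} y≢0 = trans (χ≡roots-1 (y ⊗ y)) (cong (_- 1ℤ) (trans (∑-cong (δ-square y≢0))
    (trans (∑-+ (λ x → δ x y) (λ x → δ x (⊖ y))) (cong₂ _+_ (∑-δ-1 y) (∑-δ-1 (⊖ y))))))

  χ-nonsquare : ∀ {x} → (∀ y → y ⊗ y ≢ x) → χ x ≡ -1ℤ
  χ-nonsquare {x} ns = trans (χ≡roots-1 x) (cong (_- 1ℤ) (trans (∑-cong λ y → δ-≢ (ns y)) ∑-0))

  data Class (x : Fin q) : Set where
    isZero    : x ≡ 0# → Class x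
    square    : ∀ y → y ≢ 0# → x ≡ y ⊗ y → Class x
    nonsquare : (∀ y → y ⊗ y ≢ x) → Class x

  classify : ∀ x → Class x
  classify x with any? (λ y → y ⊗ y ≟ x)
  ... | no ¬p = nonsquare λ y e → ¬p (y , e)
  ... | yes (y , refl) with y ≟ 0#
  ...   | yes refl = isZero (⊗-zeroˡ 0#)
  ...   | no y≢0 = square y y≢0 refl

  -- Each `x` is a root of exactly one `y`, so the root counts 1 + `χ y` add up to `q`.
  ∑χ : ∑ χ ≡ 0ℤ
  ∑χ = begin
    ∑ χ                                            ≡⟨ add-sub (+ q) (∑ χ) ⟩
    (+ q + ∑ χ) - + q                              ≡⟨ cong (λ z → (z + ∑ χ) - + q) ∑-1 ⟨
    (∑ (λ _ → 1ℤ) + ∑ χ) - + q                     ≡⟨ cong (_- + q) (∑-+ (λ _ → 1ℤ) χ) ⟨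
    ∑ (λ y → 1ℤ + χ y) - + q                       ≡⟨ cong (_- + q)
        (∑-cong λ y → trans (sym (roots≡1+χ y)) (sym (ℤ.*-identityʳ _))) ⟩
    ∑ (λ y → ∑ (λ x → δ (x ⊗ x) y) * 1ℤ) - + q     ≡⟨ cong (_- + q) (∑-fibre (λ x → x ⊗ x) (λ _ → 1ℤ)) ⟨
    ∑ (λ _ → 1ℤ) - + q                             ≡⟨ cong (_- + q) ∑-1 ⟩
    + q - + q                                      ≡⟨ ℤ.+-inverseʳ (+ q) ⟩
    0ℤ ∎
    where
    add-sub : ∀ a b → b ≡ (a + b) - a
    add-sub = solve-∀

  ∑-square : ∀ f → ∑ (λ x → f (x ⊗ x)) ≡ ∑ (λ y → (1ℤ + χ y) * f y)
  ∑-square f = trans (∑-fibre (λ x → x ⊗ x) f) (∑-cong λ y → cong (_* f y) (roots≡1+χ y))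

sum-nonpos : ∀ {n} (f : Fin n → ℤ) → (∀ x → f x ≤ 0ℤ) → sum f ≤ 0ℤ
sum-nonpos {zero} f f≤0 = ℤ.≤-refl
sum-nonpos {suc n} f f≤0 = ℤ.+-mono-≤ (f≤0 zero) (sum-nonpos (f ∘ suc) (f≤0 ∘ suc))

sum-nonpos≡0 : ∀ {n} (f : Fin n → ℤ) → (∀ x → f x ≤ 0ℤ) → sum f ≡ 0ℤ → ∀ x → f x ≡ 0ℤ
sum-nonpos≡0 {suc n} f f≤0 e = go
  where
  r = sum (f ∘ suc)
  r≤0 : r ≤ 0ℤ
  r≤0 = sum-nonpos (f ∘ suc) (f≤0 ∘ suc)
  f0≡0 : f zero ≡ 0ℤ
  f0≡0 = ℤ.≤-antisym (f≤0 zero)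
    (subst₂ _≤_ e (ℤ.+-identityʳ (f zero)) (ℤ.+-monoʳ-≤ (f zero) r≤0))
  go : ∀ x → f x ≡ 0ℤ
  go zero = f0≡0
  go (suc x) = sum-nonpos≡0 (f ∘ suc) (f≤0 ∘ suc)
    (trans (sym (ℤ.+-identityˡ r)) (trans (cong (_+ r) (sym f0≡0)) e)) x

-- Multiplicativity of the character and complete quadratic sums

module CharacterSums {q : ℕ} (K : FiniteField q) where
  open Character K

  -- Multiplication by `z` carries the square roots of `x` bijectively to those of `z ⊗ z ⊗ x`.
  χ-square-* : ∀ {z} → z ≢ 0# → ∀ x → χ (z ⊗ z ⊗ x) ≡ χ x
  χ-square-* {z} z≢0 x = begin
    χ (z ⊗ z ⊗ x)                                        ≡⟨ χ≡roots-1 (z ⊗ z ⊗ x) ⟩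
    ∑ (λ u → δ (u ⊗ u) (z ⊗ z ⊗ x)) - 1ℤ                 ≡⟨ cong (_- 1ℤ) (∑-scale _ z z≢0) ⟩
    ∑ (λ u → δ (z ⊗ u ⊗ (z ⊗ u)) (z ⊗ z ⊗ x)) - 1ℤ       ≡⟨ cong (_- 1ℤ) (∑-cong λ u → δ-cong
                                                              {z ⊗ u ⊗ (z ⊗ u)} {z ⊗ z ⊗ x} {u ⊗ u} {x}
                                                              (λ e → ⊗-cancelˡ (z ⊗ z) (u ⊗ u) x (⊗≢0 z≢0 z≢0)
                                                                  (trans (sym (rearr u)) e))
                                                              (λ e → trans (rearr u) (cong (z ⊗ z ⊗_) e))) ⟩
    ∑ (λ u → δ (u ⊗ u) x) - 1ℤ                           ≡⟨ χ≡roots-1 x ⟨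
    χ x ∎
    where
    rearr : ∀ u → z ⊗ u ⊗ (z ⊗ u) ≡ z ⊗ z ⊗ (u ⊗ u)
    rearr u = solve 2 (λ z u → z :* u :* (z :* u) := z :* z :* (u :* u)) refl z u

  χ≤1 : ∀ x → χ x ≤ 1ℤ
  χ≤1 x with classify x
  ... | isZero refl = subst (_≤ 1ℤ) (sym χ-0) (+≤+ ℕ.z≤n)
  ... | square y y≢0 refl = ℤ.≤-reflexive (χ-square y≢0)
  ... | nonsquare ns = subst (_≤ 1ℤ) (sym (χ-nonsquare ns)) -≤+

  nonsquare≢0 : ∀ {x} → (∀ y → y ⊗ y ≢ x) → x ≢ 0#
  nonsquare≢0 ns refl = ns 0# (⊗-zeroˡ 0#)

  -- The sum of χ (n ⊗ x) + χ x over all x vanishes, and no term of it is positive.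
  χ-nonsquare-* : ∀ {n} → (∀ y → y ⊗ y ≢ n) → ∀ x → χ (n ⊗ x) ≡ - χ x
  χ-nonsquare-* {n} ns x = begin
    χ (n ⊗ x)                 ≡⟨ add-sub (χ (n ⊗ x)) (χ x) ⟩
    χ (n ⊗ x) + χ x - χ x     ≡⟨ cong (_- χ x) (sum-nonpos≡0 h h≤0 ∑h≡0 x) ⟩
    0ℤ - χ x                  ≡⟨ ℤ.+-identityˡ _ ⟩
    - χ x ∎
    where
    h : Fin q → ℤ
    h x = χ (n ⊗ x) + χ x
    add-sub : ∀ a b → a ≡ a + b - b
    add-sub = solve-∀
    ∑h≡0 : ∑ h ≡ 0ℤ
    ∑h≡0 = trans (∑-+ (λ x → χ (n ⊗ x)) χ)
      (cong₂ _+_ (trans (sym (∑-scale χ n (nonsquare≢0 ns))) ∑χ) ∑χ)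
    h≤0 : ∀ x → h x ≤ 0ℤ
    h≤0 x with classify x
    ... | isZero refl = ℤ.≤-reflexive (cong₂ _+_ (trans (cong χ (⊗-zeroʳ n)) χ-0) χ-0)
    ... | square y y≢0 refl = ℤ.≤-reflexive (cong₂ _+_
            (trans (cong χ (⊗-comm n (y ⊗ y))) (trans (χ-square-* y≢0 n) (χ-nonsquare ns))) (χ-square y≢0))
    -- Here `χ x` is -1, so the bound `χ≤1` on the other term is enough. That `n ⊗ x` is a square in
    -- this case comes out of the vanishing of the whole sum.
    ... | nonsquare ns′ = subst (λ z → χ (n ⊗ x) + z ≤ 0ℤ) (sym (χ-nonsquare ns′)) (ℤ.+-monoˡ-≤ -1ℤ (χ≤1 (n ⊗ x)))

  χ-* : ∀ x y → χ (x ⊗ y) ≡ χ x * χ y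
  χ-* x y with classify x
  ... | isZero refl = trans (cong χ (⊗-zeroˡ y)) (trans χ-0 (cong (_* χ y) (sym χ-0)))
  ... | square z z≢0 refl = trans (χ-square-* z≢0 y)
          (trans (sym (ℤ.*-identityˡ (χ y))) (cong (_* χ y) (sym (χ-square z≢0))))
  ... | nonsquare ns = trans (χ-nonsquare-* ns y)
          (trans (sym (ℤ.-1*i≡-i (χ y))) (cong (_* χ y) (sym (χ-nonsquare ns))))

  χ-1 : χ 1# ≡ 1ℤ
  χ-1 = trans (cong χ (sym (⊗-identityˡ 1#))) (χ-square 1≢0)

  √-1≢0 : √-1 ≢ 0#
  √-1≢0 e = ⊖≢0 1≢0 (trans (sym √-1²) (trans (cong (_⊗ √-1) e) (⊗-zeroˡ √-1)))

  χ-neg : ∀ x → χ (⊖ x) ≡ χ x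
  χ-neg x = trans (cong χ (trans (solve 1 (λ x → :- x := :- con 1ℤ :* x) refl x) (cong (_⊗ x) (sym √-1²))))
    (χ-square-* √-1≢0 x)

  χ-⊝-comm : ∀ x y → χ (x ⊝ y) ≡ χ (y ⊝ x)
  χ-⊝-comm x y = trans (cong χ (solve 2 (λ x y → x :- y := :- (y :- x)) refl x y)) (χ-neg (y ⊝ x))

  χ² : ∀ x → χ x * χ x ≡ 1ℤ - δ x 0#
  χ² x with classify x
  ... | isZero refl = trans (cong₂ _*_ χ-0 χ-0) (cong (λ z → 1ℤ - z) (sym (δ-≡ {0#} refl)))
  ... | square y y≢0 refl = trans (cong₂ _*_ (χ-square y≢0) (χ-square y≢0))
          (cong (λ z → 1ℤ - z) (sym (δ-≢ (⊗≢0 y≢0 y≢0))))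
  ... | nonsquare ns = trans (cong₂ _*_ (χ-nonsquare ns) (χ-nonsquare ns))
          (cong (λ z → 1ℤ - z) (sym (δ-≢ (nonsquare≢0 ns))))

  ∑χ-shift : ∀ z → ∑ (λ x → χ (x ⊝ z)) ≡ 0ℤ
  ∑χ-shift z = trans (sym (∑-shift χ (⊖ z))) ∑χ

  q≢1 : q ≢ 1
  q≢1 refl = 1≢0 (trans (only 1#) (sym (only 0#)))
    where
    only : (x : Fin 1) → x ≡ zero
    only zero = refl

  -- By scaling, J D is the same for all D ≢ 0, and the sum of J over all D vanishes.
  module _ where
    private
      J : Fin q → ℤ
      J D = ∑ (λ k → χ k * χ (k ⊕ D))

      J-≢0 : ∀ {D} → D ≢ 0# → J D ≡ J 1#
      J-≢0 {D} D≢0 = trans (∑-scale (λ k → χ k * χ (k ⊕ D)) D D≢0) (∑-cong λ k → begin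
        χ (D ⊗ k) * χ (D ⊗ k ⊕ D)   ≡⟨ χ-* (D ⊗ k) (D ⊗ k ⊕ D) ⟨
        χ (D ⊗ k ⊗ (D ⊗ k ⊕ D))     ≡⟨ cong χ
            (solve 2 (λ D k → D :* k :* (D :* k :+ D) := D :* D :* (k :* (k :+ con 1ℤ))) refl D k) ⟩
        χ (D ⊗ D ⊗ (k ⊗ (k ⊕ 1#)))  ≡⟨ χ-square-* D≢0 _ ⟩
        χ (k ⊗ (k ⊕ 1#))            ≡⟨ χ-* k (k ⊕ 1#) ⟩
        χ k * χ (k ⊕ 1#) ∎)

      ∑χ²  : ∑ (λ k → χ k * χ k) ≡ + q - 1ℤ
      ∑χ² = begin
        ∑ (λ k → χ k * χ k)
          ≡⟨ ∑-cong (λ k → trans (χ² k) (lin (δ k 0#))) ⟩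
        ∑ (lincomb ((1ℤ , (λ _ → 1ℤ)) ∷ (-1ℤ , (λ k → δ k 0#)) ∷ []))
          ≡⟨ ∑-lincomb ((1ℤ , (λ _ → 1ℤ)) ∷ (-1ℤ , (λ k → δ k 0#)) ∷ []) ⟩
        1ℤ * ∑ (λ _ → 1ℤ) + (-1ℤ * ∑ (λ k → δ k 0#) + 0ℤ)
          ≡⟨ cong₂ (λ a b → 1ℤ * a + (-1ℤ * b + 0ℤ)) ∑-1 (∑-δ-1 0#) ⟩
        1ℤ * + q + (-1ℤ * 1ℤ + 0ℤ)
          ≡⟨ simp (+ q) ⟩
        + q - 1ℤ ∎
        where
        lin : ∀ d → 1ℤ - d ≡ 1ℤ * 1ℤ + (-1ℤ * d + 0ℤ)
        lin = solve-∀
        simp : ∀ d → 1ℤ * d + (-1ℤ * 1ℤ + 0ℤ) ≡ d - 1ℤ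
        simp = solve-∀

      J-0 : J 0# ≡ + q - 1ℤ
      J-0 = trans (∑-cong λ k → cong (λ u → χ k * χ u) (solve 1 (λ k → k :+ con 0ℤ := k) refl k)) ∑χ²

      ∑J : ∑ J ≡ 0ℤ
      ∑J = begin
        ∑ (λ D → ∑ (λ k → χ k * χ (k ⊕ D)))  ≡⟨ ∑-comm (λ D k → χ k * χ (k ⊕ D)) ⟩
        ∑ (λ k → ∑ (λ D → χ k * χ (k ⊕ D)))  ≡⟨ ∑-cong (λ k → ∑-*ˡ (χ k) (λ D → χ (k ⊕ D))) ⟩
        ∑ (λ k → χ k * ∑ (λ D → χ (k ⊕ D)))  ≡⟨ ∑-cong (λ k → cong (χ k *_) (trans (trans
                                                (∑-cong (λ D → cong χ (solve 2 (λ k D → k :+ D := D :+ k) refl k D)))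
                                                (sym (∑-shift χ k))) ∑χ)) ⟩
        ∑ (λ k → χ k * 0ℤ)                   ≡⟨ ∑-cong (λ k → ℤ.*-zeroʳ (χ k)) ⟩
        ∑ (λ _ → 0ℤ)                         ≡⟨ ∑-0 ⟩
        0ℤ ∎

      J-form : ∀ D → J D ≡ J 1# * 1ℤ + ((+ q - 1ℤ - J 1#) * δ D 0# + 0ℤ)
      J-form D with D ≟ 0#
      ... | yes refl = trans J-0 (add-sub (J 1#) (+ q - 1ℤ))
        where
        add-sub : ∀ a b → b ≡ a * 1ℤ + ((b - a) * 1ℤ + 0ℤ)
        add-sub = solve-∀
      ... | no D≢0 = trans (J-≢0 D≢0) (add-0 (J 1#) (+ q - 1ℤ))
        where
        add-0 : ∀ a b → a ≡ a * 1ℤ + ((b - a) * 0ℤ + 0ℤ)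
        add-0 = solve-∀

      -- `J` is q - 1 at 0 and `J 1#` at the q - 1 other points, so its vanishing sum factors as (q
      -- - 1) (`J 1#` + 1).
      J-1 : J 1# ≡ -1ℤ
      J-1 = begin
        J 1#          ≡⟨ add-sub (J 1#) ⟩
        J 1# + 1ℤ - 1ℤ ≡⟨ cong (_- 1ℤ) ([ (λ e → contradiction (ℤ.+-injective (add-1 e)) q≢1) , (λ e → e) ]′
            (ℤ.i*j≡0⇒i≡0∨j≡0 (+ q - 1ℤ) prod)) ⟩
        -1ℤ ∎
        where
        add-sub : ∀ a → a ≡ a + 1ℤ - 1ℤ
        add-sub = solve-∀
        sub-add : ∀ a → a ≡ a - 1ℤ + 1ℤ
        sub-add = solve-∀
        add-1 : + q - 1ℤ ≡ 0ℤ → + q ≡ 1ℤ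
        add-1 e = trans (sub-add (+ q)) (cong (_+ 1ℤ) e)
        expand : ∀ q j → (q - 1ℤ) * (j + 1ℤ) ≡ j * q + ((q - 1ℤ - j) * 1ℤ + 0ℤ)
        expand = solve-∀
        prod : (+ q - 1ℤ) * (J 1# + 1ℤ) ≡ 0ℤ
        prod = begin
          (+ q - 1ℤ) * (J 1# + 1ℤ)
            ≡⟨ expand (+ q) (J 1#) ⟩
          J 1# * + q + ((+ q - 1ℤ - J 1#) * 1ℤ + 0ℤ)
            ≡⟨ cong₂ (λ a b → J 1# * a + ((+ q - 1ℤ - J 1#) * b + 0ℤ)) ∑-1 (∑-δ-1 0#) ⟨
          J 1# * ∑ (λ _ → 1ℤ) + ((+ q - 1ℤ - J 1#) * ∑ (λ D → δ D 0#) + 0ℤ)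
            ≡⟨ ∑-lincomb ((J 1# , (λ _ → 1ℤ)) ∷ (+ q - 1ℤ - J 1# , (λ D → δ D 0#)) ∷ []) ⟨
          ∑ (lincomb ((J 1# , (λ _ → 1ℤ)) ∷ (+ q - 1ℤ - J 1# , (λ D → δ D 0#)) ∷ []))
            ≡⟨ ∑-cong J-form ⟨
          ∑ J ≡⟨ ∑J ⟩
          0ℤ ∎

    -- Translation by `A` turns the sum into `J (A ⊝ B)`. Up to the constant -1, distinct translates
    -- of `χ` are orthogonal; all complete sums of `χ` over quadratic polynomials below reduce to
    -- this.
    ∑χχ : ∀ A B → ∑ (λ k → χ (k ⊝ A) * χ (k ⊝ B)) ≡ + q * δ A B - 1ℤ
    ∑χχ A B = begin
      ∑ (λ k → χ (k ⊝ A) * χ (k ⊝ B))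
        ≡⟨ ∑-shift _ A ⟩
      ∑ (λ k → χ (k ⊕ A ⊝ A) * χ (k ⊕ A ⊝ B))
        ≡⟨ ∑-cong (λ k → cong₂ (λ u v → χ u * χ v)
             (solve 2 (λ k A → k :+ A :- A := k) refl k A)
             (solve 3 (λ k A B → k :+ A :- B := k :+ (A :- B)) refl k A B)) ⟩
      J (A ⊝ B)
        ≡⟨ J-form (A ⊝ B) ⟩
      J 1# * 1ℤ + ((+ q - 1ℤ - J 1#) * δ (A ⊝ B) 0# + 0ℤ)
        ≡⟨ cong₂ (λ j d → j * 1ℤ + ((+ q - 1ℤ - j) * d + 0ℤ)) J-1
             (δ-cong {A ⊝ B} {0#} {A} {B} (⊝≡0⇒≡ A B) (λ { refl → solve 1 (λ A → A :- A := con 0ℤ) refl A })) ⟩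
      -1ℤ * 1ℤ + ((+ q - 1ℤ - -1ℤ) * δ A B + 0ℤ)
        ≡⟨ simp (+ q) (δ A B) ⟩
      + q * δ A B - 1ℤ ∎
      where
      simp : ∀ q d → -1ℤ * 1ℤ + ((q - 1ℤ - -1ℤ) * d + 0ℤ) ≡ q * d - 1ℤ
      simp = solve-∀

  -- Completing the square: with u = 2 s - m, the equation s (m - s) = c becomes u² = m² - 4 c.
  ∑δ-quadratic : ∀ m c → ∑ (λ s → δ (s ⊗ (m ⊝ s)) c) ≡ 1ℤ + χ (m ⊗ m ⊝ ⟦ + 4 ⟧ ⊗ c)
  ∑δ-quadratic m c = sym (begin
    1ℤ + χ D
      ≡⟨ roots≡1+χ D ⟨
    ∑ (λ u → δ (u ⊗ u) D)
      ≡⟨ ∑-affine _ ⟦ + 2 ⟧ (⊖ m) 2≢0 ⟩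
    ∑ (λ s → δ ((⟦ + 2 ⟧ ⊗ s ⊝ m) ⊗ (⟦ + 2 ⟧ ⊗ s ⊝ m)) D)
      ≡⟨ ∑-cong (λ s → δ-cong {(⟦ + 2 ⟧ ⊗ s ⊝ m) ⊗ (⟦ + 2 ⟧ ⊗ s ⊝ m)} {D} {s ⊗ (m ⊝ s)} {c}
           (λ e → ⊗-cancelˡ ⟦ + 4 ⟧ (s ⊗ (m ⊝ s)) c 4≢0 (trans (trans (back s) (cong (m ⊗ m ⊝_) e)) cancel))
           (λ e → trans (forth s) (cong (λ c → m ⊗ m ⊝ ⟦ + 4 ⟧ ⊗ c) e))) ⟩
    ∑ (λ s → δ (s ⊗ (m ⊝ s)) c) ∎)
    where
    D = m ⊗ m ⊝ ⟦ + 4 ⟧ ⊗ c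
    back : ∀ s → ⟦ + 4 ⟧ ⊗ (s ⊗ (m ⊝ s)) ≡ m ⊗ m ⊝ (⟦ + 2 ⟧ ⊗ s ⊝ m) ⊗ (⟦ + 2 ⟧ ⊗ s ⊝ m)
    back s = solve 2 (λ m s → con (+ 4) :* (s :* (m :- s)) := m :* m :- (con (+ 2) :* s :- m) :*
        (con (+ 2) :* s :- m)) refl m s
    cancel : m ⊗ m ⊝ D ≡ ⟦ + 4 ⟧ ⊗ c
    cancel = solve 2 (λ m c → m :* m :- (m :* m :- con (+ 4) :* c) := con (+ 4) :* c) refl m c
    forth : ∀ s → (⟦ + 2 ⟧ ⊗ s ⊝ m) ⊗ (⟦ + 2 ⟧ ⊗ s ⊝ m) ≡ m ⊗ m ⊝ ⟦ + 4 ⟧ ⊗ (s ⊗ (m ⊝ s))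
    forth s = solve 2 (λ m s → (con (+ 2) :* s :- m) :* (con (+ 2) :* s :- m) := m :* m :- con (+ 4) :*
        (s :* (m :- s))) refl m s

-- Jacobsthal sums

module TripleSums {q : ℕ} (K : FiniteField q) where
  open Character K
  open CharacterSums K

  jacobsthal : Fin q → ℤ
  jacobsthal k = ∑ (λ x → χ x * χ (x ⊗ x ⊝ k))

  -- For `z` different from 0 and 1, `L z` is minus the trace of Frobenius of the Legendre curve y²
  -- = x (x - 1) (x - z).
  v L : Fin q → ℤ
  v x = χ x * χ (x ⊝ 1#)
  L z = ∑ (λ x → v x * χ (x ⊝ z))

  -- `X` is the intermediate form between `W` and the squared Jacobsthal sum; `c` is the product and
  -- `m` the sum of the two variables of that square.
  W X : ℤ
  W = ∑ (λ z → v z * L z)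
  X = ∑ (λ c → ∑ (λ m → χ c * (χ (m ⊗ m ⊝ ⟦ + 4 ⟧ ⊗ c) * χ ((1# ⊕ c) ⊗ (1# ⊕ c) ⊝ m ⊗ m))))

  χ-4* : ∀ x → χ (⟦ + 4 ⟧ ⊗ x) ≡ χ x
  χ-4* x = trans (cong (λ u → χ (u ⊗ x)) (solve 0 (con (+ 4) := con (+ 2) :* con (+ 2)) refl)) (χ-square-* 2≢0 x)

  -- 1 + v k is the number of s with (1 + s)² = 4 s k.
  L-alt : ∀ z → L z ≡ ∑ (λ s → χ s * χ ((1# ⊕ s) ⊗ (1# ⊕ s) ⊝ ⟦ + 4 ⟧ ⊗ s ⊗ z))
  L-alt z = begin
    ∑ (λ k → v k * χ (k ⊝ z))
      -- The vanishing sum of `χ (k ⊝ z)` is added to complete the weight `v k` to the root count 1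
      -- + `v k`.
      ≡⟨ trans (sym (ℤ.+-identityˡ _)) (cong (_+ L z) (sym (∑χ-shift z))) ⟩
    ∑ (λ k → χ (k ⊝ z)) + L z
      ≡⟨ ∑-+ (λ k → χ (k ⊝ z)) (λ k → v k * χ (k ⊝ z)) ⟨
    ∑ (λ k → χ (k ⊝ z) + v k * χ (k ⊝ z))
      ≡⟨ ∑-cong (λ k → trans (factor (v k) (χ (k ⊝ z))) (cong (_* χ (k ⊝ z)) (count k))) ⟩
    ∑ (λ k → ∑ (λ s → δ (s ⊗ (M k ⊝ s)) 1#) * χ (k ⊝ z))
      ≡⟨ ∑-cong (λ k → sym (∑-*ʳ (λ s → δ (s ⊗ (M k ⊝ s)) 1#) (χ (k ⊝ z)))) ⟩
    ∑ (λ k → ∑ (λ s → δ (s ⊗ (M k ⊝ s)) 1# * χ (k ⊝ z)))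
      ≡⟨ ∑-comm (λ k s → δ (s ⊗ (M k ⊝ s)) 1# * χ (k ⊝ z)) ⟩
    ∑ (λ s → ∑ (λ k → δ (s ⊗ (M k ⊝ s)) 1# * χ (k ⊝ z)))
      ≡⟨ ∑-cong inner ⟩
    ∑ (λ s → χ s * χ ((1# ⊕ s) ⊗ (1# ⊕ s) ⊝ ⟦ + 4 ⟧ ⊗ s ⊗ z)) ∎
    where
    -- The equation (1 + s)² = 4 s k, rewritten as s (4 k - 2 - s) = 1, is the case c = 1 of
    -- `∑δ-quadratic`.
    M : Fin q → Fin q
    M k = ⟦ + 4 ⟧ ⊗ k ⊝ ⟦ + 2 ⟧
    factor : ∀ a b → b + a * b ≡ (1ℤ + a) * b
    factor = solve-∀
    count : ∀ k → 1ℤ + v k ≡ ∑ (λ s → δ (s ⊗ (M k ⊝ s)) 1#)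
    count k = sym (trans (∑δ-quadratic (M k) 1#) (cong (λ u → 1ℤ + u) (begin
      χ (M k ⊗ M k ⊝ ⟦ + 4 ⟧ ⊗ 1#)
        ≡⟨ cong χ (solve 1 (λ k → (con (+ 4) :* k :- con (+ 2)) :* (con (+ 4) :* k :- con (+ 2)) :- con (+ 4) :* con 1ℤ
             := con (+ 4) :* (con (+ 4) :* (k :* (k :- con 1ℤ)))) refl k) ⟩
      χ (⟦ + 4 ⟧ ⊗ (⟦ + 4 ⟧ ⊗ (k ⊗ (k ⊝ 1#))))
        ≡⟨ trans (χ-4* _) (χ-4* _) ⟩
      χ (k ⊗ (k ⊝ 1#))
        ≡⟨ χ-* k (k ⊝ 1#) ⟩
      v k ∎)))
    inner : ∀ s → ∑ (λ k → δ (s ⊗ (M k ⊝ s)) 1# * χ (k ⊝ z)) ≡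
                  χ s * χ ((1# ⊕ s) ⊗ (1# ⊕ s) ⊝ ⟦ + 4 ⟧ ⊗ s ⊗ z)
    inner s with s ≟ 0#
    ... | yes refl = trans (trans (∑-cong λ k → cong (_* χ (k ⊝ z))
        (δ-≢ {0# ⊗ (M k ⊝ 0#)} {1#} λ e → 1≢0 (trans (sym e) (⊗-zeroˡ _)))) ∑-0)
                       (cong (_* χ ((1# ⊕ 0#) ⊗ (1# ⊕ 0#) ⊝ ⟦ + 4 ⟧ ⊗ 0# ⊗ z)) (sym χ-0))
    ... | no s≢0 = begin
      ∑ (λ k → δ (s ⊗ (M k ⊝ s)) 1# * χ (k ⊝ z))
        -- A nonzero `s` determines k through n = 4 s k = (1 + s)². In terms of n the factor `χ s`
        -- appears, because 4 s² (k - z) = s (4 s k - 4 s z).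
        ≡⟨ ∑-cong (λ k → cong₂ _*_ (δ-cong {s ⊗ (M k ⊝ s)} {1#} {d ⊗ k} {a} (to k) (from k)) (scale k)) ⟩
      ∑ (λ k → δ (d ⊗ k) a * (χ s * χ (d ⊗ k ⊝ d ⊗ z)))
        ≡⟨ ∑-scale (λ n → δ n a * (χ s * χ (n ⊝ d ⊗ z))) d (⊗≢0 4≢0 s≢0) ⟨
      ∑ (λ n → δ n a * (χ s * χ (n ⊝ d ⊗ z)))
        ≡⟨ ∑-δ (λ n → χ s * χ (n ⊝ d ⊗ z)) a ⟩
      χ s * χ (a ⊝ d ⊗ z) ∎
      where
      a d : Fin q
      a = (1# ⊕ s) ⊗ (1# ⊕ s)
      d = ⟦ + 4 ⟧ ⊗ s
      to : ∀ k → s ⊗ (M k ⊝ s) ≡ 1# → d ⊗ k ≡ a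
      to k e = trans (solve 2 (λ s k → con (+ 4) :* s :* k := s :* (con (+ 4) :* k :- con (+ 2) :- s) :+
          (con (+ 2) :* s :+ s :* s)) refl s k)
        (trans (cong (_⊕ (⟦ + 2 ⟧ ⊗ s ⊕ s ⊗ s)) e)
          (solve 1 (λ s → con 1ℤ :+ (con (+ 2) :* s :+ s :* s) := (con 1ℤ :+ s) :* (con 1ℤ :+ s)) refl s))
      from : ∀ k → d ⊗ k ≡ a → s ⊗ (M k ⊝ s) ≡ 1#
      from k e = trans (solve 2 (λ s k → s :* (con (+ 4) :* k :- con (+ 2) :- s) := con (+ 4) :* s :* k :-
          (con (+ 2) :* s :+ s :* s)) refl s k)
        (trans (cong (_⊝ (⟦ + 2 ⟧ ⊗ s ⊕ s ⊗ s)) e)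
          (solve 1 (λ s → (con 1ℤ :+ s) :* (con 1ℤ :+ s) :- (con (+ 2) :* s :+ s :* s) := con 1ℤ) refl s))
      scale : ∀ k → χ (k ⊝ z) ≡ χ s * χ (d ⊗ k ⊝ d ⊗ z)
      scale k = begin
        χ (k ⊝ z)                            ≡⟨ χ-square-* s≢0 _ ⟨
        χ (s ⊗ s ⊗ (k ⊝ z))                  ≡⟨ χ-4* _ ⟨
        χ (⟦ + 4 ⟧ ⊗ (s ⊗ s ⊗ (k ⊝ z)))      ≡⟨ cong χ
            (solve 3 (λ s k z → con (+ 4) :* (s :* s :* (k :- z)) := s :*
                (con (+ 4) :* s :* k :- con (+ 4) :* s :* z)) refl s k z) ⟩
        χ (s ⊗ (d ⊗ k ⊝ d ⊗ z))              ≡⟨ χ-* s _ ⟩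
        χ s * χ (d ⊗ k ⊝ d ⊗ z) ∎

  private
    Y : Fin q → ℤ
    Y c = ∑ (λ n → χ n * (χ (n ⊝ ⟦ + 4 ⟧ ⊗ c) * χ ((1# ⊕ c) ⊗ (1# ⊕ c) ⊝ n)))

  -- Insert `L-alt`, put the sum over its parameter `c` outside, and substitute n = 4 c z for `c`
  -- nonzero; `v z` is unchanged by the square factor (4 c)². At `c` = 0 both sides vanish through
  -- `χ c`.
  W-alt : W ≡ ∑ (λ c → χ c * Y c)
  W-alt = begin
    ∑ (λ z → v z * L z)
      ≡⟨ ∑-cong (λ z → trans (cong (v z *_) (L-alt z)) (sym (∑-*ˡ (v z) (λ c → χ c * χ (a c ⊝ d c ⊗ z))))) ⟩
    ∑ (λ z → ∑ (λ c → v z * (χ c * χ (a c ⊝ d c ⊗ z))))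
      ≡⟨ ∑-comm (λ z c → v z * (χ c * χ (a c ⊝ d c ⊗ z))) ⟩
    ∑ (λ c → ∑ (λ z → v z * (χ c * χ (a c ⊝ d c ⊗ z))))
      ≡⟨ ∑-cong (λ c → trans (∑-cong (λ z → swap (v z) (χ c) _)) (∑-*ˡ (χ c) (λ z → v z * χ (a c ⊝ d c ⊗ z)))) ⟩
    ∑ (λ c → χ c * ∑ (λ z → v z * χ (a c ⊝ d c ⊗ z)))
      ≡⟨ ∑-cong inner ⟩
    ∑ (λ c → χ c * Y c) ∎
    where
    a d : Fin q → Fin q
    a c = (1# ⊕ c) ⊗ (1# ⊕ c)
    d c = ⟦ + 4 ⟧ ⊗ c
    swap : ∀ a b c → a * (b * c) ≡ b * (a * c)
    swap = solve-∀
    inner : ∀ c → χ c * ∑ (λ z → v z * χ (a c ⊝ d c ⊗ z)) ≡ χ c * Y c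
    inner c with c ≟ 0#
    ... | yes refl = trans (cong (_* ∑ (λ z → v z * χ (a 0# ⊝ d 0# ⊗ z))) χ-0) (cong (_* Y 0#) (sym χ-0))
    ... | no c≢0 = cong (χ c *_) (begin
      ∑ (λ z → v z * χ (a c ⊝ d c ⊗ z))
        ≡⟨ ∑-cong (λ z → trans (cong (_* χ (a c ⊝ d c ⊗ z)) (scale z))
            (ℤ.*-assoc (χ (d c ⊗ z)) (χ (d c ⊗ z ⊝ d c)) _)) ⟩
      ∑ (λ z → χ (d c ⊗ z) * (χ (d c ⊗ z ⊝ d c) * χ (a c ⊝ d c ⊗ z)))
        ≡⟨ ∑-scale (λ n → χ n * (χ (n ⊝ d c) * χ (a c ⊝ n))) (d c) (⊗≢0 4≢0 c≢0) ⟨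
      Y c ∎)
      where
      scale : ∀ z → v z ≡ χ (d c ⊗ z) * χ (d c ⊗ z ⊝ d c)
      scale z = begin
        χ z * χ (z ⊝ 1#)                  ≡⟨ χ-* z (z ⊝ 1#) ⟨
        χ (z ⊗ (z ⊝ 1#))                  ≡⟨ χ-square-* (⊗≢0 4≢0 c≢0) _ ⟨
        χ (d c ⊗ d c ⊗ (z ⊗ (z ⊝ 1#)))    ≡⟨ cong χ
            (solve 2 (λ d z → d :* d :* (z :* (z :- con 1ℤ)) := d :* z :* (d :* z :- d)) refl (d c) z) ⟩
        χ (d c ⊗ z ⊗ (d c ⊗ z ⊝ d c))     ≡⟨ χ-* (d c ⊗ z) _ ⟩
        χ (d c ⊗ z) * χ (d c ⊗ z ⊝ d c) ∎

  ∑χ*δ : ∀ a → χ a ≡ 1ℤ → ∑ (λ c → χ c * (+ q * δ c a - 1ℤ)) ≡ + q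
  ∑χ*δ a χa = begin
    ∑ (λ c → χ c * (+ q * δ c a - 1ℤ))
      ≡⟨ ∑-cong (λ c → expand (χ c) (+ q) (δ c a)) ⟩
    ∑ (lincomb ((+ q , (λ c → δ c a * χ c)) ∷ (-1ℤ , χ) ∷ []))
      ≡⟨ ∑-lincomb ((+ q , (λ c → δ c a * χ c)) ∷ (-1ℤ , χ) ∷ []) ⟩
    + q * ∑ (λ c → δ c a * χ c) + (-1ℤ * ∑ χ + 0ℤ)
      ≡⟨ cong₂ (λ x y → + q * x + (-1ℤ * y + 0ℤ)) (trans (∑-δ χ a) χa) ∑χ ⟩
    + q * 1ℤ + (-1ℤ * 0ℤ + 0ℤ)
      ≡⟨ simp (+ q) ⟩
    + q ∎
    where
    expand : ∀ x q d → x * (q * d - 1ℤ) ≡ q * (d * x) + (-1ℤ * x + 0ℤ)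
    expand = solve-∀
    simp : ∀ q → q * 1ℤ + (-1ℤ * 0ℤ + 0ℤ) ≡ q
    simp = solve-∀

  -- In `X` the variable m enters only as m², so `∑-square` replaces it by n with weight 1 + `χ n`.
  -- The `χ n` part is `W` by `W-alt`. The constant part is `∑χχ` at 4 c and (1 + c)², whose
  -- difference (c - 1)² vanishes only at c = 1.
  X≡W+q : X ≡ + q + W
  X≡W+q = begin
    X
      ≡⟨ ∑-cong (λ c → trans (∑-*ˡ (χ c) _) (cong (χ c *_) (∑-square (λ n → χ (n ⊝ d c) * χ (a c ⊝ n))))) ⟩
    ∑ (λ c → χ c * ∑ (λ n → (1ℤ + χ n) * (χ (n ⊝ d c) * χ (a c ⊝ n))))
      ≡⟨ ∑-cong (λ c → trans (cong (χ c *_) (split c)) (ℤ.*-distribˡ-+ (χ c) _ (Y c))) ⟩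
    ∑ (λ c → χ c * (+ q * δ c 1# - 1ℤ) + χ c * Y c)
      ≡⟨ ∑-+ (λ c → χ c * (+ q * δ c 1# - 1ℤ)) (λ c → χ c * Y c) ⟩
    ∑ (λ c → χ c * (+ q * δ c 1# - 1ℤ)) + ∑ (λ c → χ c * Y c)
      ≡⟨ cong₂ _+_ (∑χ*δ 1# χ-1) (sym W-alt) ⟩
    + q + W ∎
    where
    a d : Fin q → Fin q
    a c = (1# ⊕ c) ⊗ (1# ⊕ c)
    d c = ⟦ + 4 ⟧ ⊗ c
    distrib : ∀ x y → (1ℤ + x) * y ≡ y + x * y
    distrib = solve-∀
    δ-eq : ∀ c → δ (d c) (a c) ≡ δ c 1#
    δ-eq c = δ-cong {d c} {a c} {c} {1#}
      (λ e → ⊝≡0⇒≡ c 1# ([ (λ z → z) , (λ z → z) ]′ (⊗≡0 (c ⊝ 1#) (c ⊝ 1#) (begin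
        (c ⊝ 1#) ⊗ (c ⊝ 1#)
          ≡⟨ solve 1 (λ c → (c :- con 1ℤ) :* (c :- con 1ℤ) := (con 1ℤ :+ c) :* (con 1ℤ :+ c) :- con (+ 4) :* c) refl c ⟩
        a c ⊝ d c ≡⟨ cong (a c ⊝_) e ⟩
        a c ⊝ a c ≡⟨ solve 1 (λ x → x :- x := con 0ℤ) refl (a c) ⟩
        0# ∎))))
      (λ { refl → solve 0 (con (+ 4) :* con 1ℤ := (con 1ℤ :+ con 1ℤ) :* (con 1ℤ :+ con 1ℤ)) refl })
    split : ∀ c → ∑ (λ n → (1ℤ + χ n) * (χ (n ⊝ d c) * χ (a c ⊝ n))) ≡ (+ q * δ c 1# - 1ℤ) + Y c
    split c = begin
      ∑ (λ n → (1ℤ + χ n) * (χ (n ⊝ d c) * χ (a c ⊝ n)))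
        ≡⟨ ∑-cong (λ n → distrib (χ n) (χ (n ⊝ d c) * χ (a c ⊝ n))) ⟩
      ∑ (λ n → χ (n ⊝ d c) * χ (a c ⊝ n) + χ n * (χ (n ⊝ d c) * χ (a c ⊝ n)))
        ≡⟨ ∑-+ (λ n → χ (n ⊝ d c) * χ (a c ⊝ n)) _ ⟩
      ∑ (λ n → χ (n ⊝ d c) * χ (a c ⊝ n)) + Y c
        ≡⟨ cong (_+ Y c) (∑-cong λ n → cong (χ (n ⊝ d c) *_) (χ-⊝-comm (a c) n)) ⟩
      ∑ (λ n → χ (n ⊝ d c) * χ (n ⊝ a c)) + Y c
        ≡⟨ cong (_+ Y c) (∑χχ (d c) (a c)) ⟩
      (+ q * δ (d c) (a c) - 1ℤ) + Y c
        ≡⟨ cong (λ e → (+ q * e - 1ℤ) + Y c) (δ-eq c) ⟩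
      (+ q * δ c 1# - 1ℤ) + Y c ∎

  -- Substitute c = s r and m = s + r, so that (s² - 1)(r² - 1) = (1 + c)² - m².
  jacobsthal²≡X+q : jacobsthal 1# * jacobsthal 1# ≡ X + + q
  jacobsthal²≡X+q = begin
    t * t
      ≡⟨ ∑-*ʳ (λ s → χ s * χ (s ⊗ s ⊝ 1#)) t ⟨
    ∑ (λ s → χ s * χ (s ⊗ s ⊝ 1#) * t)
      ≡⟨ ∑-cong (λ s → trans (sym (∑-*ˡ (χ s * χ (s ⊗ s ⊝ 1#)) (λ r → χ r * χ (r ⊗ r ⊝ 1#))))
           (trans (∑-shift _ (⊖ s)) (∑-cong (term s)))) ⟩
    ∑ (λ s → ∑ (λ m → f m (s ⊗ (m ⊝ s))))
      ≡⟨ ∑-comm (λ s m → f m (s ⊗ (m ⊝ s))) ⟩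
    ∑ (λ m → ∑ (λ s → f m (s ⊗ (m ⊝ s))))
      -- For fixed m, the values c = s (m - s) are hit 1 + χ (m² - 4 c) times. The χ part of this
      -- weight gives `X`; the constant part is a complete quadratic sum in m, exceptional only at c
      -- = -1, which yields the extra `q`.
      ≡⟨ ∑-cong (λ m → trans (∑-fibre (λ s → s ⊗ (m ⊝ s)) (f m)) (∑-cong λ c → cong (_* f m c) (∑δ-quadratic m c))) ⟩
    ∑ (λ m → ∑ (λ c → (1ℤ + χ (m ⊗ m ⊝ d c)) * f m c))
      ≡⟨ ∑-comm (λ m c → (1ℤ + χ (m ⊗ m ⊝ d c)) * f m c) ⟩
    ∑ (λ c → ∑ (λ m → (1ℤ + χ (m ⊗ m ⊝ d c)) * f m c))
      ≡⟨ ∑-cong (λ c → trans (∑-cong λ m → distrib (χ (m ⊗ m ⊝ d c)) (χ c) (χ (a c ⊝ m ⊗ m)))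
           (∑-+ (λ m → χ c * χ (a c ⊝ m ⊗ m)) _)) ⟩
    ∑ (λ c → ∑ (λ m → χ c * χ (a c ⊝ m ⊗ m)) + ∑ (λ m → χ c * (χ (m ⊗ m ⊝ d c) * χ (a c ⊝ m ⊗ m))))
      ≡⟨ ∑-+ (λ c → ∑ (λ m → χ c * χ (a c ⊝ m ⊗ m))) _ ⟩
    ∑ (λ c → ∑ (λ m → χ c * χ (a c ⊝ m ⊗ m))) + X
      ≡⟨ cong (_+ X) (∑-cong inner) ⟩
    ∑ (λ c → χ c * (+ q * δ c (⊖ 1#) - 1ℤ)) + X
      ≡⟨ cong (_+ X) (∑χ*δ (⊖ 1#) (trans (χ-neg 1#) χ-1)) ⟩
    + q + X
      ≡⟨ ℤ.+-comm (+ q) X ⟩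
    X + + q ∎
    where
    t = jacobsthal 1#
    a d : Fin q → Fin q
    a c = (1# ⊕ c) ⊗ (1# ⊕ c)
    d c = ⟦ + 4 ⟧ ⊗ c
    f : Fin q → Fin q → ℤ
    f m c = χ c * χ (a c ⊝ m ⊗ m)
    distrib : ∀ x y z → (1ℤ + x) * (y * z) ≡ y * z + y * (x * z)
    distrib = solve-∀
    swap : ∀ a b c d → a * b * (c * d) ≡ a * c * (b * d)
    swap = solve-∀
    term : ∀ s m → χ s * χ (s ⊗ s ⊝ 1#) * (χ (m ⊝ s) * χ ((m ⊝ s) ⊗ (m ⊝ s) ⊝ 1#)) ≡ f m (s ⊗ (m ⊝ s))
    term s m = begin
      χ s * χ (s ⊗ s ⊝ 1#) * (χ r * χ (r ⊗ r ⊝ 1#))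
        ≡⟨ swap (χ s) (χ (s ⊗ s ⊝ 1#)) (χ r) (χ (r ⊗ r ⊝ 1#)) ⟩
      χ s * χ r * (χ (s ⊗ s ⊝ 1#) * χ (r ⊗ r ⊝ 1#))
        ≡⟨ cong₂ _*_ (sym (χ-* s r)) (sym (χ-* (s ⊗ s ⊝ 1#) (r ⊗ r ⊝ 1#))) ⟩
      χ (s ⊗ r) * χ ((s ⊗ s ⊝ 1#) ⊗ (r ⊗ r ⊝ 1#))
        ≡⟨ cong (λ u → χ (s ⊗ r) * χ u) (solve 2 (λ s m →
             (s :* s :- con 1ℤ) :* ((m :- s) :* (m :- s) :- con 1ℤ) :=
             (con 1ℤ :+ s :* (m :- s)) :* (con 1ℤ :+ s :* (m :- s)) :- m :* m) refl s m) ⟩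
      f m (s ⊗ r) ∎
      where r = m ⊝ s
    inner : ∀ c → ∑ (λ m → χ c * χ (a c ⊝ m ⊗ m)) ≡ χ c * (+ q * δ c (⊖ 1#) - 1ℤ)
    inner c = trans (∑-*ˡ (χ c) (λ m → χ (a c ⊝ m ⊗ m))) (cong (χ c *_) (begin
      ∑ (λ m → χ (a c ⊝ m ⊗ m))
        ≡⟨ ∑-cong (λ m → trans (χ-⊝-comm (a c) (m ⊗ m)) (trans
             (cong χ (solve 2 (λ m b → m :* m :- b :* b := (m :- b) :* (m :- :- b)) refl m (1# ⊕ c)))
             (χ-* (m ⊝ (1# ⊕ c)) (m ⊝ ⊖ (1# ⊕ c))))) ⟩
      ∑ (λ m → χ (m ⊝ (1# ⊕ c)) * χ (m ⊝ ⊖ (1# ⊕ c)))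
        ≡⟨ ∑χχ (1# ⊕ c) (⊖ (1# ⊕ c)) ⟩
      + q * δ (1# ⊕ c) (⊖ (1# ⊕ c)) - 1ℤ
        ≡⟨ cong (λ e → + q * e - 1ℤ) (δ-cong {1# ⊕ c} {⊖ (1# ⊕ c)} {c} {⊖ 1#} to from) ⟩
      + q * δ c (⊖ 1#) - 1ℤ ∎))
      where
      to : 1# ⊕ c ≡ ⊖ (1# ⊕ c) → c ≡ ⊖ 1#
      to e with (1# ⊕ c) ≟ 0#
      ... | no ≢0 = contradiction e (x≢⊖x ≢0)
      ... | yes ≡0 = ⊝≡0⇒≡ c (⊖ 1#) (trans (solve 1 (λ c → c :- :- con 1ℤ := con 1ℤ :+ c) refl c) ≡0)
      from : c ≡ ⊖ 1# → 1# ⊕ c ≡ ⊖ (1# ⊕ c)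
      from refl = solve 0 (con 1ℤ :- con 1ℤ := :- (con 1ℤ :- con 1ℤ)) refl

  W≡jacobsthal²-2q : W ≡ jacobsthal 1# * jacobsthal 1# - + 2 * + q
  W≡jacobsthal²-2q = trans (move W (+ q)) (cong (_- + 2 * + q) (sym (trans jacobsthal²≡X+q (cong (_+ + q) X≡W+q))))
    where
    move : ∀ w q → w ≡ q + w + q - + 2 * q
    move = solve-∀

-- The weighted count of 4-tuples over the field

module PaleySums {q : ℕ} (K : FiniteField q) where
  open Character K
  open CharacterSums K
  open TripleSums K

  -- e d is 2 if d is a nonzero square and 0 otherwise.
  e : Fin q → ℤ
  e d = 1ℤ - δ d 0# + χ d

  δχ₀ : ∀ x → δ x 0# * χ x ≡ 0ℤ
  δχ₀ x = trans (δ-* χ x 0#) (trans (cong (δ x 0# *_) χ-0) (ℤ.*-zeroʳ (δ x 0#)))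

  δ² : ∀ x a → δ x a * δ x a ≡ δ x a
  δ² x a = trans (δ-* (λ u → δ u a) x a) (trans (cong (δ x a *_) (δ-≡ {a} refl)) (ℤ.*-identityʳ _))

  e² : ∀ x → e x * e x ≡ + 2 * e x
  e² x = begin
    e x * e x ≡⟨ expand (δ x 0#) (χ x) ⟩
    1ℤ + δ x 0# * δ x 0# + χ x * χ x - + 2 * δ x 0# + + 2 * χ x - + 2 * (δ x 0# * χ x)
      ≡⟨ cong₂ (λ a b → 1ℤ + a + χ x * χ x - + 2 * δ x 0# + + 2 * χ x - + 2 * b) (δ² x 0#) (δχ₀ x) ⟩
    1ℤ + δ x 0# + χ x * χ x - + 2 * δ x 0# + + 2 * χ x - + 2 * 0ℤ
      ≡⟨ cong (λ a → 1ℤ + δ x 0# + a - + 2 * δ x 0# + + 2 * χ x - + 2 * 0ℤ) (χ² x) ⟩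
    1ℤ + δ x 0# + (1ℤ - δ x 0#) - + 2 * δ x 0# + + 2 * χ x - + 2 * 0ℤ
      ≡⟨ collect (δ x 0#) (χ x) ⟩
    + 2 * e x ∎
    where
    expand : ∀ d c → (1ℤ - d + c) * (1ℤ - d + c) ≡ 1ℤ + d * d + c * c - + 2 * d + + 2 * c - + 2 * (d * c)
    expand = solve-∀
    collect : ∀ d c → 1ℤ + d + (1ℤ - d) - + 2 * d + + 2 * c - + 2 * 0ℤ ≡ + 2 * (1ℤ - d + c)
    collect = solve-∀

  eχ : ∀ x → e x * χ x ≡ e x
  eχ x = begin
    e x * χ x                        ≡⟨ expand (δ x 0#) (χ x) ⟩
    χ x - δ x 0# * χ x + χ x * χ x   ≡⟨ cong₂ (λ a b → χ x - a + b) (δχ₀ x) (χ² x) ⟩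
    χ x - 0ℤ + (1ℤ - δ x 0#)         ≡⟨ collect (δ x 0#) (χ x) ⟩
    e x ∎
    where
    expand : ∀ d c → (1ℤ - d + c) * c ≡ c - d * c + c * c
    expand = solve-∀
    collect : ∀ d c → c - 0ℤ + (1ℤ - d) ≡ 1ℤ - d + c
    collect = solve-∀

  eδ : ∀ x → e x * δ x 0# ≡ 0ℤ
  eδ x = begin
    e x * δ x 0#                                   ≡⟨ expand (δ x 0#) (χ x) ⟩
    δ x 0# - δ x 0# * δ x 0# + δ x 0# * χ x        ≡⟨ cong₂ (λ a b → δ x 0# - a + b) (δ² x 0#) (δχ₀ x) ⟩
    δ x 0# - δ x 0# + 0ℤ                           ≡⟨ cancel (δ x 0#) ⟩
    0ℤ ∎
    where
    expand : ∀ d c → (1ℤ - d + c) * d ≡ d - d * d + d * c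
    expand = solve-∀
    cancel : ∀ d → d - d + 0ℤ ≡ 0ℤ
    cancel = solve-∀

  δ-⊝ : ∀ x y → δ (x ⊝ y) 0# ≡ δ x y
  δ-⊝ x y = δ-cong {x ⊝ y} {0#} {x} {y} (⊝≡0⇒≡ x y) (λ { refl → solve 1 (λ x → x :- x := con 0ℤ) refl x })

  e-neg : ∀ x → e (⊖ x) ≡ e x
  e-neg x = cong₂ (λ a b → 1ℤ - a + b)
    (δ-cong {⊖ x} {0#} {x} {0#}
      (λ eq → trans (solve 1 (λ x → x := :- :- x) refl x) (trans (cong ⊖_ eq) neg0))
      (λ { refl → neg0 }))
    (χ-neg x)
    where
    neg0 : ⊖ 0# ≡ 0#
    neg0 = solve 0 (:- con 0ℤ := con 0ℤ) refl

  e-⊝-comm : ∀ x y → e (x ⊝ y) ≡ e (y ⊝ x)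
  e-⊝-comm x y = trans (cong e (solve 2 (λ x y → x :- y := :- (y :- x)) refl x y)) (e-neg (y ⊝ x))

  -- Equals 4 on the common neighbours of 0 and 1 in the Paley graph of the field and 0 elsewhere.
  k : Fin q → ℤ
  k x = e x * e (x ⊝ 1#)

  χ0⊝1 : χ (0# ⊝ 1#) ≡ 1ℤ
  χ0⊝1 = trans (cong χ (solve 0 (con 0ℤ :- con 1ℤ := :- con 1ℤ) refl)) (trans (χ-neg 1#) χ-1)

  δ₀χ₁ : ∀ x → δ x 0# * χ (x ⊝ 1#) ≡ δ x 0#
  δ₀χ₁ x = trans (δ-* (λ u → χ (u ⊝ 1#)) x 0#) (trans (cong (δ x 0# *_) χ0⊝1) (ℤ.*-identityʳ _))

  δ₁χ : ∀ x → δ x 1# * χ x ≡ δ x 1#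
  δ₁χ x = trans (δ-* χ x 1#) (trans (cong (δ x 1# *_) χ-1) (ℤ.*-identityʳ _))

  δ₀δ₁ : ∀ x → δ x 0# * δ x 1# ≡ 0ℤ
  δ₀δ₁ x = trans (δ-* (λ u → δ u 1#) x 0#) (trans (cong (δ x 0# *_) (δ-≢ {0#} {1#} (1≢0 ∘ sym))) (ℤ.*-zeroʳ (δ x 0#)))

  -- Each delta gets the coefficient -2: once from its own factor `e`, and once more because the
  -- other character is 1 at that point. At 0 this uses χ (-1) = 1.
  k-form : ∀ x → k x ≡ 1ℤ - + 2 * δ x 0# - + 2 * δ x 1# + χ x + χ (x ⊝ 1#) + v x
  k-form x = begin
    k x
      ≡⟨ cong (λ a → e x * (1ℤ - a + χ (x ⊝ 1#))) (δ-⊝ x 1#) ⟩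
    e x * (1ℤ - δ x 1# + χ (x ⊝ 1#))
      ≡⟨ expand (δ x 0#) (δ x 1#) (χ x) (χ (x ⊝ 1#)) ⟩
    1ℤ - δ x 0# - δ x 1# + χ x + χ (x ⊝ 1#) + v x + δ x 0# * δ x 1# - δ x 0# * χ (x ⊝ 1#) - δ x 1# * χ x
      ≡⟨ cong₂ (λ a b → 1ℤ - δ x 0# - δ x 1# + χ x + χ (x ⊝ 1#) + v x + a - b - δ x 1# * χ x) (δ₀δ₁ x) (δ₀χ₁ x) ⟩
    1ℤ - δ x 0# - δ x 1# + χ x + χ (x ⊝ 1#) + v x + 0ℤ - δ x 0# - δ x 1# * χ x
      ≡⟨ cong (λ b → 1ℤ - δ x 0# - δ x 1# + χ x + χ (x ⊝ 1#) + v x + 0ℤ - δ x 0# - b) (δ₁χ x) ⟩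
    1ℤ - δ x 0# - δ x 1# + χ x + χ (x ⊝ 1#) + v x + 0ℤ - δ x 0# - δ x 1#
      ≡⟨ collect (δ x 0#) (δ x 1#) (χ x) (χ (x ⊝ 1#)) (v x) ⟩
    1ℤ - + 2 * δ x 0# - + 2 * δ x 1# + χ x + χ (x ⊝ 1#) + v x ∎
    where
    expand : ∀ a b c d → (1ℤ - a + c) * (1ℤ - b + d) ≡ 1ℤ - a - b + c + d + c * d + a * b - a * d - b * c
    expand = solve-∀
    collect : ∀ a b c d v → 1ℤ - a - b + c + d + v + 0ℤ - a - b ≡ 1ℤ - + 2 * a - + 2 * b + c + d + v
    collect = solve-∀

  k² : ∀ x → k x * k x ≡ + 4 * k x
  k² x = trans (rearr (e x) (e (x ⊝ 1#))) (trans (cong₂ _*_ (e² x) (e² (x ⊝ 1#))) (collect (e x) (e (x ⊝ 1#))))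
    where
    rearr : ∀ a b → a * b * (a * b) ≡ a * a * (b * b)
    rearr = solve-∀
    collect : ∀ a b → + 2 * a * (+ 2 * b) ≡ + 4 * (a * b)
    collect = solve-∀

  kχ : ∀ x → k x * χ x ≡ k x
  kχ x = trans (rearr (e x) (e (x ⊝ 1#)) (χ x)) (cong (_* e (x ⊝ 1#)) (eχ x))
    where
    rearr : ∀ a b c → a * b * c ≡ a * c * b
    rearr = solve-∀

  kχ₁ : ∀ x → k x * χ (x ⊝ 1#) ≡ k x
  kχ₁ x = trans (ℤ.*-assoc (e x) _ _) (cong (e x *_) (eχ (x ⊝ 1#)))

  kδ₀ : ∀ x → k x * δ x 0# ≡ 0ℤ
  kδ₀ x = trans (rearr (e x) (e (x ⊝ 1#)) (δ x 0#)) (trans (cong (_* e (x ⊝ 1#)) (eδ x)) refl)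
    where
    rearr : ∀ a b c → a * b * c ≡ a * c * b
    rearr = solve-∀

  kδ₁ : ∀ x → k x * δ x 1# ≡ 0ℤ
  kδ₁ x = trans (ℤ.*-assoc (e x) _ _) (trans (cong (e x *_)
    (trans (cong (e (x ⊝ 1#) *_) (sym (δ-⊝ x 1#))) (eδ (x ⊝ 1#)))) (ℤ.*-zeroʳ (e x)))

  ∑v : ∑ v ≡ -1ℤ
  ∑v = begin
    ∑ v                                       ≡⟨ ∑-cong
        (λ x → cong (λ u → χ u * χ (x ⊝ 1#)) (solve 1 (λ x → x := x :- con 0ℤ) refl x)) ⟩
    ∑ (λ x → χ (x ⊝ 0#) * χ (x ⊝ 1#))         ≡⟨ ∑χχ 0# 1# ⟩
    + q * δ 0# 1# - 1ℤ                        ≡⟨ cong (λ d → + q * d - 1ℤ) (δ-≢ {0#} {1#} (1≢0 ∘ sym)) ⟩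
    + q * 0ℤ - 1ℤ                             ≡⟨ cong (_- 1ℤ) (ℤ.*-zeroʳ (+ q)) ⟩
    -1ℤ ∎

  κ : ℤ
  κ = ∑ k

  -- Four times the number (q - 5) / 4 of common neighbours of two adjacent vertices of the Paley
  -- graph.
  κ≡q-5 : κ ≡ + q - + 5
  κ≡q-5 = begin
    ∑ k
      ≡⟨ ∑-cong (λ x → trans (k-form x) (as-lin (δ x 0#) (δ x 1#) (χ x) (χ (x ⊝ 1#)) (v x))) ⟩
    ∑ (lincomb fs)
      ≡⟨ ∑-lincomb fs ⟩
    1ℤ * ∑ (λ _ → 1ℤ) + (- + 2 * ∑ (λ x → δ x 0#) +
        (- + 2 * ∑ (λ x → δ x 1#) + (1ℤ * ∑ χ + (1ℤ * ∑ (λ x → χ (x ⊝ 1#)) + (1ℤ * ∑ v + 0ℤ)))))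
      ≡⟨ cong₂ (λ a b → 1ℤ * a + (- + 2 * ∑ (λ x → δ x 0#) +
          (- + 2 * ∑ (λ x → δ x 1#) + (1ℤ * ∑ χ + (1ℤ * ∑ (λ x → χ (x ⊝ 1#)) + (1ℤ * b + 0ℤ)))))) ∑-1 ∑v ⟩
    1ℤ * + q + (- + 2 * ∑ (λ x → δ x 0#) +
        (- + 2 * ∑ (λ x → δ x 1#) + (1ℤ * ∑ χ + (1ℤ * ∑ (λ x → χ (x ⊝ 1#)) + (1ℤ * -1ℤ + 0ℤ)))))
      ≡⟨ cong₂ (λ a b → 1ℤ * + q + (- + 2 * a +
          (- + 2 * b + (1ℤ * ∑ χ + (1ℤ * ∑ (λ x → χ (x ⊝ 1#)) + (1ℤ * -1ℤ + 0ℤ)))))) (∑-δ-1 0#) (∑-δ-1 1#) ⟩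
    1ℤ * + q + (- + 2 * 1ℤ + (- + 2 * 1ℤ + (1ℤ * ∑ χ + (1ℤ * ∑ (λ x → χ (x ⊝ 1#)) + (1ℤ * -1ℤ + 0ℤ)))))
      ≡⟨ cong₂ (λ a b → 1ℤ * + q + (- + 2 * 1ℤ + (- + 2 * 1ℤ + (1ℤ * a + (1ℤ * b + (1ℤ * -1ℤ + 0ℤ)))))) ∑χ
          (∑χ-shift 1#) ⟩
    1ℤ * + q + (- + 2 * 1ℤ + (- + 2 * 1ℤ + (1ℤ * 0ℤ + (1ℤ * 0ℤ + (1ℤ * -1ℤ + 0ℤ)))))
      ≡⟨ simp (+ q) ⟩
    + q - + 5 ∎
    where
    fs = (1ℤ , (λ _ → 1ℤ)) ∷ (- + 2 , (λ x → δ x 0#)) ∷ (- + 2 , (λ x → δ x 1#)) ∷ (1ℤ , χ) ∷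
        (1ℤ , (λ x → χ (x ⊝ 1#))) ∷ (1ℤ , v) ∷ []
    as-lin : ∀ a b c d v → 1ℤ - + 2 * a - + 2 * b + c + d + v ≡
      1ℤ * 1ℤ + (- + 2 * a + (- + 2 * b + (1ℤ * c + (1ℤ * d + (1ℤ * v + 0ℤ)))))
    as-lin = solve-∀
    simp : ∀ q → 1ℤ * q + (- + 2 * 1ℤ + (- + 2 * 1ℤ + (1ℤ * 0ℤ + (1ℤ * 0ℤ + (1ℤ * -1ℤ + 0ℤ))))) ≡ q - + 5
    simp = solve-∀

  M : Fin q → ℤ
  M z = ∑ (λ x → k x * χ (x ⊝ z))

  -- Of the terms of `k-form`, only `v` leaves a cubic sum, namely `L z`; the others become values
  -- of `χ` or instances of `∑χχ`.
  M-form : ∀ z → M z ≡ - + 2 * χ z - + 2 * χ (z ⊝ 1#) + (+ q * δ z 0# - 1ℤ) + (+ q * δ z 1# - 1ℤ) + L z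
  M-form z = begin
    ∑ (λ x → k x * χ (x ⊝ z))
      ≡⟨ ∑-cong (λ x → trans (cong (_* χ (x ⊝ z)) (k-form x))
          (as-lin (δ x 0#) (δ x 1#) (χ x) (χ (x ⊝ 1#)) (v x) (χ (x ⊝ z)))) ⟩
    ∑ (lincomb fs)
      ≡⟨ ∑-lincomb fs ⟩
    s1 ∑1 ∑2 ∑3 ∑4 ∑5
      ≡⟨ cong₂ (λ a b → s1 a b ∑3 ∑4 ∑5) (∑χ-shift z) (trans (∑-δ (λ x → χ (x ⊝ z)) 0#)
           (trans (cong χ (solve 1 (λ z → con 0ℤ :- z := :- z) refl z)) (χ-neg z))) ⟩
    s1 0ℤ (χ z) ∑3 ∑4 ∑5
      ≡⟨ cong₂ (λ a b → s1 0ℤ (χ z) a b ∑5) (trans (∑-δ (λ x → χ (x ⊝ z)) 1#) (χ-⊝-comm 1# z))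
           (trans (∑-cong (λ x → cong (λ u → χ u * χ (x ⊝ z)) (solve 1 (λ x → x := x :- con 0ℤ) refl x)))
               (trans (∑χχ 0# z) (cong (λ d → + q * d - 1ℤ) (δ-comm 0# z)))) ⟩
    s1 0ℤ (χ z) (χ (z ⊝ 1#)) (+ q * δ z 0# - 1ℤ) ∑5
      ≡⟨ cong (s1 0ℤ (χ z) (χ (z ⊝ 1#)) (+ q * δ z 0# - 1ℤ))
          (trans (∑χχ 1# z) (cong (λ d → + q * d - 1ℤ) (δ-comm 1# z))) ⟩
    s1 0ℤ (χ z) (χ (z ⊝ 1#)) (+ q * δ z 0# - 1ℤ) (+ q * δ z 1# - 1ℤ)
      ≡⟨ simp (χ z) (χ (z ⊝ 1#)) (+ q * δ z 0# - 1ℤ) (+ q * δ z 1# - 1ℤ) (L z) ⟩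
    - + 2 * χ z - + 2 * χ (z ⊝ 1#) + (+ q * δ z 0# - 1ℤ) + (+ q * δ z 1# - 1ℤ) + L z ∎
    where
    fs = (1ℤ , (λ x → χ (x ⊝ z))) ∷ (- + 2 , (λ x → δ x 0# * χ (x ⊝ z))) ∷ (- + 2 , (λ x → δ x 1# * χ (x ⊝ z)))
       ∷ (1ℤ , (λ x → χ x * χ (x ⊝ z))) ∷ (1ℤ , (λ x → χ (x ⊝ 1#) * χ (x ⊝ z))) ∷ (1ℤ , (λ x → v x * χ (x ⊝ z))) ∷ []
    s1 : ℤ → ℤ → ℤ → ℤ → ℤ → ℤ
    s1 a b c d e = 1ℤ * a + (- + 2 * b + (- + 2 * c + (1ℤ * d + (1ℤ * e + (1ℤ * L z + 0ℤ)))))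
    ∑1 = ∑ (λ x → χ (x ⊝ z))
    ∑2 = ∑ (λ x → δ x 0# * χ (x ⊝ z))
    ∑3 = ∑ (λ x → δ x 1# * χ (x ⊝ z))
    ∑4 = ∑ (λ x → χ x * χ (x ⊝ z))
    ∑5 = ∑ (λ x → χ (x ⊝ 1#) * χ (x ⊝ z))
    as-lin : ∀ a b c d v y → (1ℤ - + 2 * a - + 2 * b + c + d + v) * y ≡
      1ℤ * y + (- + 2 * (a * y) + (- + 2 * (b * y) + (1ℤ * (c * y) + (1ℤ * (d * y) + (1ℤ * (v * y) + 0ℤ)))))
    as-lin = solve-∀
    simp : ∀ b c d e l → 1ℤ * 0ℤ + (- + 2 * b + (- + 2 * c + (1ℤ * d + (1ℤ * e + (1ℤ * l + 0ℤ))))) ≡ - + 2 * b -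
        + 2 * c + d + e + l
    simp = solve-∀

  weighted-M : ∀ u z → u * M z ≡
    - + 2 * (u * χ z) - + 2 * (u * χ (z ⊝ 1#)) + + q * (u * δ z 0#) + + q * (u * δ z 1#) - + 2 * u + u * L z
  weighted-M u z = trans (cong (u *_) (M-form z)) (expand u (χ z) (χ (z ⊝ 1#)) (+ q) (δ z 0#) (δ z 1#) (L z))
    where
    expand : ∀ u c d q a b l → u * (- + 2 * c - + 2 * d + (q * a - 1ℤ) + (q * b - 1ℤ) + l) ≡
      - + 2 * (u * c) - + 2 * (u * d) + q * (u * a) + q * (u * b) - + 2 * u + u * l
    expand = solve-∀

  -- Since `χ` squares to 1 away from 0, `v` times one of its own characters is the other character
  -- up to a delta. The two deltas give 2 each, and -2 times `∑v` gives another 2.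
  ∑vM : ∑ (λ z → v z * M z) ≡ + 6 + W
  ∑vM = begin
    ∑ (λ z → v z * M z)
      ≡⟨ ∑-cong (λ z → trans (weighted-M (v z) z) (pointwise z)) ⟩
    ∑ (lincomb fs)
      ≡⟨ ∑-lincomb fs ⟩
    s (∑ (λ z → χ (z ⊝ 1#))) (∑ (λ z → δ z 0#)) (∑ χ) (∑ (λ z → δ z 1#)) (∑ v)
      ≡⟨ cong₂ (λ a b → s a b (∑ χ) (∑ (λ z → δ z 1#)) (∑ v)) (∑χ-shift 1#) (∑-δ-1 0#) ⟩
    s 0ℤ 1ℤ (∑ χ) (∑ (λ z → δ z 1#)) (∑ v)
      ≡⟨ cong₂ (λ a b → s 0ℤ 1ℤ a b (∑ v)) ∑χ (∑-δ-1 1#) ⟩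
    s 0ℤ 1ℤ 0ℤ 1ℤ (∑ v)
      ≡⟨ cong (s 0ℤ 1ℤ 0ℤ 1ℤ) ∑v ⟩
    s 0ℤ 1ℤ 0ℤ 1ℤ -1ℤ
      ≡⟨ simp W ⟩
    + 6 + W ∎
    where
    fs = (- + 2 , (λ z → χ (z ⊝ 1#))) ∷ (+ 2 , (λ z → δ z 0#)) ∷ (- + 2 , χ) ∷ (+ 2 , (λ z → δ z 1#)) ∷
        (- + 2 , v) ∷ (1ℤ , (λ z → v z * L z)) ∷ []
    s : ℤ → ℤ → ℤ → ℤ → ℤ → ℤ
    s a b c d e = - + 2 * a + (+ 2 * b + (- + 2 * c + (+ 2 * d + (- + 2 * e + (1ℤ * W + 0ℤ)))))
    simp : ∀ w → - + 2 * 0ℤ + (+ 2 * 1ℤ + (- + 2 * 0ℤ + (+ 2 * 1ℤ + (- + 2 * -1ℤ + (1ℤ * w + 0ℤ))))) ≡ + 6 + w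
    simp = solve-∀
    assoc₁ : ∀ a b → a * b * a ≡ a * a * b
    assoc₁ = solve-∀
    sub-* : ∀ d x → (1ℤ - d) * x ≡ x - d * x
    sub-* = solve-∀
    vχ : ∀ z → v z * χ z ≡ χ (z ⊝ 1#) - δ z 0#
    vχ z = trans (assoc₁ (χ z) (χ (z ⊝ 1#))) (trans (cong (_* χ (z ⊝ 1#)) (χ² z))
      (trans (sub-* (δ z 0#) (χ (z ⊝ 1#))) (cong (λ x → χ (z ⊝ 1#) - x) (δ₀χ₁ z))))
    vχ₁ : ∀ z → v z * χ (z ⊝ 1#) ≡ χ z - δ z 1#
    vχ₁ z = trans (ℤ.*-assoc (χ z) _ _) (trans (cong (χ z *_) (trans (χ² (z ⊝ 1#)) (cong (λ d → 1ℤ - d) (δ-⊝ z 1#))))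
      (trans (trans (ℤ.*-comm (χ z) _) (sub-* (δ z 1#) (χ z))) (cong (λ x → χ z - x) (δ₁χ z))))
    vδ₀ : ∀ z → v z * δ z 0# ≡ 0ℤ
    vδ₀ z = trans (rearr (χ z) (χ (z ⊝ 1#)) (δ z 0#)) (trans (cong (_* χ (z ⊝ 1#)) (δχ₀ z)) refl)
      where
      rearr : ∀ a b d → a * b * d ≡ d * a * b
      rearr = solve-∀
    vδ₁ : ∀ z → v z * δ z 1# ≡ 0ℤ
    vδ₁ z = trans (rearr (χ z) (χ (z ⊝ 1#)) (δ z 1#)) (trans (cong (λ d → d * χ (z ⊝ 1#) * χ z) (sym (δ-⊝ z 1#)))
      (cong (_* χ z) (δχ₀ (z ⊝ 1#))))
      where
      rearr : ∀ a b d → a * b * d ≡ d * b * a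
      rearr = solve-∀
    collect : ∀ c c₁ d₀ d₁ q v l → - + 2 * (c₁ - d₀) - + 2 * (c - d₁) + q * 0ℤ + q * 0ℤ - + 2 * v + l ≡
      - + 2 * c₁ + (+ 2 * d₀ + (- + 2 * c + (+ 2 * d₁ + (- + 2 * v + (1ℤ * l + 0ℤ)))))
    collect = solve-∀
    pointwise : ∀ z → - + 2 * (v z * χ z) - + 2 * (v z * χ (z ⊝ 1#)) + + q * (v z * δ z 0#) + + q *
        (v z * δ z 1#) - + 2 * v z + v z * L z ≡ lincomb fs z
    pointwise z = trans
      (trans (cong₂ (λ a b → - + 2 * a - + 2 * b + + q * (v z * δ z 0#) + + q * (v z * δ z 1#) - + 2 * v z + v z
          * L z) (vχ z) (vχ₁ z))
             (cong₂ (λ a b → - + 2 * (χ (z ⊝ 1#) - δ z 0#) - + 2 * (χ z - δ z 1#) + + q * a + + q * b - + 2 * v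
                 z + v z * L z) (vδ₀ z) (vδ₁ z)))
      (collect (χ z) (χ (z ⊝ 1#)) (δ z 0#) (δ z 1#) (+ q) (v z) (v z * L z))

  -- The kernel `χ (x ⊝ z)` is symmetric, so the weights `k` and `v` can trade places. `M-form` then
  -- applies a second time and leaves `W` as the only unevaluated sum.
  ∑kL : ∑ (λ z → k z * L z) ≡ ∑ (λ x → v x * M x)
  ∑kL = begin
    ∑ (λ z → k z * L z)
      ≡⟨ ∑-cong (λ z → sym (∑-*ˡ (k z) (λ x → v x * χ (x ⊝ z)))) ⟩
    ∑ (λ z → ∑ (λ x → k z * (v x * χ (x ⊝ z))))
      ≡⟨ ∑-comm (λ z x → k z * (v x * χ (x ⊝ z))) ⟩
    ∑ (λ x → ∑ (λ z → k z * (v x * χ (x ⊝ z))))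
      ≡⟨ ∑-cong (λ x → trans (∑-cong λ z → trans (swap (k z) (v x) (χ (x ⊝ z)))
          (cong (λ u → v x * (k z * u)) (χ-⊝-comm x z)))
           (∑-*ˡ (v x) (λ z → k z * χ (z ⊝ x)))) ⟩
    ∑ (λ x → v x * M x) ∎
    where
    swap : ∀ a b c → a * (b * c) ≡ b * (a * c)
    swap = solve-∀

  -- On the support of `k` both characters are 1 and both deltas are 0, so `M-form` contributes -2 -
  -- 2 - 1 - 1 = -6 there, apart from `L`.
  ∑kM : ∑ (λ z → k z * M z) ≡ - + 6 * κ + (+ 6 + W)
  ∑kM = begin
    ∑ (λ z → k z * M z)
      ≡⟨ ∑-cong (λ z → trans (weighted-M (k z) z) (pointwise z)) ⟩
    ∑ (lincomb ((- + 6 , k) ∷ (1ℤ , (λ z → k z * L z)) ∷ []))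
      ≡⟨ ∑-lincomb ((- + 6 , k) ∷ (1ℤ , (λ z → k z * L z)) ∷ []) ⟩
    - + 6 * κ + (1ℤ * ∑ (λ z → k z * L z) + 0ℤ)
      ≡⟨ cong (λ a → - + 6 * κ + a) (trans (ℤ.+-identityʳ _) (trans (ℤ.*-identityˡ _) (trans ∑kL ∑vM))) ⟩
    - + 6 * κ + (+ 6 + W) ∎
    where
    collect : ∀ k q l → - + 2 * k - + 2 * k + q * 0ℤ + q * 0ℤ - + 2 * k + l ≡ - + 6 * k + (1ℤ * l + 0ℤ)
    collect = solve-∀
    pointwise : ∀ z → - + 2 * (k z * χ z) - + 2 * (k z * χ (z ⊝ 1#)) + + q * (k z * δ z 0#) + + q *
        (k z * δ z 1#) - + 2 * k z + k z * L z
      ≡ - + 6 * k z + (1ℤ * (k z * L z) + 0ℤ)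
    pointwise z = trans
      (trans (cong₂ (λ a b → - + 2 * a - + 2 * b + + q * (k z * δ z 0#) + + q * (k z * δ z 1#) - + 2 * k z + k z
          * L z) (kχ z) (kχ₁ z))
             (cong₂ (λ a b → - + 2 * k z - + 2 * k z + + q * a + + q * b - + 2 * k z + k z * L z) (kδ₀ z) (kδ₁ z)))
      (collect (k z) (+ q) (k z * L z))

  Q : ℤ
  Q = ∑ (λ y → k y * ∑ (λ z → k z * e (y ⊝ z)))

  -- The three terms of `e (y ⊝ z)` contribute κ², -4 κ (as `k` squared is 4 `k`) and `∑kM`, in
  -- total κ² - 10 κ + 6 + W.
  Q≡ : Q ≡ + q * + q - + 22 * + q + + 81 + jacobsthal 1# * jacobsthal 1#
  Q≡ = begin
    Q
      ≡⟨ ∑-cong (λ y → cong (k y *_) (inner y)) ⟩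
    ∑ (λ y → k y * (κ - k y + M y))
      ≡⟨ ∑-cong (λ y → trans (expand κ (k y) (M y))
          (cong (λ u → κ * k y + (-1ℤ * u + (1ℤ * (k y * M y) + 0ℤ))) (k² y))) ⟩
    ∑ (λ y → κ * k y + (-1ℤ * (+ 4 * k y) + (1ℤ * (k y * M y) + 0ℤ)))
      ≡⟨ ∑-lincomb ((κ , k) ∷ (-1ℤ , (λ y → + 4 * k y)) ∷ (1ℤ , (λ y → k y * M y)) ∷ []) ⟩
    κ * κ + (-1ℤ * ∑ (λ y → + 4 * k y) + (1ℤ * ∑ (λ y → k y * M y) + 0ℤ))
      ≡⟨ cong₂ (λ a b → κ * κ + (-1ℤ * a + (1ℤ * b + 0ℤ))) (∑-*ˡ (+ 4) k) ∑kM ⟩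
    κ * κ + (-1ℤ * (+ 4 * κ) + (1ℤ * (- + 6 * κ + (+ 6 + W)) + 0ℤ))
      ≡⟨ cong₂ (λ k w → k * k + (-1ℤ * (+ 4 * k) + (1ℤ * (- + 6 * k + (+ 6 + w)) + 0ℤ))) κ≡q-5 W≡jacobsthal²-2q ⟩
    (+ q - + 5) * (+ q - + 5) + (-1ℤ * (+ 4 * (+ q - + 5)) +
        (1ℤ * (- + 6 * (+ q - + 5) + (+ 6 + (t * t - + 2 * + q))) + 0ℤ))
      ≡⟨ simp (+ q) t ⟩
    + q * + q - + 22 * + q + + 81 + t * t ∎
    where
    t = jacobsthal 1#
    expand : ∀ K k m → k * (K - k + m) ≡ K * k + (-1ℤ * (k * k) + (1ℤ * (k * m) + 0ℤ))
    expand = solve-∀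
    simp : ∀ q t → (q - + 5) * (q - + 5) +
        (-1ℤ * (+ 4 * (q - + 5)) + (1ℤ * (- + 6 * (q - + 5) + (+ 6 + (t * t - + 2 * q))) + 0ℤ))
      ≡ q * q - + 22 * q + + 81 + t * t
    simp = solve-∀
    expand₂ : ∀ k d c → k * (1ℤ - d + c) ≡ 1ℤ * k + (-1ℤ * (d * k) + (1ℤ * (k * c) + 0ℤ))
    expand₂ = solve-∀
    simp₂ : ∀ a b c → 1ℤ * a + (-1ℤ * b + (1ℤ * c + 0ℤ)) ≡ a - b + c
    simp₂ = solve-∀
    inner : ∀ y → ∑ (λ z → k z * e (y ⊝ z)) ≡ κ - k y + M y
    inner y = begin
      ∑ (λ z → k z * e (y ⊝ z))
        ≡⟨ ∑-cong (λ z → trans (cong (k z *_) (e-⊝-comm y z)) (trans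
             (cong (λ d → k z * (1ℤ - d + χ (z ⊝ y))) (δ-⊝ z y)) (expand₂ (k z) (δ z y) (χ (z ⊝ y))))) ⟩
      ∑ (lincomb fs)
        ≡⟨ ∑-lincomb fs ⟩
      1ℤ * κ + (-1ℤ * ∑ (λ z → δ z y * k z) + (1ℤ * M y + 0ℤ))
        ≡⟨ cong (λ a → 1ℤ * κ + (-1ℤ * a + (1ℤ * M y + 0ℤ))) (∑-δ k y) ⟩
      1ℤ * κ + (-1ℤ * k y + (1ℤ * M y + 0ℤ))
        ≡⟨ simp₂ κ (k y) (M y) ⟩
      κ - k y + M y ∎
      where
      fs = (1ℤ , k) ∷ (-1ℤ , (λ z → δ z y * k z)) ∷ (1ℤ , (λ z → k z * χ (z ⊝ y))) ∷ []

  ∑e : ∑ e ≡ + q - 1ℤ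
  ∑e = begin
    ∑ e
      ≡⟨ ∑-cong (λ x → as-lin (δ x 0#) (χ x)) ⟩
    ∑ (lincomb fs)
      ≡⟨ ∑-lincomb fs ⟩
    1ℤ * ∑ (λ _ → 1ℤ) + (-1ℤ * ∑ (λ x → δ x 0#) + (1ℤ * ∑ χ + 0ℤ))
      ≡⟨ cong₂ (λ a b → 1ℤ * a + (-1ℤ * b + (1ℤ * ∑ χ + 0ℤ))) ∑-1 (∑-δ-1 0#) ⟩
    1ℤ * + q + (-1ℤ * 1ℤ + (1ℤ * ∑ χ + 0ℤ))
      ≡⟨ cong (λ a → 1ℤ * + q + (-1ℤ * 1ℤ + (1ℤ * a + 0ℤ))) ∑χ ⟩
    1ℤ * + q + (-1ℤ * 1ℤ + (1ℤ * 0ℤ + 0ℤ))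
      ≡⟨ simp (+ q) ⟩
    + q - 1ℤ ∎
    where
    fs = (1ℤ , (λ _ → 1ℤ)) ∷ (-1ℤ , (λ x → δ x 0#)) ∷ (1ℤ , χ) ∷ []
    as-lin : ∀ d c → 1ℤ - d + c ≡ 1ℤ * 1ℤ + (-1ℤ * d + (1ℤ * c + 0ℤ))
    as-lin = solve-∀
    simp : ∀ q → 1ℤ * q + (-1ℤ * 1ℤ + (1ℤ * 0ℤ + 0ℤ)) ≡ q - 1ℤ
    simp = solve-∀

  e-square-* : ∀ {z} → z ≢ 0# → ∀ x → e (z ⊗ z ⊗ x) ≡ e x
  e-square-* {z} z≢0 x = cong₂ (λ a b → 1ℤ - a + b)
    (δ-cong {z ⊗ z ⊗ x} {0#} {x} {0#}
      (λ eq → [ (λ zz≡0 → contradiction zz≡0 (⊗≢0 z≢0 z≢0)) , (λ p → p) ]′ (⊗≡0 (z ⊗ z) x eq))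
      (λ { refl → ⊗-zeroʳ (z ⊗ z) }))
    (χ-square-* z≢0 x)

  private
    R : Fin q → ℤ
    R x = ∑ (λ y → e y * e (x ⊝ y) * ∑ (λ z → e z * e (x ⊝ z) * e (y ⊝ z)))

    -- For x = s² nonzero, scaling the two inner variables by s² changes no value of `e`. For all
    -- other x the factor `e x` is 0, which is why it stays on both sides.
    eR : ∀ x → e x * R x ≡ e x * Q
    eR x with classify x
    ... | isZero refl = trans (cong (_* R 0#) e0) (cong (_* Q) (sym e0))
      where
      e0 : e 0# ≡ 0ℤ
      e0 = cong₂ (λ a b → 1ℤ - a + b) (δ-≡ {0#} refl) χ-0
    ... | nonsquare ns = trans (cong (_* R x) ex) (cong (_* Q) (sym ex))
      where
      ex : e x ≡ 0ℤ
      ex = cong₂ (λ a b → 1ℤ - a + b) (δ-≢ (nonsquare≢0 ns)) (χ-nonsquare ns)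
    ... | square s s≢0 refl = cong (e (s ⊗ s) *_) (begin
      R (s ⊗ s)
        ≡⟨ ∑-scale _ (s ⊗ s) ss≢0 ⟩
      ∑ (λ y → e (s ⊗ s ⊗ y) * e (s ⊗ s ⊝ s ⊗ s ⊗ y) * ∑ (λ z → e z * e (s ⊗ s ⊝ z) * e (s ⊗ s ⊗ y ⊝ z)))
        ≡⟨ ∑-cong (λ y → cong₂ _*_ (pair y) (trans (∑-scale _ (s ⊗ s) ss≢0) (∑-cong λ z → cong₂ _*_ (pair z)
             (trans (cong e (solve 3 (λ s y z → s :* s :* y :- s :* s :* z := s :* s :* (y :- z)) refl s y z))
                 (e-square-* s≢0 (y ⊝ z)))))) ⟩
      Q ∎)
      where
      ss≢0 = ⊗≢0 s≢0 s≢0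
      pair : ∀ y → e (s ⊗ s ⊗ y) * e (s ⊗ s ⊝ s ⊗ s ⊗ y) ≡ k y
      pair y = cong₂ _*_ (e-square-* s≢0 y) (begin
        e (s ⊗ s ⊝ s ⊗ s ⊗ y)    ≡⟨ cong e
            (solve 2 (λ s y → s :* s :- s :* s :* y := s :* s :* (con 1ℤ :- y)) refl s y) ⟩
        e (s ⊗ s ⊗ (1# ⊝ y))     ≡⟨ e-square-* s≢0 (1# ⊝ y) ⟩
        e (1# ⊝ y)               ≡⟨ e-⊝-comm 1# y ⟩
        e (y ⊝ 1#) ∎)

  -- Translate the first vertex to 0, then scale the second one to 1.
  tupleSum-e : tupleSum 4 (λ _ → 1ℤ) (λ x y → e (x ⊝ y)) ≡ + q * ((+ q - 1ℤ) * Q)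
  tupleSum-e = begin
    ∑ (λ w → 1ℤ * S w)
      ≡⟨ ∑-cong (λ w → trans (ℤ.*-identityˡ (S w)) (trans (S-const w) (sym (ℤ.*-identityʳ ((+ q - 1ℤ) * Q))))) ⟩
    ∑ (λ w → (+ q - 1ℤ) * Q * 1ℤ)
      ≡⟨ ∑-*ˡ ((+ q - 1ℤ) * Q) (λ _ → 1ℤ) ⟩
    (+ q - 1ℤ) * Q * ∑ (λ _ → 1ℤ)
      ≡⟨ cong ((+ q - 1ℤ) * Q *_) ∑-1 ⟩
    (+ q - 1ℤ) * Q * + q
      ≡⟨ ℤ.*-comm _ (+ q) ⟩
    + q * ((+ q - 1ℤ) * Q) ∎
    where
    S : Fin q → ℤ
    S w = tupleSum 3 (λ x → 1ℤ * e (w ⊝ x)) (λ x y → e (x ⊝ y))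
    one : ∀ w x → 1ℤ * e (w ⊝ (x ⊕ w)) ≡ e x
    one w x = trans (ℤ.*-identityˡ _) (trans (cong e (solve 2 (λ w x → w :- (x :+ w) := :- x) refl w x)) (e-neg x))
    two : ∀ w x y → e (x ⊕ w ⊝ (y ⊕ w)) ≡ e (x ⊝ y)
    two w x y = cong e (solve 3 (λ w x y → x :+ w :- (y :+ w) := x :- y) refl w x y)
    S-const : ∀ w → S w ≡ (+ q - 1ℤ) * Q
    S-const w = begin
      S w
        ≡⟨ ∑-shift _ w ⟩
      _ ≡⟨ ∑-cong (λ x → cong₂ _*_ (one w x) (trans (∑-shift _ w) (∑-cong λ y → cong₂ _*_
             (cong₂ _*_ (one w y) (two w x y)) (trans (∑-shift _ w) (∑-cong λ z → trans (ℤ.*-identityʳ _)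
             (cong₂ _*_ (cong₂ _*_ (one w z) (two w x z)) (two w y z))))))) ⟩
      ∑ (λ x → e x * R x)
        ≡⟨ ∑-cong eR ⟩
      ∑ (λ x → e x * Q)
        ≡⟨ ∑-*ʳ e Q ⟩
      ∑ e * Q
        ≡⟨ cong (_* Q) ∑e ⟩
      (+ q - 1ℤ) * Q ∎

-- Sums of two squares

i*i≡+∣i∣² : ∀ i → i * i ≡ + (∣ i ∣ ℕ.* ∣ i ∣)
i*i≡+∣i∣² (+ n) = sym (ℤ.pos-* n n)
i*i≡+∣i∣² -[1+ n ] = refl

m²≤n²⇒m≤n : ∀ {m n} → m ℕ.* m ℕ.≤ n ℕ.* n → m ℕ.≤ n
m²≤n²⇒m≤n {m} {n} le with m ℕ.≤? n
... | yes m≤n = m≤n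
... | no m≰n = contradiction le (ℕ.<⇒≱ (ℕ.*-mono-< (ℕ.≰⇒> m≰n) (ℕ.≰⇒> m≰n)))

-- |N| ≤ p, and |N| = p is excluded by parity.
even-multiple≡0 : ∀ {p} → ¬ 2 ℕ∣.∣ p → ∀ N M → + p * + p ≡ N * N + M * M →
  p ℕ∣.∣ ∣ N ∣ → 2 ℕ∣.∣ ∣ N ∣ → N ≡ 0ℤ
even-multiple≡0 {p} 2∤p N M eq p∣N 2∣N = ℤ.∣i∣≡0⇒i≡0 (vanish ∣ N ∣ N²≤p² p∣N 2∣N)
  where
  N²≤p² : ∣ N ∣ ℕ.* ∣ N ∣ ℕ.≤ p ℕ.* p
  N²≤p² = subst (∣ N ∣ ℕ.* ∣ N ∣ ℕ.≤_) (ℤ.+-injective (begin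
    + (∣ N ∣ ℕ.* ∣ N ∣ ℕ.+ ∣ M ∣ ℕ.* ∣ M ∣)      ≡⟨ ℤ.pos-+ (∣ N ∣ ℕ.* ∣ N ∣) _ ⟩
    + (∣ N ∣ ℕ.* ∣ N ∣) + + (∣ M ∣ ℕ.* ∣ M ∣)    ≡⟨ cong₂ _+_ (i*i≡+∣i∣² N) (i*i≡+∣i∣² M) ⟨
    N * N + M * M                                ≡⟨ eq ⟨
    + p * + p                                    ≡⟨ ℤ.pos-* p p ⟨
    + (p ℕ.* p) ∎)) (ℕ.m≤m+n (∣ N ∣ ℕ.* ∣ N ∣) _)
  vanish : ∀ n → n ℕ.* n ℕ.≤ p ℕ.* p → p ℕ∣.∣ n → 2 ℕ∣.∣ n → n ≡ 0
  vanish zero _ _ _ = refl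
  vanish n@(suc _) n²≤p² p∣n 2∣n =
    contradiction (subst (2 ℕ∣.∣_) (ℕ.≤-antisym (m²≤n²⇒m≤n n²≤p²) (ℕ∣.∣⇒≤ p∣n)) 2∣n) 2∤p

-- N = a c - b d and N′ = a c + b d are even with N N′ = p (a² - d²); whichever is divisible by p vanishes.
two-squares-unique : ∀ {p} → Prime p → ¬ 2 ℕ∣.∣ p → ∀ a b c d →
  + p ≡ a * a + b * b → + p ≡ c * c + d * d → 2 ℕ∣.∣ ∣ a ∣ → 2 ℕ∣.∣ ∣ d ∣ → c * c ≡ b * b
two-squares-unique {p} p-prime 2∤p a b c d ab cd 2∣a 2∣d = from-zero NN′≡0
  where
  instance _ = prime⇒nonZero p-prime
  N N′ : ℤ
  N = a * c - b * d
  N′ = a * c + b * d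
  NN′ : N * N′ ≡ + p * (a * a - d * d)
  NN′ = begin
    N * N′                                               ≡⟨ expand a b c d ⟩
    a * a * (c * c + d * d) - d * d * (a * a + b * b)    ≡⟨ cong₂ (λ x y → a * a * x - d * d * y) cd ab ⟨
    a * a * + p - d * d * + p                            ≡⟨ factor a d (+ p) ⟩
    + p * (a * a - d * d) ∎
    where
    expand : ∀ a b c d → (a * c - b * d) * (a * c + b * d) ≡ a * a * (c * c + d * d) - d * d * (a * a + b * b)
    expand = solve-∀
    factor : ∀ a d p → a * a * p - d * d * p ≡ p * (a * a - d * d)
    factor = solve-∀
  p∣NN′ : p ℕ∣.∣ ∣ N ∣ ℕ.* ∣ N′ ∣
  p∣NN′ = subst (p ℕ∣.∣_) (trans (sym (ℤ.abs-* (+ p) (a * a - d * d))) (trans (cong ∣_∣ (sym NN′)) (ℤ.abs-* N N′)))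
    (ℕ∣.m∣m*n ∣ a * a - d * d ∣)
  even-l : ∀ x y → 2 ℕ∣.∣ ∣ x ∣ → 2 ℕ∣.∣ ∣ x * y ∣
  even-l x y 2∣x = subst (2 ℕ∣.∣_) (sym (ℤ.abs-* x y)) (ℕ∣.∣m⇒∣m*n ∣ y ∣ 2∣x)
  even-r : ∀ x y → 2 ℕ∣.∣ ∣ y ∣ → 2 ℕ∣.∣ ∣ x * y ∣
  even-r x y 2∣y = subst (2 ℕ∣.∣_) (sym (ℤ.abs-* x y)) (ℕ∣.∣n⇒∣m*n ∣ x ∣ 2∣y)
  even-+ : ∀ x y → 2 ℕ∣.∣ ∣ x ∣ → 2 ℕ∣.∣ ∣ y ∣ → 2 ℕ∣.∣ ∣ x + y ∣
  even-+ x y 2∣x 2∣y = ∣⇒∣ᵤ (∣m∣n⇒∣m+n (∣ᵤ⇒∣ {+ 2} {x} 2∣x) (∣ᵤ⇒∣ {+ 2} {y} 2∣y))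
  2∣N : 2 ℕ∣.∣ ∣ N ∣
  2∣N = even-+ (a * c) (- (b * d)) (even-l a c 2∣a) (subst (2 ℕ∣.∣_) (sym (ℤ.∣-i∣≡∣i∣ (b * d))) (even-r b d 2∣d))
  2∣N′ : 2 ℕ∣.∣ ∣ N′ ∣
  2∣N′ = even-+ (a * c) (b * d) (even-l a c 2∣a) (even-r b d 2∣d)
  -- Brahmagupta's identity with both choices of sign: it writes p² as a sum of two squares, one of
  -- them that of `N` or `N′`, as `even-multiple≡0` requires.
  norm : ∀ a b c d → (a * a + b * b) * (c * c + d * d) ≡ (a * c - b * d) * (a * c - b * d) + (a * d + b * c) *
      (a * d + b * c)
  norm = solve-∀
  norm′ : ∀ a b c d → (a * a + b * b) * (c * c + d * d) ≡ (a * c + b * d) * (a * c + b * d) + (a * d - b * c) *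
      (a * d - b * c)
  norm′ = solve-∀
  NN′≡0 : N * N′ ≡ 0ℤ
  NN′≡0 with euclidsLemma ∣ N ∣ ∣ N′ ∣ p-prime p∣NN′
  ... | inj₁ p∣N = cong (_* N′) (even-multiple≡0 2∤p N (a * d + b * c) (trans (cong₂ _*_ ab cd) (norm a b c d)) p∣N 2∣N)
  ... | inj₂ p∣N′ = trans (cong (N *_)
      (even-multiple≡0 2∤p N′ (a * d - b * c) (trans (cong₂ _*_ ab cd) (norm′ a b c d)) p∣N′ 2∣N′)) (ℤ.*-zeroʳ N)
  from-zero : N * N′ ≡ 0ℤ → c * c ≡ b * b
  -- The factorization of N N′ is now read in the other direction: a vanishing product forces a² =
  -- d², and comparing the two representations of `p` gives c² = b².
  from-zero eq with ℤ.i*j≡0⇒i≡0∨j≡0 (+ p) (trans (sym NN′) eq)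
  ... | inj₁ p≡0 = contradiction (ℤ.+-injective p≡0) (ℕ.≢-nonZero⁻¹ p)
  ... | inj₂ a²-d²≡0 = begin
    c * c                                     ≡⟨ isolate c d ⟩
    c * c + d * d - d * d                     ≡⟨ cong (_- d * d) (trans (sym cd) ab) ⟩
    a * a + b * b - d * d                     ≡⟨ rearr a b d ⟩
    a * a - d * d + b * b                     ≡⟨ cong (_+ b * b) a²-d²≡0 ⟩
    0ℤ + b * b                                ≡⟨ ℤ.+-identityˡ _ ⟩
    b * b ∎
    where
    isolate : ∀ c d → c * c ≡ c * c + d * d - d * d
    isolate = solve-∀
    rearr : ∀ a b d → a * a + b * b - d * d ≡ a * a - d * d + b * b
    rearr = solve-∀

-- Jacobsthal's theorem

module JacobsthalSums {q : ℕ} (K : FiniteField q) where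
  open Character K
  open CharacterSums K
  open TripleSums K
  open PaleySums K

  private
    T = jacobsthal

  T-scale : ∀ {c} → c ≢ 0# → ∀ k → T (c ⊗ c ⊗ k) ≡ χ c * T k
  T-scale {c} c≢0 k = begin
    T (c ⊗ c ⊗ k)
      ≡⟨ ∑-scale _ c c≢0 ⟩
    ∑ (λ x → χ (c ⊗ x) * χ (c ⊗ x ⊗ (c ⊗ x) ⊝ c ⊗ c ⊗ k))
      ≡⟨ ∑-cong (λ x → trans (cong₂ _*_ (χ-* c x) (trans
           (cong χ (solve 3 (λ c x k → c :* x :* (c :* x) :- c :* c :* k := c :* c :* (x :* x :- k)) refl c x k))
           (χ-square-* c≢0 (x ⊗ x ⊝ k)))) (ℤ.*-assoc (χ c) (χ x) _)) ⟩
    ∑ (λ x → χ c * (χ x * χ (x ⊗ x ⊝ k)))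
      ≡⟨ ∑-*ˡ (χ c) (λ x → χ x * χ (x ⊗ x ⊝ k)) ⟩
    χ c * T k ∎

  T²-scale : ∀ {c} → c ≢ 0# → ∀ k → T (c ⊗ c ⊗ k) * T (c ⊗ c ⊗ k) ≡ T k * T k
  T²-scale {c} c≢0 k = begin
    T (c ⊗ c ⊗ k) * T (c ⊗ c ⊗ k)  ≡⟨ cong₂ _*_ (T-scale c≢0 k) (T-scale c≢0 k) ⟩
    χ c * T k * (χ c * T k)        ≡⟨ rearr (χ c) (T k) ⟩
    χ c * χ c * (T k * T k)        ≡⟨ cong (_* (T k * T k)) (trans (χ² c) (cong (λ d → 1ℤ - d) (δ-≢ c≢0))) ⟩
    1ℤ * (T k * T k)               ≡⟨ ℤ.*-identityˡ _ ⟩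
    T k * T k ∎
    where
    rearr : ∀ a b → a * b * (a * b) ≡ a * a * (b * b)
    rearr = solve-∀

  T-0 : T 0# ≡ 0ℤ
  T-0 = trans (∑-cong pointwise) ∑χ
    where
    sub-* : ∀ d x → x * (1ℤ - d) ≡ x - d * x
    sub-* = solve-∀
    pointwise : ∀ x → χ x * χ (x ⊗ x ⊝ 0#) ≡ χ x
    pointwise x = begin
      χ x * χ (x ⊗ x ⊝ 0#)    ≡⟨ cong (χ x *_)
          (trans (cong χ (solve 1 (λ x → x :* x :- con 0ℤ := x :* x) refl x)) (χ-* x x)) ⟩
      χ x * (χ x * χ x)       ≡⟨ cong (χ x *_) (χ² x) ⟩
      χ x * (1ℤ - δ x 0#)     ≡⟨ sub-* (δ x 0#) (χ x) ⟩
      χ x - δ x 0# * χ x      ≡⟨ cong (λ a → χ x - a) (δχ₀ x) ⟩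
      χ x - 0ℤ                ≡⟨ ℤ.+-identityʳ (χ x) ⟩
      χ x ∎

  -- Summed over k first, the product of the terms at x and y is an instance of `∑χχ`, concentrated
  -- on y = ±x up to the constant -1. The constant drops out by `∑χ`; each nonzero x then
  -- contributes 2 q.
  ∑T² : ∑ (λ k → T k * T k) ≡ + 2 * + q * (+ q - 1ℤ)
  ∑T² = begin
    ∑ (λ k → T k * T k)
      ≡⟨ ∑-cong (λ k → trans (sym (∑-*ʳ (f k) (T k))) (∑-cong λ x → sym (∑-*ˡ (f k x) (f k)))) ⟩
    ∑ (λ k → ∑ (λ x → ∑ (λ y → f k x * f k y)))
      ≡⟨ ∑-comm (λ k x → ∑ (λ y → f k x * f k y)) ⟩
    ∑ (λ x → ∑ (λ k → ∑ (λ y → f k x * f k y)))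
      ≡⟨ ∑-cong (λ x → ∑-comm (λ k y → f k x * f k y)) ⟩
    ∑ (λ x → ∑ (λ y → ∑ (λ k → f k x * f k y)))
      ≡⟨ ∑-cong (λ x → trans (∑-cong (inner x)) (outer x)) ⟩
    ∑ (λ x → + 2 * + q * 1ℤ + (- (+ 2 * + q) * δ x 0# + (0ℤ * χ x + 0ℤ)))
      ≡⟨ ∑-lincomb ((+ 2 * + q , (λ _ → 1ℤ)) ∷ (- (+ 2 * + q) , (λ x → δ x 0#)) ∷ (0ℤ , χ) ∷ []) ⟩
    + 2 * + q * ∑ (λ _ → 1ℤ) + (- (+ 2 * + q) * ∑ (λ x → δ x 0#) + (0ℤ + 0ℤ))
      ≡⟨ cong₂ (λ a b → + 2 * + q * a + (- (+ 2 * + q) * b + (0ℤ + 0ℤ))) ∑-1 (∑-δ-1 0#) ⟩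
    + 2 * + q * + q + (- (+ 2 * + q) * 1ℤ + (0ℤ + 0ℤ))
      ≡⟨ simp (+ q) ⟩
    + 2 * + q * (+ q - 1ℤ) ∎
    where
    f : Fin q → Fin q → ℤ
    f k x = χ x * χ (x ⊗ x ⊝ k)
    simp : ∀ q → + 2 * q * q + (- (+ 2 * q) * 1ℤ + (0ℤ + 0ℤ)) ≡ + 2 * q * (q - 1ℤ)
    simp = solve-∀
    rearr : ∀ a b c d → a * b * (c * d) ≡ a * c * (b * d)
    rearr = solve-∀
    inner : ∀ x y → ∑ (λ k → f k x * f k y) ≡ χ x * χ y * (+ q * δ (y ⊗ y) (x ⊗ x) - 1ℤ)
    inner x y = begin
      ∑ (λ k → f k x * f k y)
        ≡⟨ ∑-cong (λ k → trans (rearr (χ x) (χ (x ⊗ x ⊝ k)) (χ y) (χ (y ⊗ y ⊝ k)))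
             (cong (χ x * χ y *_) (cong₂ _*_ (χ-⊝-comm (x ⊗ x) k) (χ-⊝-comm (y ⊗ y) k)))) ⟩
      ∑ (λ k → χ x * χ y * (χ (k ⊝ x ⊗ x) * χ (k ⊝ y ⊗ y)))
        ≡⟨ ∑-*ˡ (χ x * χ y) (λ k → χ (k ⊝ x ⊗ x) * χ (k ⊝ y ⊗ y)) ⟩
      χ x * χ y * ∑ (λ k → χ (k ⊝ x ⊗ x) * χ (k ⊝ y ⊗ y))
        ≡⟨ cong (χ x * χ y *_) (trans (∑χχ (x ⊗ x) (y ⊗ y)) (cong (λ d → + q * d - 1ℤ) (δ-comm (x ⊗ x) (y ⊗ y)))) ⟩
      χ x * χ y * (+ q * δ (y ⊗ y) (x ⊗ x) - 1ℤ) ∎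
    expand : ∀ x y q d → x * y * (q * d - 1ℤ) ≡ q * x * (d * y) + (- x * y + 0ℤ)
    expand = solve-∀
    fibre : ∀ x → χ x * ∑ (λ y → δ (y ⊗ y) (x ⊗ x) * χ y) ≡ + 2 * (χ x * χ x)
    fibre x with x ≟ 0#
    ... | yes refl = trans (cong (_* ∑ (λ y → δ (y ⊗ y) (0# ⊗ 0#) * χ y)) χ-0) (cong (λ a → + 2 * (a * a)) (sym χ-0))
    ... | no x≢0 = begin
      χ x * ∑ (λ y → δ (y ⊗ y) (x ⊗ x) * χ y)
        ≡⟨ cong (χ x *_) (∑-cong λ y → trans (cong (_* χ y) (δ-square x≢0 y)) (ℤ.*-distribʳ-+ (χ y) (δ y x) _)) ⟩
      χ x * ∑ (λ y → δ y x * χ y + δ y (⊖ x) * χ y)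
        ≡⟨ cong (χ x *_) (trans (∑-+ (λ y → δ y x * χ y) _) (cong₂ _+_ (∑-δ χ x) (trans (∑-δ χ (⊖ x)) (χ-neg x)))) ⟩
      χ x * (χ x + χ x)
        ≡⟨ double (χ x) ⟩
      + 2 * (χ x * χ x) ∎
      where
      double : ∀ a → a * (a + a) ≡ + 2 * (a * a)
      double = solve-∀
    outer : ∀ x → ∑ (λ y → χ x * χ y * (+ q * δ (y ⊗ y) (x ⊗ x) - 1ℤ)) ≡
      + 2 * + q * 1ℤ + (- (+ 2 * + q) * δ x 0# + (0ℤ * χ x + 0ℤ))
    outer x = begin
      ∑ (λ y → χ x * χ y * (+ q * δ (y ⊗ y) (x ⊗ x) - 1ℤ))
        ≡⟨ ∑-cong (λ y → expand (χ x) (χ y) (+ q) (δ (y ⊗ y) (x ⊗ x))) ⟩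
      ∑ (λ y → + q * χ x * (δ (y ⊗ y) (x ⊗ x) * χ y) + (- χ x * χ y + 0ℤ))
        ≡⟨ ∑-lincomb ((+ q * χ x , (λ y → δ (y ⊗ y) (x ⊗ x) * χ y)) ∷ (- χ x , χ) ∷ []) ⟩
      + q * χ x * F + (- χ x * ∑ χ + 0ℤ)
        ≡⟨ cong₂ _+_ (ℤ.*-assoc (+ q) (χ x) F) (cong (λ a → - χ x * a + 0ℤ) ∑χ) ⟩
      + q * (χ x * F) + (- χ x * 0ℤ + 0ℤ)
        ≡⟨ cong (λ a → + q * a + (- χ x * 0ℤ + 0ℤ)) (trans (fibre x) (cong (+ 2 *_) (χ² x))) ⟩
      + q * (+ 2 * (1ℤ - δ x 0#)) + (- χ x * 0ℤ + 0ℤ)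
        ≡⟨ collect (+ q) (δ x 0#) (χ x) ⟩
      + 2 * + q * 1ℤ + (- (+ 2 * + q) * δ x 0# + (0ℤ * χ x + 0ℤ)) ∎
      where
      F = ∑ (λ y → δ (y ⊗ y) (x ⊗ x) * χ y)
      collect : ∀ q d x → q * (+ 2 * (1ℤ - d)) + (- x * 0ℤ + 0ℤ) ≡ + 2 * q * 1ℤ + (- (+ 2 * q) * d + (0ℤ * x + 0ℤ))
      collect = solve-∀

  -- Otherwise `χ` would be 1 at all nonzero points, and its sum would be q - 1 instead of 0.
  ∃-nonsquare : ∃[ n ] (∀ y → y ⊗ y ≢ n)
  ∃-nonsquare with any? (λ x → χ x ℤ.≟ -1ℤ)
  ... | yes (n , χn) = n , λ y yy≡n → not-square y yy≡n
    where
    not-square : ∀ y → y ⊗ y ≢ n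
    not-square y refl with y ≟ 0#
    ... | yes refl = contradiction (trans (sym χn) (trans (cong χ (⊗-zeroˡ 0#)) χ-0)) λ ()
    ... | no y≢0 = contradiction (trans (sym χn) (χ-square y≢0)) λ ()
  ... | no ¬n = contradiction (ℤ.+-injective q≡1) q≢1
    where
    χ≡1-δ : ∀ x → χ x ≡ 1ℤ * 1ℤ + (-1ℤ * δ x 0# + 0ℤ)
    χ≡1-δ x with classify x
    ... | isZero refl = trans χ-0 (cong (λ d → 1ℤ * 1ℤ + (-1ℤ * d + 0ℤ)) (sym (δ-≡ {0#} refl)))
    ... | square y y≢0 refl = trans (χ-square y≢0) (cong (λ d → 1ℤ * 1ℤ + (-1ℤ * d + 0ℤ)) (sym (δ-≢ (⊗≢0 y≢0 y≢0))))
    ... | nonsquare ns = contradiction (x , χ-nonsquare ns) ¬n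
    q≡1 : + q ≡ 1ℤ
    q≡1 = begin
      + q
        ≡⟨ add-sub (+ q) ⟩
      1ℤ * + q + (-1ℤ * 1ℤ + 0ℤ) + 1ℤ
        ≡⟨ cong₂ (λ a b → 1ℤ * a + (-1ℤ * b + 0ℤ) + 1ℤ) ∑-1 (∑-δ-1 0#) ⟨
      1ℤ * ∑ (λ _ → 1ℤ) + (-1ℤ * ∑ (λ x → δ x 0#) + 0ℤ) + 1ℤ
        ≡⟨ cong (_+ 1ℤ) (∑-lincomb ((1ℤ , (λ _ → 1ℤ)) ∷ (-1ℤ , (λ x → δ x 0#)) ∷ [])) ⟨
      ∑ (λ x → 1ℤ * 1ℤ + (-1ℤ * δ x 0# + 0ℤ)) + 1ℤ
        ≡⟨ cong (_+ 1ℤ) (trans (sym (∑-cong χ≡1-δ)) ∑χ) ⟩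
      1ℤ ∎
      where
      add-sub : ∀ q → q ≡ 1ℤ * q + (-1ℤ * 1ℤ + 0ℤ) + 1ℤ
      add-sub = solve-∀

  -- Up to squares, k is 0, 1 or n.
  T²-form : ∀ {n} → (∀ y → y ⊗ y ≢ n) → ∀ k →
    + 2 * (T k * T k) ≡ (1ℤ - δ k 0# + χ k) * (T 1# * T 1#) + (1ℤ - δ k 0# - χ k) * (T n * T n)
  T²-form {n} ns k with classify k
  ... | isZero refl = trans (cong (λ a → + 2 * (a * a)) T-0)
          (sym (cong₂ (λ d c → (1ℤ - d + c) * (T 1# * T 1#) + (1ℤ - d - c) * (T n * T n)) (δ-≡ {0#} refl) χ-0))
  ... | square y y≢0 refl = begin
    + 2 * (T (y ⊗ y) * T (y ⊗ y))
      ≡⟨ cong (λ u → + 2 * (T u * T u)) (solve 1 (λ y → y :* y := y :* y :* con 1ℤ) refl y) ⟩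
    + 2 * (T (y ⊗ y ⊗ 1#) * T (y ⊗ y ⊗ 1#))
      ≡⟨ cong (+ 2 *_) (T²-scale y≢0 1#) ⟩
    + 2 * (T 1# * T 1#)
      ≡⟨ add-0 (T 1# * T 1#) (T n * T n) ⟩
    (1ℤ - 0ℤ + 1ℤ) * (T 1# * T 1#) + (1ℤ - 0ℤ - 1ℤ) * (T n * T n)
      ≡⟨ cong₂ (λ d c → (1ℤ - d + c) * (T 1# * T 1#) + (1ℤ - d - c) * (T n * T n)) (sym (δ-≢ (⊗≢0 y≢0 y≢0)))
          (sym (χ-square y≢0)) ⟩
    _ ∎
    where
    add-0 : ∀ a b → + 2 * a ≡ (1ℤ - 0ℤ + 1ℤ) * a + (1ℤ - 0ℤ - 1ℤ) * b
    add-0 = solve-∀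
  ... | nonsquare ns′ = begin
    + 2 * (T k * T k)
      ≡⟨ cong (+ 2 *_) Tk²≡Tn² ⟩
    + 2 * (T n * T n)
      ≡⟨ add-0 (T 1# * T 1#) (T n * T n) ⟩
    (1ℤ - 0ℤ + -1ℤ) * (T 1# * T 1#) + (1ℤ - 0ℤ - -1ℤ) * (T n * T n)
      ≡⟨ cong₂ (λ d c → (1ℤ - d + c) * (T 1# * T 1#) + (1ℤ - d - c) * (T n * T n)) (sym (δ-≢ (nonsquare≢0 ns′)))
          (sym (χ-nonsquare ns′)) ⟩
    _ ∎
    where
    add-0 : ∀ a b → + 2 * b ≡ (1ℤ - 0ℤ + -1ℤ) * a + (1ℤ - 0ℤ - -1ℤ) * b
    add-0 = solve-∀
    χkn : χ (k ⊗ n) ≡ 1ℤ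
    χkn = trans (χ-* k n) (cong₂ _*_ (χ-nonsquare ns′) (χ-nonsquare ns))
    Tk²≡Tn² : T k * T k ≡ T n * T n
    Tk²≡Tn² with classify (k ⊗ n)
    ... | isZero kn≡0 = contradiction kn≡0 (⊗≢0 (nonsquare≢0 ns′) (nonsquare≢0 ns))
    ... | nonsquare ns″ = contradiction (trans (sym (χ-nonsquare ns″)) χkn) λ ()
    -- From k n = s² follows n² k = s² n, so square factors lead from k to n.
    ... | square s s≢0 kn≡ss = begin
      T k * T k                            ≡⟨ T²-scale (nonsquare≢0 ns) k ⟨
      T (n ⊗ n ⊗ k) * T (n ⊗ n ⊗ k)        ≡⟨ cong (λ u → T u * T u)
          (trans (solve 2 (λ n k → n :* n :* k := k :* n :* n) refl n k) (cong (_⊗ n) kn≡ss)) ⟩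
      T (s ⊗ s ⊗ n) * T (s ⊗ s ⊗ n)        ≡⟨ T²-scale s≢0 n ⟩
      T n * T n ∎

  -- Sum `T²-form` over all k. The squares and the nonsquares among the nonzero k are equally many
  -- (`∑χ`), so `A` and `B` get the same coefficient: (q - 1) (A + B) = 4 q (q - 1).
  T₁²+Tₙ² : ∀ {n} → (∀ y → y ⊗ y ≢ n) → T 1# * T 1# + T n * T n ≡ + 4 * + q
  T₁²+Tₙ² {n} ns =
    [ (λ q-1≡0 → contradiction (ℤ.+-injective (ℤ.i-j≡0⇒i≡j (+ q) 1ℤ q-1≡0)) q≢1)
    , ℤ.i-j≡0⇒i≡j (T 1# * T 1# + T n * T n) (+ 4 * + q)
    ]′ (ℤ.i*j≡0⇒i≡0∨j≡0 (+ q - 1ℤ) prod)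
    where
    A = T 1# * T 1#
    B = T n * T n
    regroup : ∀ d c a b → (1ℤ - d + c) * a + (1ℤ - d - c) * b ≡
      (a + b) * 1ℤ + (- (a + b) * d + ((a - b) * c + 0ℤ))
    regroup = solve-∀
    factor : ∀ q s → (q - 1ℤ) * (s - + 4 * q) ≡ (s * q + (- s * 1ℤ + 0ℤ)) - + 2 * (+ 2 * q * (q - 1ℤ))
    factor = solve-∀
    ∑-eq : (A + B) * + q + (- (A + B) * 1ℤ + 0ℤ) ≡ + 2 * (+ 2 * + q * (+ q - 1ℤ))
    ∑-eq = sym (begin
      + 2 * (+ 2 * + q * (+ q - 1ℤ))
        ≡⟨ cong (+ 2 *_) ∑T² ⟨
      + 2 * ∑ (λ k → T k * T k)
        ≡⟨ ∑-*ˡ (+ 2) (λ k → T k * T k) ⟨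
      ∑ (λ k → + 2 * (T k * T k))
        ≡⟨ ∑-cong (λ k → trans (T²-form ns k) (regroup (δ k 0#) (χ k) A B)) ⟩
      ∑ (λ k → (A + B) * 1ℤ + (- (A + B) * δ k 0# + ((A - B) * χ k + 0ℤ)))
        ≡⟨ ∑-lincomb ((A + B , (λ _ → 1ℤ)) ∷ (- (A + B) , (λ k → δ k 0#)) ∷ (A - B , χ) ∷ []) ⟩
      (A + B) * ∑ (λ _ → 1ℤ) + (- (A + B) * ∑ (λ k → δ k 0#) + ((A - B) * ∑ χ + 0ℤ))
        ≡⟨ cong₂ (λ a b → (A + B) * a + (- (A + B) * b + ((A - B) * ∑ χ + 0ℤ))) ∑-1 (∑-δ-1 0#) ⟩
      (A + B) * + q + (- (A + B) * 1ℤ + ((A - B) * ∑ χ + 0ℤ))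
        ≡⟨ cong (λ a → (A + B) * + q + (- (A + B) * 1ℤ + a))
            (trans (ℤ.+-identityʳ _) (trans (cong ((A - B) *_) ∑χ) (ℤ.*-zeroʳ (A - B)))) ⟩
      (A + B) * + q + (- (A + B) * 1ℤ + 0ℤ) ∎)
    prod : (+ q - 1ℤ) * (A + B - + 4 * + q) ≡ 0ℤ
    prod = trans (factor (+ q) (A + B))
        (trans (cong (_- + 2 * (+ 2 * + q * (+ q - 1ℤ))) ∑-eq) (ℤ.+-inverseʳ (+ 2 * (+ 2 * + q * (+ q - 1ℤ)))))

  -- Grouping x by its square pairs s with -s. `classify` picks one root from each pair, and its
  -- value of `g` is half the contribution of the fibre.
  ∑-even : ∀ g → (∀ x → g (⊖ x) ≡ g x) → g 0# ≡ 0ℤ → ∃[ h ] ∑ g ≡ + 2 * h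
  ∑-even g g-even g0 = ∑ (proj₁ ∘ half) , (begin
    ∑ g
      ≡⟨ ∑-cong (λ x → ∑-δ′ (λ _ → g x) (x ⊗ x)) ⟨
    ∑ (λ x → ∑ (λ y → δ (x ⊗ x) y * g x))
      ≡⟨ ∑-comm (λ x y → δ (x ⊗ x) y * g x) ⟩
    ∑ (λ y → ∑ (λ x → δ (x ⊗ x) y * g x))
      ≡⟨ ∑-cong (λ y → proj₂ (half y)) ⟩
    ∑ (λ y → + 2 * proj₁ (half y))
      ≡⟨ ∑-*ˡ (+ 2) (proj₁ ∘ half) ⟩
    + 2 * ∑ (proj₁ ∘ half) ∎)
    where
    half : ∀ y → ∃[ h ] ∑ (λ x → δ (x ⊗ x) y * g x) ≡ + 2 * h
    half y with classify y
    ... | isZero refl = 0ℤ , trans (∑-cong λ x → cong (_* g x) (δ-cong {x ⊗ x} {0#} {x} {0#}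
            (λ eq → [ (λ p → p) , (λ p → p) ]′ (⊗≡0 x x eq)) (λ { refl → ⊗-zeroˡ 0# }))) (trans (∑-δ g 0#) g0)
    ... | nonsquare ns = 0ℤ , trans (∑-cong λ x → cong (_* g x) (δ-≢ (ns x))) ∑-0
    ... | square s s≢0 refl = g s , (begin
      ∑ (λ x → δ (x ⊗ x) (s ⊗ s) * g x)
        ≡⟨ ∑-cong (λ x → trans (cong (_* g x) (δ-square s≢0 x)) (ℤ.*-distribʳ-+ (g x) (δ x s) _)) ⟩
      ∑ (λ x → δ x s * g x + δ x (⊖ s) * g x)
        ≡⟨ trans (∑-+ (λ x → δ x s * g x) _) (cong₂ _+_ (∑-δ g s) (trans (∑-δ g (⊖ s)) (g-even s))) ⟩
      g s + g s
        ≡⟨ double (g s) ⟩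
      + 2 * g s ∎)
      where
      double : ∀ a → a + a ≡ + 2 * a
      double = solve-∀

  e-even : ∀ x → ∃[ ε ] e x ≡ + 2 * ε
  e-even x with classify x
  ... | isZero refl = 0ℤ , cong₂ (λ a b → 1ℤ - a + b) (δ-≡ {0#} refl) χ-0
  ... | square y y≢0 refl = 1ℤ , cong₂ (λ a b → 1ℤ - a + b) (δ-≢ (⊗≢0 y≢0 y≢0)) (χ-square y≢0)
  ... | nonsquare ns = 0ℤ , cong₂ (λ a b → 1ℤ - a + b) (δ-≢ (nonsquare≢0 ns)) (χ-nonsquare ns)

  -- `χ` is `e` - 1 corrected by 1 at zeros. The polynomial `P` is odd and `e` is even, so half the
  -- sum of `e (P x)` is again even by `∑-even`, giving 4 h. The zeros of `P` are 0 and the 1 +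
  -- `χ k` square roots of k.
  T-mod4 : ∀ {k} → k ≢ 0# → ∃[ h ] T k ≡ + 4 * h - + q + + 2 + χ k
  T-mod4 {k} k≢0 = proj₁ h , (begin
    T k
      ≡⟨ ∑-cong (λ x → trans (sym (χ-* x (x ⊗ x ⊝ k))) (χ-form x)) ⟩
    ∑ (λ x → + 2 * ε x + (-1ℤ * 1ℤ + (1ℤ * δ x 0# + (1ℤ * δ (x ⊗ x) k + 0ℤ))))
      ≡⟨ ∑-lincomb ((+ 2 , ε) ∷ (-1ℤ , (λ _ → 1ℤ)) ∷ (1ℤ , (λ x → δ x 0#)) ∷ (1ℤ , (λ x → δ (x ⊗ x) k)) ∷ []) ⟩
    + 2 * ∑ ε + (-1ℤ * ∑ (λ _ → 1ℤ) + (1ℤ * ∑ (λ x → δ x 0#) + (1ℤ * ∑ (λ x → δ (x ⊗ x) k) + 0ℤ)))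
      ≡⟨ cong₂ (λ a b → + 2 * a + (-1ℤ * b + (1ℤ * ∑ (λ x → δ x 0#) + (1ℤ * ∑ (λ x → δ (x ⊗ x) k) + 0ℤ))))
          (proj₂ h) ∑-1 ⟩
    + 2 * (+ 2 * proj₁ h) + (-1ℤ * + q + (1ℤ * ∑ (λ x → δ x 0#) + (1ℤ * ∑ (λ x → δ (x ⊗ x) k) + 0ℤ)))
      ≡⟨ cong₂ (λ a b → + 2 * (+ 2 * proj₁ h) + (-1ℤ * + q + (1ℤ * a + (1ℤ * b + 0ℤ)))) (∑-δ-1 0#) (roots≡1+χ k) ⟩
    + 2 * (+ 2 * proj₁ h) + (-1ℤ * + q + (1ℤ * 1ℤ + (1ℤ * (1ℤ + χ k) + 0ℤ)))
      ≡⟨ simp (proj₁ h) (+ q) (χ k) ⟩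
    + 4 * proj₁ h - + q + + 2 + χ k ∎)
    where
    P : Fin q → Fin q
    P x = x ⊗ (x ⊗ x ⊝ k)
    ε : Fin q → ℤ
    ε x = proj₁ (e-even (P x))
    ε-unique : ∀ x y → e (P x) ≡ e (P y) → ε x ≡ ε y
    ε-unique x y eq = ℤ.*-cancelˡ-≡ (+ 2) _ _ (trans (sym (proj₂ (e-even (P x)))) (trans eq (proj₂ (e-even (P y)))))
    ε0 : ε 0# ≡ 0ℤ
    ε0 = ℤ.*-cancelˡ-≡ (+ 2) _ 0ℤ (trans (sym (proj₂ (e-even (P 0#)))) (trans (cong e (⊗-zeroˡ (0# ⊗ 0# ⊝ k)))
      (cong₂ (λ a b → 1ℤ - a + b) (δ-≡ {0#} refl) χ-0)))
    h : ∃[ h ] ∑ ε ≡ + 2 * h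
    h = ∑-even ε (λ x → ε-unique (⊖ x) x (trans
          (cong e (solve 2 (λ x k → :- x :* (:- x :* :- x :- k) := :- (x :* (x :* x :- k))) refl x k))
              (e-neg (P x)))) ε0
    δP : ∀ x → δ (P x) 0# ≡ δ x 0# + δ (x ⊗ x) k
    δP x with x ≟ 0#
    ... | yes refl = trans (δ-≡ (⊗-zeroˡ (0# ⊗ 0# ⊝ k)))
        (cong (λ z → 1ℤ + z) (sym (δ-≢ (λ eq → k≢0 (trans (sym eq) (⊗-zeroˡ 0#))))))
    ... | no x≢0 = trans (δ-cong {P x} {0#} {x ⊗ x} {k}
            (λ eq → ⊝≡0⇒≡ (x ⊗ x) k ([ (λ x≡0 → contradiction x≡0 x≢0) , (λ p → p) ]′ (⊗≡0 x _ eq)))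
            (λ eq → trans (cong (λ u → x ⊗ (u ⊝ k)) eq) (solve 2 (λ x k → x :* (k :- k) := con 0ℤ) refl x k)))
            (sym (ℤ.+-identityˡ _))
    isolate : ∀ d c → c ≡ (1ℤ - d + c) - 1ℤ + d
    isolate = solve-∀
    collect : ∀ a d f → + 2 * a - 1ℤ + (d + f) ≡ + 2 * a + (-1ℤ * 1ℤ + (1ℤ * d + (1ℤ * f + 0ℤ)))
    collect = solve-∀
    χ-form : ∀ x → χ (P x) ≡ + 2 * ε x + (-1ℤ * 1ℤ + (1ℤ * δ x 0# + (1ℤ * δ (x ⊗ x) k + 0ℤ)))
    χ-form x = begin
      χ (P x)
        ≡⟨ isolate (δ (P x) 0#) (χ (P x)) ⟩
      e (P x) - 1ℤ + δ (P x) 0#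
        ≡⟨ cong₂ (λ a b → a - 1ℤ + b) (proj₂ (e-even (P x))) (δP x) ⟩
      + 2 * ε x - 1ℤ + (δ x 0# + δ (x ⊗ x) k)
        ≡⟨ collect (ε x) (δ x 0#) (δ (x ⊗ x) k) ⟩
      _ ∎
    simp : ∀ h q c → + 2 * (+ 2 * h) + (-1ℤ * q + (1ℤ * 1ℤ + (1ℤ * (1ℤ + c) + 0ℤ))) ≡ + 4 * h - q + + 2 + c
    simp = solve-∀

  -- T 1 / 2 is odd and T n / 2 is even for a nonsquare n, and their squares add up to q.
  jacobsthal²≡4b² : Prime q → ∀ m → + q ≡ 1ℤ + + 4 * m → ∀ a b → + q ≡ a * a + b * b → 2 ℕ∣.∣ ∣ a ∣ →
    T 1# * T 1# ≡ + 4 * (b * b)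
  jacobsthal²≡4b² q-prime m q≡1+4m a b q≡a²+b² 2∣a = begin
    T 1# * T 1#                ≡⟨ cong₂ _*_ T₁≡2c T₁≡2c ⟩
    + 2 * c * (+ 2 * c)        ≡⟨ double² c ⟩
    + 4 * (c * c)              ≡⟨ cong (+ 4 *_)
        (two-squares-unique q-prime 2∤q a b c (+ 2 * u) q≡a²+b² q≡c²+d² 2∣a 2∣2u) ⟩
    + 4 * (b * b) ∎
    where
    n = proj₁ ∃-nonsquare
    ns = proj₂ ∃-nonsquare
    h h′ : ℤ
    h = proj₁ (T-mod4 1≢0)
    h′ = proj₁ (T-mod4 (nonsquare≢0 ns))
    T₁≡ : T 1# ≡ + 4 * h - + q + + 2 + χ 1#
    T₁≡ = proj₂ (T-mod4 1≢0)
    Tₙ≡ : T n ≡ + 4 * h′ - + q + + 2 + χ n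
    Tₙ≡ = proj₂ (T-mod4 (nonsquare≢0 ns))
    -- With q = 1 + 4 m, `T-mod4` reads 4 (h - m) + 2 for `T 1#` and 4 (h′ - m) for `T n`; halving
    -- gives the odd `c` and the even 2 u.
    c u : ℤ
    c = + 2 * (h - m) + 1ℤ
    u = h′ - m
    double² : ∀ c → + 2 * c * (+ 2 * c) ≡ + 4 * (c * c)
    double² = solve-∀
    odd-half : ∀ h m → + 4 * h - (1ℤ + + 4 * m) + + 2 + 1ℤ ≡ + 2 * (+ 2 * (h - m) + 1ℤ)
    odd-half = solve-∀
    even-half : ∀ h m → + 4 * h - (1ℤ + + 4 * m) + + 2 + -1ℤ ≡ + 2 * (+ 2 * (h - m))
    even-half = solve-∀
    T₁≡2c : T 1# ≡ + 2 * c
    T₁≡2c = trans T₁≡ (trans (cong₂ (λ q x → + 4 * h - q + + 2 + x) q≡1+4m χ-1) (odd-half h m))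
    Tₙ≡2d : T n ≡ + 2 * (+ 2 * u)
    Tₙ≡2d = trans Tₙ≡ (trans (cong₂ (λ q x → + 4 * h′ - q + + 2 + x) q≡1+4m (χ-nonsquare ns)) (even-half h′ m))
    q≡c²+d² : + q ≡ c * c + + 2 * u * (+ 2 * u)
    q≡c²+d² = ℤ.*-cancelˡ-≡ (+ 4) _ _ (begin
      + 4 * + q                                                      ≡⟨ T₁²+Tₙ² ns ⟨
      T 1# * T 1# + T n * T n                                        ≡⟨ cong₂ (λ x y → x * x + y * y) T₁≡2c Tₙ≡2d ⟩
      + 2 * c * (+ 2 * c) + + 2 * (+ 2 * u) * (+ 2 * (+ 2 * u))      ≡⟨ quadruple c (+ 2 * u) ⟩
      + 4 * (c * c + + 2 * u * (+ 2 * u)) ∎)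
      where
      quadruple : ∀ c d → + 2 * c * (+ 2 * c) + + 2 * d * (+ 2 * d) ≡ + 4 * (c * c + d * d)
      quadruple = solve-∀
    2∣2u : 2 ℕ∣.∣ ∣ + 2 * u ∣
    2∣2u = subst (2 ℕ∣.∣_) (sym (ℤ.abs-* (+ 2) u)) (ℕ∣.m∣m*n ∣ u ∣)
    2∤q : ¬ 2 ℕ∣.∣ q
    2∤q 2∣q = contradiction (ℕ∣.∣⇒≤ (2∣∣1∣)) λ { (ℕ.s≤s ()) }
      where
      one : + q + - (+ 2 * (+ 2 * m)) ≡ 1ℤ
      one = trans (cong (_+ - (+ 2 * (+ 2 * m))) q≡1+4m) (cancel m)
        where
        cancel : ∀ m → 1ℤ + + 4 * m + - (+ 2 * (+ 2 * m)) ≡ 1ℤ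
        cancel = solve-∀
      2∣∣1∣ : 2 ℕ∣.∣ 1
      2∣∣1∣ = ∣⇒∣ᵤ (subst (+ 2 ∣_) one (∣m∣n⇒∣m+n (∣ᵤ⇒∣ {+ 2} {+ q} 2∣q) (∣m⇒∣-m (∣m⇒∣m*n (+ 2 * m) (∣-refl {+ 2})))))

  Q-value : Prime q → ∀ m → + q ≡ 1ℤ + + 4 * m → ∀ a b → + q ≡ a * a + b * b → 2 ℕ∣.∣ ∣ a ∣ →
    Q ≡ (+ q - + 9) * (+ q - + 9) - + 4 * (a * a)
  Q-value q-prime m q≡1+4m a b q≡a²+b² 2∣a = begin
    Q
      ≡⟨ Q≡ ⟩
    + q * + q - + 22 * + q + + 81 + T 1# * T 1#
      ≡⟨ cong (λ z → + q * + q - + 22 * + q + + 81 + z) (jacobsthal²≡4b² q-prime m q≡1+4m a b q≡a²+b² 2∣a) ⟩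
    + q * + q - + 22 * + q + + 81 + + 4 * (b * b)
      -- Trading 4 b² for 4 q - 4 a² changes -22 q into -18 q, the cross term of (q - 9)².
      ≡⟨ isolate a b (+ q) ⟩
    + q * + q - + 22 * + q + + 81 + + 4 * (a * a + b * b) - + 4 * (a * a)
      ≡⟨ cong (λ z → + q * + q - + 22 * + q + + 81 + + 4 * z - + 4 * (a * a)) q≡a²+b² ⟨
    + q * + q - + 22 * + q + + 81 + + 4 * + q - + 4 * (a * a)
      ≡⟨ complete-square a (+ q) ⟩
    (+ q - + 9) * (+ q - + 9) - + 4 * (a * a) ∎
    where
    isolate : ∀ a b q → q * q - + 22 * q + + 81 + + 4 * (b * b) ≡
      q * q - + 22 * q + + 81 + + 4 * (a * a + b * b) - + 4 * (a * a)
    isolate = solve-∀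
    complete-square : ∀ a q → q * q - + 22 * q + + 81 + + 4 * q - + 4 * (a * a) ≡ (q - + 9) * (q - + 9) - + 4 * (a * a)
    complete-square = solve-∀

-- Residues modulo n

module _ {n : ℕ} where

  ≡mod-refl : ∀ i → i ≡ i [mod n ]
  ≡mod-refl i = divides 0ℤ (ℤ.+-inverseʳ i)

  ≡mod-sym : ∀ i j → i ≡ j [mod n ] → j ≡ i [mod n ]
  ≡mod-sym i j i≡j = subst (+ n ∣_) (negate i j) (∣m⇒∣-m i≡j)
    where
    negate : ∀ i j → - (i - j) ≡ j - i
    negate = solve-∀

  ≡mod-trans : ∀ i j k → i ≡ j [mod n ] → j ≡ k [mod n ] → i ≡ k [mod n ]
  ≡mod-trans i j k i≡j j≡k = subst (+ n ∣_) (add i j k) (∣m∣n⇒∣m+n i≡j j≡k)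
    where
    add : ∀ i j k → (i - j) + (j - k) ≡ i - k
    add = solve-∀

  +-mod : ∀ i i′ j j′ → i ≡ i′ [mod n ] → j ≡ j′ [mod n ] → i + j ≡ i′ + j′ [mod n ]
  +-mod i i′ j j′ p q = subst (+ n ∣_) (add i i′ j j′) (∣m∣n⇒∣m+n p q)
    where
    add : ∀ i i′ j j′ → (i - i′) + (j - j′) ≡ i + j - (i′ + j′)
    add = solve-∀

  *-mod : ∀ i i′ j j′ → i ≡ i′ [mod n ] → j ≡ j′ [mod n ] → i * j ≡ i′ * j′ [mod n ]
  *-mod i i′ j j′ p q =
    subst (+ n ∣_) (mul i i′ j j′) (∣m∣n⇒∣m+n (∣n⇒∣m*n i q) (∣n⇒∣m*n j′ p))
    where
    mul : ∀ i i′ j j′ → i * (j - j′) + j′ * (i - i′) ≡ i * j - i′ * j′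
    mul = solve-∀

  neg-mod : ∀ i i′ → i ≡ i′ [mod n ] → - i ≡ - i′ [mod n ]
  neg-mod i i′ p = subst (+ n ∣_) (neg i i′) (∣m⇒∣-m p)
    where
    neg : ∀ i i′ → - (i - i′) ≡ - i - - i′
    neg = solve-∀

≡mod-∣ : ∀ {m n i j} → m ℕ∣.∣ n → i ≡ j [mod n ] → i ≡ j [mod m ]
≡mod-∣ {m} {n} m∣n i≡j = ∣-trans (∣ᵤ⇒∣ {+ m} {+ n} m∣n) i≡j

rep-injective : ∀ {n} (u v : Fin n) → rep u ≡ rep v [mod n ] → u ≡ v
rep-injective {n} u v u≡v = toℕ-injective (ℤ.+-injective (ℤ.i-j≡0⇒i≡j (rep u) (rep v) (ℤ.∣i∣≡0⇒i≡0
  (multiple<⇒0 (∣⇒∣ᵤ u≡v) ∣u-v∣<n))))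
  where
  multiple<⇒0 : ∀ {k} → n ℕ∣.∣ k → k ℕ.< n → k ≡ 0
  multiple<⇒0 {zero} _ _ = refl
  multiple<⇒0 {suc k} n∣k k<n = contradiction (ℕ∣.∣⇒≤ n∣k) (ℕ.<⇒≱ k<n)
  ∣u-v∣<n : ∣ rep u - rep v ∣ ℕ.< n
  ∣u-v∣<n = ℕ.≤-<-trans
    (subst (λ i → ∣ i ∣ ℕ.≤ toℕ u ℕ.⊔ toℕ v) (sym (ℤ.m-n≡m⊖n (toℕ u) (toℕ v))) (ℤ.∣m⊝n∣≤m⊔n (toℕ u) (toℕ v)))
    (ℕ.⊔-lub (toℕ<n u) (toℕ<n v))

module Residue (n : ℕ) .{{n≢0 : ℕ.NonZero n}} where

  abstract
    -- Opaque, so that residues are handled only through the congruence `rep-⟦⟧` and never by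
    -- unfolding a division.
    ⟦_⟧ : ℤ → Fin n
    ⟦ i ⟧ = fromℕ< (n%ℕd<d i n)

    rep-⟦⟧ : ∀ i → rep ⟦ i ⟧ ≡ i [mod n ]
    rep-⟦⟧ i = divides (- (i /ℕ n)) (begin
      rep ⟦ i ⟧ - i
        ≡⟨ cong₂ (λ a b → + a - b) (toℕ-fromℕ< (n%ℕd<d i n)) (a≡a%ℕn+[a/ℕn]*n i n) ⟩
      + (i %ℕ n) - (+ (i %ℕ n) + (i /ℕ n) * + n)
        ≡⟨ cancel (+ (i %ℕ n)) (i /ℕ n) (+ n) ⟩
      - (i /ℕ n) * + n ∎)
      where
      cancel : ∀ r d n → r - (r + d * n) ≡ - d * n
      cancel = solve-∀

  ⟦⟧-cong : ∀ {i j} → i ≡ j [mod n ] → ⟦ i ⟧ ≡ ⟦ j ⟧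
  ⟦⟧-cong {i} {j} i≡j = rep-injective ⟦ i ⟧ ⟦ j ⟧
    (≡mod-trans (rep ⟦ i ⟧) i (rep ⟦ j ⟧) (rep-⟦⟧ i)
        (≡mod-trans i j (rep ⟦ j ⟧) i≡j (≡mod-sym (rep ⟦ j ⟧) j (rep-⟦⟧ j))))

  ⟦⟧-injective : ∀ {i j} → ⟦ i ⟧ ≡ ⟦ j ⟧ → i ≡ j [mod n ]
  ⟦⟧-injective {i} {j} eq = ≡mod-trans i (rep ⟦ i ⟧) j (≡mod-sym (rep ⟦ i ⟧) i (rep-⟦⟧ i))
    (subst (λ u → rep u ≡ j [mod n ]) (sym eq) (rep-⟦⟧ j))

  ⟦rep⟧ : ∀ x → ⟦ rep x ⟧ ≡ x
  ⟦rep⟧ x = rep-injective ⟦ rep x ⟧ x (rep-⟦⟧ (rep x))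

  infixl 6 _⊕_
  infixl 7 _⊗_
  infix  8 ⊖_
  _⊕_ _⊗_ : Fin n → Fin n → Fin n
  x ⊕ y = ⟦ rep x + rep y ⟧
  x ⊗ y = ⟦ rep x * rep y ⟧

  ⊖_ : Fin n → Fin n
  ⊖ x = ⟦ - rep x ⟧

  ⟦⟧-+ : ∀ i j → ⟦ i + j ⟧ ≡ ⟦ i ⟧ ⊕ ⟦ j ⟧
  ⟦⟧-+ i j = ⟦⟧-cong (≡mod-sym (rep ⟦ i ⟧ + rep ⟦ j ⟧) (i + j)
      (+-mod (rep ⟦ i ⟧) i (rep ⟦ j ⟧) j (rep-⟦⟧ i) (rep-⟦⟧ j)))

  ⟦⟧-* : ∀ i j → ⟦ i * j ⟧ ≡ ⟦ i ⟧ ⊗ ⟦ j ⟧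
  ⟦⟧-* i j = ⟦⟧-cong (≡mod-sym (rep ⟦ i ⟧ * rep ⟦ j ⟧) (i * j)
      (*-mod (rep ⟦ i ⟧) i (rep ⟦ j ⟧) j (rep-⟦⟧ i) (rep-⟦⟧ j)))

  ⟦⟧-neg : ∀ i → ⟦ - i ⟧ ≡ ⊖ ⟦ i ⟧
  ⟦⟧-neg i = ⟦⟧-cong (≡mod-sym (- rep ⟦ i ⟧) (- i) (neg-mod (rep ⟦ i ⟧) i (rep-⟦⟧ i)))

  private
    +ˡ : ∀ i j → ⟦ rep ⟦ i ⟧ + j ⟧ ≡ ⟦ i + j ⟧
    +ˡ i j = ⟦⟧-cong (+-mod (rep ⟦ i ⟧) i j j (rep-⟦⟧ i) (≡mod-refl j))
    +ʳ : ∀ i j → ⟦ i + rep ⟦ j ⟧ ⟧ ≡ ⟦ i + j ⟧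
    +ʳ i j = ⟦⟧-cong (+-mod i i (rep ⟦ j ⟧) j (≡mod-refl i) (rep-⟦⟧ j))
    *ˡ : ∀ i j → ⟦ rep ⟦ i ⟧ * j ⟧ ≡ ⟦ i * j ⟧
    *ˡ i j = ⟦⟧-cong (*-mod (rep ⟦ i ⟧) i j j (rep-⟦⟧ i) (≡mod-refl j))
    *ʳ : ∀ i j → ⟦ i * rep ⟦ j ⟧ ⟧ ≡ ⟦ i * j ⟧
    *ʳ i j = ⟦⟧-cong (*-mod i i (rep ⟦ j ⟧) j (≡mod-refl i) (rep-⟦⟧ j))

    ⊕-comm : ∀ x y → x ⊕ y ≡ y ⊕ x
    ⊕-comm x y = cong ⟦_⟧ (ℤ.+-comm (rep x) (rep y))
    ⊗-comm : ∀ x y → x ⊗ y ≡ y ⊗ x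
    ⊗-comm x y = cong ⟦_⟧ (ℤ.*-comm (rep x) (rep y))
    ⊕-assoc : ∀ x y z → (x ⊕ y) ⊕ z ≡ x ⊕ (y ⊕ z)
    ⊕-assoc x y z = trans (+ˡ _ (rep z)) (trans (cong ⟦_⟧ (ℤ.+-assoc (rep x) (rep y) (rep z))) (sym (+ʳ (rep x) _)))
    ⊗-assoc : ∀ x y z → (x ⊗ y) ⊗ z ≡ x ⊗ (y ⊗ z)
    ⊗-assoc x y z = trans (*ˡ _ (rep z)) (trans (cong ⟦_⟧ (ℤ.*-assoc (rep x) (rep y) (rep z))) (sym (*ʳ (rep x) _)))
    ⊕-identityˡ : ∀ x → ⟦ 0ℤ ⟧ ⊕ x ≡ x
    ⊕-identityˡ x = trans (+ˡ 0ℤ (rep x)) (trans (cong ⟦_⟧ (ℤ.+-identityˡ (rep x))) (⟦rep⟧ x))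
    ⊗-identityˡ : ∀ x → ⟦ 1ℤ ⟧ ⊗ x ≡ x
    ⊗-identityˡ x = trans (*ˡ 1ℤ (rep x)) (trans (cong ⟦_⟧ (ℤ.*-identityˡ (rep x))) (⟦rep⟧ x))
    ⊖-inverseˡ : ∀ x → ⊖ x ⊕ x ≡ ⟦ 0ℤ ⟧
    ⊖-inverseˡ x = trans (+ˡ (- rep x) (rep x)) (cong ⟦_⟧ (ℤ.+-inverseˡ (rep x)))
    distribˡ : ∀ x y z → x ⊗ (y ⊕ z) ≡ x ⊗ y ⊕ x ⊗ z
    distribˡ x y z = trans (*ʳ (rep x) _) (trans (cong ⟦_⟧ (ℤ.*-distribˡ-+ (rep x) (rep y) (rep z)))
      (⟦⟧-+ (rep x * rep y) (rep x * rep z)))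

  isCommutativeRing : IsCommutativeRing _≡_ _⊕_ _⊗_ ⊖_ ⟦ 0ℤ ⟧ ⟦ 1ℤ ⟧
  isCommutativeRing = record
    { isRing = record
      { +-isAbelianGroup = record
        { isGroup = record
          { isMonoid = record
            { isSemigroup = record
              { isMagma = record { isEquivalence = isEquivalence ; ∙-cong = cong₂ _⊕_ }
              ; assoc = ⊕-assoc }
            ; identity = ⊕-identityˡ , λ x → trans (⊕-comm x _) (⊕-identityˡ x) }
          ; inverse = ⊖-inverseˡ , λ x → trans (⊕-comm x _) (⊖-inverseˡ x)
          ; ⁻¹-cong = cong ⊖_ }
        ; comm = ⊕-comm }
      ; *-cong = cong₂ _⊗_
      ; *-assoc = ⊗-assoc
      ; *-identity = ⊗-identityˡ , λ x → trans (⊗-comm x _) (⊗-identityˡ x)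
      ; distrib = distribˡ , λ x y z → trans (⊗-comm (y ⊕ z) x)
          (trans (distribˡ x y z) (cong₂ _⊕_ (⊗-comm x y) (⊗-comm x z))) }
    ; *-comm = ⊗-comm }

-- The prime field and its square root of -1

module PrimeResidue {p : ℕ} (p-prime : Prime p) where
  private instance
    p≢0 : ℕ.NonZero p
    p≢0 = prime⇒nonZero p-prime
  open Residue p {{p≢0}} public

  ⟦⟧≡0 : ∀ {i} → ⟦ i ⟧ ≡ ⟦ 0ℤ ⟧ → + p ∣ i
  ⟦⟧≡0 {i} eq = subst (+ p ∣_) (ℤ.+-identityʳ i) (⟦⟧-injective eq)

  inverse : ∀ x → x ≢ ⟦ 0ℤ ⟧ → ∃[ y ] x ⊗ y ≡ ⟦ 1ℤ ⟧
  inverse x x≢0 = invert (toℕ x) refl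
    where
    from-mod : ∀ j → rep x * j ≡ 1ℤ [mod p ] → ∃[ y ] x ⊗ y ≡ ⟦ 1ℤ ⟧
    from-mod j xj≡1 = ⟦ j ⟧ , (begin
      x ⊗ ⟦ j ⟧              ≡⟨ cong (_⊗ ⟦ j ⟧) (⟦rep⟧ x) ⟨
      ⟦ rep x ⟧ ⊗ ⟦ j ⟧      ≡⟨ ⟦⟧-* (rep x) j ⟨
      ⟦ rep x * j ⟧          ≡⟨ ⟦⟧-cong xj≡1 ⟩
      ⟦ 1ℤ ⟧ ∎)
    negate : ∀ k w → k * - w - 1ℤ ≡ - (1ℤ + w * k)
    negate = solve-∀
    cancel : ∀ z → 1ℤ + z - 1ℤ ≡ z
    cancel = solve-∀
    invert : ∀ k → toℕ x ≡ k → ∃[ y ] x ⊗ y ≡ ⟦ 1ℤ ⟧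
    invert zero eq = contradiction (trans (sym (⟦rep⟧ x)) (cong (λ k → ⟦ + k ⟧) eq)) x≢0
    invert k@(suc _) eq with coprime-Bézout (prime⇒coprime p-prime (subst (ℕ._< p) eq (toℕ<n x)))
    -- In this case 1 + w k = u p, so the inverse is -w; in the other case 1 + u p = w k, and it is
    -- w.
    ... | Bézout.+- u w e = from-mod (- + w) (divides (- + u) (begin
      rep x * - + w - 1ℤ       ≡⟨ cong (λ k → + k * - + w - 1ℤ) eq ⟩
      + k * - + w - 1ℤ         ≡⟨ negate (+ k) (+ w) ⟩
      - (1ℤ + + w * + k)       ≡⟨ cong (λ z → - (1ℤ + z)) (ℤ.pos-* w k) ⟨
      - (1ℤ + + (w ℕ.* k))     ≡⟨ cong (λ z → - z) (trans (cong +_ e) (ℤ.pos-* u p)) ⟩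
      - (+ u * + p)            ≡⟨ ℤ.neg-distribˡ-* (+ u) (+ p) ⟩
      - + u * + p ∎))
    ... | Bézout.-+ u w e = from-mod (+ w) (divides (+ u) (begin
      rep x * + w - 1ℤ             ≡⟨ cong (λ k → + k * + w - 1ℤ) eq ⟩
      + k * + w - 1ℤ               ≡⟨ cong (_- 1ℤ) (trans (ℤ.*-comm (+ k) (+ w)) (sym (ℤ.pos-* w k))) ⟩
      + (w ℕ.* k) - 1ℤ             ≡⟨ cong (λ z → + z - 1ℤ) e ⟨
      1ℤ + + (u ℕ.* p) - 1ℤ        ≡⟨ cancel (+ (u ℕ.* p)) ⟩
      + (u ℕ.* p)                  ≡⟨ ℤ.pos-* u p ⟩
      + u * + p ∎))

  p∤1 : ¬ (+ p ∣ 1ℤ)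
  p∤1 p∣1 = ℕ.nonTrivial⇒≢1 {{prime⇒nonTrivial p-prime}} (ℕ∣.∣1⇒≡1 (∣⇒∣ᵤ p∣1))

  primeField : ⟦ + 2 ⟧ ≢ ⟦ 0ℤ ⟧ → (i : Fin p) → i ⊗ i ≡ ⊖ ⟦ 1ℤ ⟧ → FiniteField p
  primeField 2≢0 i i² = record
    { isCommutativeRing = isCommutativeRing
    ; ⟦⟧-+ = ⟦⟧-+ ; ⟦⟧-* = ⟦⟧-* ; ⟦⟧-neg = ⟦⟧-neg
    ; inverse = inverse
    ; 1≢0 = λ e → p∤1 (⟦⟧≡0 e)
    ; 2≢0 = 2≢0 ; √-1 = i ; √-1² = i² }

  -- If `p` divided b, it would divide a² and hence a, so p² would divide p.
  p∤b : ∀ a b → + p ≡ a * a + b * b → ¬ (+ p ∣ b)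
  p∤b a b p≡a²+b² p∣b = p∤1 (divides (a′ * a′ + b′ * b′)
    (ℤ.*-cancelˡ-≡ (+ p) 1ℤ ((a′ * a′ + b′ * b′) * + p) (begin
      + p * 1ℤ                                         ≡⟨ ℤ.*-identityʳ (+ p) ⟩
      + p                                              ≡⟨ p≡a²+b² ⟩
      a * a + b * b                                    ≡⟨ cong₂ (λ x y → x * x + y * y) (_∣_.equality p∣a)
          (_∣_.equality p∣b) ⟩
      a′ * + p * (a′ * + p) + b′ * + p * (b′ * + p)    ≡⟨ factor a′ b′ (+ p) ⟩
      + p * ((a′ * a′ + b′ * b′) * + p) ∎)))
    where
    isolate : ∀ a b → a * a ≡ a * a + b * b - b * b
    isolate = solve-∀
    p∣a*a : p ℕ∣.∣ ∣ a ∣ ℕ.* ∣ a ∣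
    p∣a*a = subst (p ℕ∣.∣_) (ℤ.abs-* a a) (∣⇒∣ᵤ (subst (+ p ∣_)
      (sym (trans (isolate a b) (cong (_- b * b) (sym p≡a²+b²))))
      (∣m∣n⇒∣m-n (∣-refl {+ p}) (∣m⇒∣m*n b p∣b))))
    p∣a : + p ∣ a
    p∣a = ∣ᵤ⇒∣ ([ (λ d → d) , (λ d → d) ]′ (euclidsLemma ∣ a ∣ ∣ a ∣ p-prime p∣a*a))
    a′ b′ : ℤ
    a′ = quotient p∣a
    b′ = quotient p∣b
    factor : ∀ a b p → a * p * (a * p) + b * p * (b * p) ≡ p * ((a * a + b * b) * p)
    factor = solve-∀

  √-1-quotient : ∀ a b w → + p ≡ a * a + b * b → b * w ≡ 1ℤ [mod p ] →
    ⟦ a * w ⟧ ⊗ ⟦ a * w ⟧ ≡ ⊖ ⟦ 1ℤ ⟧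
  √-1-quotient a b w p≡a²+b² bw≡1 = begin
    ⟦ a * w ⟧ ⊗ ⟦ a * w ⟧    ≡⟨ ⟦⟧-* (a * w) (a * w) ⟨
    ⟦ a * w * (a * w) ⟧      ≡⟨ ⟦⟧-cong {a * w * (a * w)} { - 1ℤ} a²w²≡-1 ⟩
    ⟦ - 1ℤ ⟧                 ≡⟨ ⟦⟧-neg 1ℤ ⟩
    ⊖ ⟦ 1ℤ ⟧ ∎
    where
    expand : ∀ a b w → a * w * (a * w) + 1ℤ ≡ w * w * (a * a + b * b) - (b * w + 1ℤ) * (b * w - 1ℤ)
    expand = solve-∀
    a²w²≡-1 : a * w * (a * w) ≡ - 1ℤ [mod p ]
    a²w²≡-1 = subst (+ p ∣_)
      (sym (trans (expand a b w) (cong (λ q → w * w * q - (b * w + 1ℤ) * (b * w - 1ℤ)) (sym p≡a²+b²))))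
      (∣m∣n⇒∣m-n {+ p} {w * w * + p} {(b * w + 1ℤ) * (b * w - 1ℤ)}
        (∣n⇒∣m*n (w * w) (∣-refl {+ p})) (∣n⇒∣m*n (b * w + 1ℤ) bw≡1))

  -- The root is a / b: modulo `p`, a² is -b², and b is invertible by `p∤b`.
  √-1-exists : ∀ a b → + p ≡ a * a + b * b → ∃[ i ] i ⊗ i ≡ ⊖ ⟦ 1ℤ ⟧
  √-1-exists a b p≡a²+b² = from-inverse (inverse ⟦ b ⟧ λ b≡0 → p∤b a b p≡a²+b² (⟦⟧≡0 b≡0))
    where
    from-inverse : ∃[ y ] ⟦ b ⟧ ⊗ y ≡ ⟦ 1ℤ ⟧ → ∃[ i ] i ⊗ i ≡ ⊖ ⟦ 1ℤ ⟧
    from-inverse (y , by≡1) = ⟦ a * rep y ⟧ , √-1-quotient a b (rep y) p≡a²+b²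
      (⟦⟧-injective (trans (⟦⟧-* b (rep y)) (trans (cong (⟦ b ⟧ ⊗_) (⟦rep⟧ y)) by≡1)))

-- Newton's iteration for c² = D, carrying along an inverse u of 2 c.
newton : ∀ m D c u → m ∣ c * c - D → m ∣ + 2 * c * u - 1ℤ →
  ∃[ c′ ] ∃[ u′ ] (m * m ∣ c′ * c′ - D) × (m * m ∣ + 2 * c′ * u′ - 1ℤ)
-- `X * u` is the correction (c² - D) / (2 c); the new error of the square is X² u² - X Y. The
-- factor 1 - Y′ is a Newton step for the inverse of 2 c′, with error -Y′².
newton m D c u m∣X m∣Y = c - X * u , u * (1ℤ - Y′)
  , subst (m * m ∣_) (trans (square-error c u X) (cong (λ z → (c - X * u) * (c - X * u) - z) (cancel c D)))
      (∣m∣n⇒∣m-n {m * m} {X * X * (u * u)} {X * Y} (∣m⇒∣m*n (u * u) (∣-* X X m∣X m∣X)) (∣-* X Y m∣X m∣Y))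
  , subst (m * m ∣_) (inverse-error (c - X * u) u) (∣m⇒∣-m (∣-* Y′ Y′ m∣Y′ m∣Y′))
  where
  X Y Y′ : ℤ
  X = c * c - D
  Y = + 2 * c * u - 1ℤ
  Y′ = + 2 * (c - X * u) * u - 1ℤ
  ∣-* : ∀ i j → m ∣ i → m ∣ j → m * m ∣ i * j
  ∣-* i j m∣i m∣j = ∣-trans (*-monoʳ-∣ m m∣j) (*-monoˡ-∣ j m∣i)
  error : ∀ c u X → (+ 2 * c * u - 1ℤ) - X * (+ 2 * u * u) ≡ + 2 * (c - X * u) * u - 1ℤ
  error = solve-∀
  m∣Y′ : m ∣ Y′
  m∣Y′ = subst (m ∣_) (error c u X) (∣m∣n⇒∣m-n {m} {Y} {X * (+ 2 * u * u)} m∣Y (∣m⇒∣m*n (+ 2 * u * u) m∣X))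
  cancel : ∀ c D → c * c - (c * c - D) ≡ D
  cancel = solve-∀
  square-error : ∀ c u X → X * X * (u * u) - X * (+ 2 * c * u - 1ℤ) ≡ (c - X * u) * (c - X * u) - (c * c - X)
  square-error = solve-∀
  inverse-error : ∀ c u → - ((+ 2 * c * u - 1ℤ) * (+ 2 * c * u - 1ℤ)) ≡ + 2 * c * (u * (1ℤ - (+ 2 * c * u - 1ℤ))) - 1ℤ
  inverse-error = solve-∀

-- A Newton step squares the modulus m = p ^ `suc β`; only the divisor p m of m² is kept, which is
-- what an induction on `β` asks for.
hensel : ∀ p β D c u → + p ∣ c * c - D → + p ∣ + 2 * c * u - 1ℤ →
  ∃[ c′ ] ∃[ u′ ] (+ (p ℕ.^ suc β) ∣ c′ * c′ - D) × (+ (p ℕ.^ suc β) ∣ + 2 * c′ * u′ - 1ℤ)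
hensel p zero D c u p∣X p∣Y = c , u , subst (λ n → + n ∣ c * c - D) p≡p^1 p∣X , subst
    (λ n → + n ∣ + 2 * c * u - 1ℤ) p≡p^1 p∣Y
  where
  p≡p^1 : p ≡ p ℕ.^ 1
  p≡p^1 = sym (ℕ.*-identityʳ p)
hensel p (suc β) D c u p∣X p∣Y =
  let c₁ , u₁ , X₁ , Y₁ = hensel p β D c u p∣X p∣Y
      c₂ , u₂ , X₂ , Y₂ = newton (+ (p ℕ.^ suc β)) D c₁ u₁ X₁ Y₁
  in c₂ , u₂ , ∣-trans pm∣mm X₂ , ∣-trans pm∣mm Y₂
  where
  m = p ℕ.^ suc β
  pm∣mm : + (p ℕ.* m) ∣ + m * + m
  pm∣mm = ∣ᵤ⇒∣ (subst (p ℕ.* m ℕ∣.∣_) (sym (ℤ.abs-* (+ m) (+ m))) (ℕ∣.*-monoˡ-∣ m (ℕ∣.m∣m*n {p} (p ℕ.^ β))))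

-- Reduction from ℤ/p^α to ℤ/p

tupleSum-cong : ∀ {n} m {P Q : Fin n → ℤ} {A B : Fin n → Fin n → ℤ} → P ≗ Q → (∀ x y → A x y ≡ B x y) →
  tupleSum m P A ≡ tupleSum m Q B
tupleSum-cong zero P≗Q A≗B = refl
tupleSum-cong (suc m) P≗Q A≗B = sum-cong-≗ λ x →
  cong₂ _*_ (P≗Q x) (tupleSum-cong m (λ y → cong₂ _*_ (P≗Q y) (A≗B x y)) A≗B)

tupleSum-*ˡ : ∀ {n} m c (P Q : Fin n → ℤ) (A : Fin n → Fin n → ℤ) → (∀ x → Q x ≡ c * P x) →
  tupleSum m Q A ≡ c ^ m * tupleSum m P A
tupleSum-*ˡ zero c P Q A Q≡cP = refl
tupleSum-*ˡ (suc m) c P Q A Q≡cP = begin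
  sum (λ x → Q x * tupleSum m (λ y → Q y * A x y) A)
    ≡⟨ sum-cong-≗ (λ x → trans (cong₂ _*_ (Q≡cP x) (tupleSum-*ˡ m c (λ y → P y * A x y) _ A
         (λ y → trans (cong (_* A x y) (Q≡cP y)) (ℤ.*-assoc c (P y) (A x y)))))
         (rearr c (P x) (c ^ m) _)) ⟩
  sum (λ x → c * c ^ m * (P x * tupleSum m (λ y → P y * A x y) A))
    ≡⟨ *-distribˡ-sum (c * c ^ m) (λ x → P x * tupleSum m (λ y → P y * A x y) A) ⟨
  c * c ^ m * tupleSum (suc m) P A ∎
  where
  rearr : ∀ a b c d → a * b * (c * d) ≡ a * c * (b * d)
  rearr = solve-∀

-- The binomial coefficient m (m - 1) / 2, built up as `tupleSum` does: a chosen vertex forms a pair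
-- with each of the `m` vertices still to come.
pairs : ℕ → ℕ
pairs zero = 0
pairs (suc m) = m ℕ.+ pairs m

tupleSum-scale : ∀ {n} m c (P : Fin n → ℤ) (A B : Fin n → Fin n → ℤ) → (∀ x y → B x y ≡ c * A x y) →
  tupleSum m P B ≡ c ^ pairs m * tupleSum m P A
tupleSum-scale zero c P A B B≡cA = refl
tupleSum-scale (suc m) c P A B B≡cA = begin
  sum (λ x → P x * tupleSum m (λ y → P y * B x y) B)
    ≡⟨ sum-cong-≗ (λ x → begin
         P x * tupleSum m (λ y → P y * B x y) B
           ≡⟨ cong (P x *_) (tupleSum-scale m c _ A B B≡cA) ⟩
         P x * (c ^ pairs m * tupleSum m (λ y → P y * B x y) A)
           ≡⟨ cong (λ t → P x * (c ^ pairs m * t)) (tupleSum-*ˡ m c (λ y → P y * A x y) _ A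
                (λ y → trans (cong (P y *_) (B≡cA x y)) (swap (P y) c (A x y)))) ⟩
         P x * (c ^ pairs m * (c ^ m * tupleSum m (λ y → P y * A x y) A))
           ≡⟨ rearr (P x) (c ^ pairs m) (c ^ m) _ ⟩
         c ^ m * c ^ pairs m * (P x * tupleSum m (λ y → P y * A x y) A) ∎) ⟩
  sum (λ x → c ^ m * c ^ pairs m * (P x * tupleSum m (λ y → P y * A x y) A))
    ≡⟨ *-distribˡ-sum (c ^ m * c ^ pairs m) (λ x → P x * tupleSum m (λ y → P y * A x y) A) ⟨
  c ^ m * c ^ pairs m * tupleSum (suc m) P A
    ≡⟨ cong (_* tupleSum (suc m) P A) (ℤ.^-distribˡ-+-* c m (pairs m)) ⟨
  c ^ pairs (suc m) * tupleSum (suc m) P A ∎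
  where
  swap : ∀ a b c → a * (b * c) ≡ b * (a * c)
  swap = solve-∀
  rearr : ∀ a b c d → a * (b * (c * d)) ≡ c * b * (a * d)
  rearr = solve-∀

-- All that is asked of `r` is that its fibres have `N` elements, stated as a summation rule; each
-- of the `m` nested sums then yields one factor `N`.
tupleSum-pullback : ∀ {n q} (r : Fin n → Fin q) N → (∀ f → sum (λ x → f (r x)) ≡ N * sum f) →
  ∀ m P A → tupleSum m (λ x → P (r x)) (λ x y → A (r x) (r y)) ≡ N ^ m * tupleSum m P A
tupleSum-pullback r N sum-r zero P A = refl
tupleSum-pullback r N sum-r (suc m) P A = begin
  sum (λ x → P (r x) * tupleSum m (λ y → P (r y) * A (r x) (r y)) (λ y z → A (r y) (r z)))
    ≡⟨ sum-cong-≗ (λ x → trans (cong (P (r x) *_) (tupleSum-pullback r N sum-r m (λ v → P v * A (r x) v) A))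
         (swap (P (r x)) (N ^ m) _)) ⟩
  sum (λ x → f (r x))
    ≡⟨ sum-r f ⟩
  N * sum f
    ≡⟨ cong (N *_) (*-distribˡ-sum (N ^ m) (λ u → P u * tupleSum m (λ v → P v * A u v) A)) ⟨
  N * (N ^ m * tupleSum (suc m) P A)
    ≡⟨ ℤ.*-assoc N (N ^ m) _ ⟨
  N * N ^ m * tupleSum (suc m) P A ∎
  where
  f = λ u → N ^ m * (P u * tupleSum m (λ v → P v * A u v) A)
  swap : ∀ a b c → a * (b * c) ≡ b * (a * c)
  swap = solve-∀

sum-↑ : ∀ m {n} (f : Fin (m ℕ.+ n) → ℤ) → sum f ≡ sum (λ i → f (i ↑ˡ n)) + sum (λ i → f (m ↑ʳ i))
sum-↑ zero f = sym (ℤ.+-identityˡ (sum f))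
sum-↑ (suc m) f = trans (cong (λ z → f zero + z) (sum-↑ m (f ∘ suc))) (sym (ℤ.+-assoc (f zero) _ _))

sum-periodic : ∀ p (g : ℕ → ℤ) → (∀ k → g (p ℕ.+ k) ≡ g k) → ∀ N →
  sum {N ℕ.* p} (g ∘ toℕ) ≡ + N * sum {p} (g ∘ toℕ)
sum-periodic p g g-per zero = refl
sum-periodic p g g-per (suc N) = begin
  sum {p ℕ.+ N ℕ.* p} (g ∘ toℕ)
    ≡⟨ sum-↑ p {N ℕ.* p} (g ∘ toℕ) ⟩
  sum {p} (λ i → g (toℕ (i ↑ˡ (N ℕ.* p)))) + sum {N ℕ.* p} (λ i → g (toℕ (p ↑ʳ i)))
    ≡⟨ cong₂ _+_ (sum-cong-≗ {p} λ i → cong g (toℕ-↑ˡ i (N ℕ.* p)))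
         (trans (sum-cong-≗ {N ℕ.* p} λ i → trans (cong g (toℕ-↑ʳ p i)) (g-per (toℕ i))) (sum-periodic p g g-per N)) ⟩
  sum {p} (g ∘ toℕ) + + N * sum {p} (g ∘ toℕ)
    ≡⟨ ℤ.suc-* (+ N) (sum {p} (g ∘ toℕ)) ⟨
  + suc N * sum {p} (g ∘ toℕ) ∎

module Clique₄ {p : ℕ} (p-prime : Prime p) (β : ℕ) where
  open PrimeResidue p-prime using (⟦rep⟧; ⟦⟧-cong; ⟦⟧-injective; primeField)
  module R = PrimeResidue p-prime

  private instance
    p≢0 : ℕ.NonZero p
    p≢0 = prime⇒nonZero p-prime
    n≢0 : ℕ.NonZero (p ℕ.^ suc β)
    n≢0 = ℕ.m^n≢0 p (suc β)

  red : Fin (p ℕ.^ suc β) → Fin p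
  red x = R.⟦ rep x ⟧

  p∣n : p ℕ∣.∣ p ℕ.^ suc β
  p∣n = ℕ∣.m∣m*n (p ℕ.^ β)

  sum-red : ∀ f → sum (λ x → f (red x)) ≡ + (p ℕ.^ β) * sum f
  sum-red f = trans (sum-n (p ℕ.^ suc β) (ℕ.*-comm p (p ℕ.^ β)))
      (cong (+ (p ℕ.^ β) *_) (sum-cong-≗ {p} λ x → cong f (⟦rep⟧ x)))
    where
    g : ℕ → ℤ
    g k = f R.⟦ + k ⟧
    g-per : ∀ k → g (p ℕ.+ k) ≡ g k
    g-per k = cong f (⟦⟧-cong (divides 1ℤ (trans (cong (_- + k) (ℤ.pos-+ p k)) (cancel (+ p) (+ k)))))
      where
      cancel : ∀ p k → p + k - k ≡ 1ℤ * p
      cancel = solve-∀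
    -- `p ℕ.^ suc β` unfolds to p * p ^ β, while `sum-periodic` counts p ^ β blocks of length p.
    -- With the bound as a variable, matching on the equation replaces a cast between index sets.
    sum-n : ∀ n → n ≡ p ℕ.^ β ℕ.* p → sum {n} (g ∘ toℕ) ≡ + (p ℕ.^ β) * sum {p} (g ∘ toℕ)
    sum-n _ refl = sum-periodic p g g-per (p ℕ.^ β)

  module _ (⟦2⟧≢0 : R.⟦ + 2 ⟧ ≢ R.⟦ 0ℤ ⟧) (i : Fin p) (i² : i R.⊗ i ≡ R.⊖ R.⟦ 1ℤ ⟧) where
    K : FiniteField p
    K = primeField ⟦2⟧≢0 i i²
    open Character K
    open CharacterSums K
    open PaleySums K
    open JacobsthalSums K using (Q-value)

    red-⊝ : ∀ x y → R.⟦ rep x - rep y ⟧ ≡ red x ⊝ red y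
    red-⊝ x y = trans (⟦⟧-+ (rep x) (- rep y)) (cong (red x ⊕_) (⟦⟧-neg (rep y)))

    adj⇒square : ∀ x y → PaleyAdj (p ℕ.^ suc β) x y → ∃[ s ] s ≢ 0# × red x ⊝ red y ≡ s ⊗ s
    adj⇒square x y (c , (d , cd≡1) , x-y≡c²) = red c , c≢0 ,
      trans (sym (red-⊝ x y)) (trans (⟦⟧-cong (≡mod-∣ {i = rep x - rep y} {rep c * rep c} p∣n x-y≡c²))
          (⟦⟧-* (rep c) (rep c)))
      where
      c≢0 : red c ≢ 0#
      c≢0 c≡0 = 1≢0 (begin
        1#                      ≡⟨ ⟦⟧-cong (≡mod-∣ {i = rep c * rep d} {1ℤ} p∣n cd≡1) ⟨
        R.⟦ rep c * rep d ⟧     ≡⟨ ⟦⟧-* (rep c) (rep d) ⟩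
        red c ⊗ red d           ≡⟨ cong (_⊗ red d) c≡0 ⟩
        0# ⊗ red d              ≡⟨ ⊗-zeroˡ (red d) ⟩
        0# ∎)

    -- As 2 s is invertible modulo `p`, s is a simple root of c² = x - y and lifts by `hensel`. The
    -- inverse of 2 c carried along the lifting also shows that the lifted root is a unit.
    square⇒adj : ∀ x y s → s ≢ 0# → red x ⊝ red y ≡ s ⊗ s → PaleyAdj (p ℕ.^ suc β) x y
    square⇒adj x y s s≢0 eq = lift (inverse (⟦ + 2 ⟧ ⊗ s) (⊗≢0 2≢0 s≢0))
      where
      module N = Residue (p ℕ.^ suc β)
      D c₀ : ℤ
      D = rep x - rep y
      c₀ = rep s
      lift : ∃[ u ] ⟦ + 2 ⟧ ⊗ s ⊗ u ≡ 1# → PaleyAdj (p ℕ.^ suc β) x y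
      lift (u , 2su≡1) = from-hensel (hensel p β D c₀ (rep u) X₀ Y₀)
        where
        X₀ : + p ∣ c₀ * c₀ - D
        X₀ = ⟦⟧-injective (trans (⟦⟧-* c₀ c₀)
            (trans (cong₂ _⊗_ (⟦rep⟧ s) (⟦rep⟧ s)) (trans (sym eq) (sym (red-⊝ x y)))))
        Y₀ : + p ∣ + 2 * c₀ * rep u - 1ℤ
        Y₀ = ⟦⟧-injective (trans (⟦⟧-* (+ 2 * c₀) (rep u)) (trans
          (cong₂ _⊗_ (trans (⟦⟧-* (+ 2) c₀) (cong (⟦ + 2 ⟧ ⊗_) (⟦rep⟧ s))) (⟦rep⟧ u)) 2su≡1))
        from-hensel : (∃[ c ] ∃[ u ] (+ (p ℕ.^ suc β) ∣ c * c - D) × (+ (p ℕ.^ suc β) ∣ + 2 * c * u - 1ℤ)) →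
            PaleyAdj (p ℕ.^ suc β) x y
        -- From 2 c u ≡ 1 the inverse of c is 2 u.
        from-hensel (c , u , X , Y) = N.⟦ c ⟧ , (N.⟦ + 2 * u ⟧ , unit) ,
          ≡mod-sym (rep N.⟦ c ⟧ * rep N.⟦ c ⟧) D
            (≡mod-trans (rep N.⟦ c ⟧ * rep N.⟦ c ⟧) (c * c) D
              (*-mod (rep N.⟦ c ⟧) c (rep N.⟦ c ⟧) c (N.rep-⟦⟧ c) (N.rep-⟦⟧ c)) X)
          where
          unit : rep N.⟦ c ⟧ * rep N.⟦ + 2 * u ⟧ ≡ 1ℤ [mod (p ℕ.^ suc β) ]
          unit = ≡mod-trans (rep N.⟦ c ⟧ * rep N.⟦ + 2 * u ⟧) (c * (+ 2 * u)) 1ℤ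
            (*-mod (rep N.⟦ c ⟧) c (rep N.⟦ + 2 * u ⟧) (+ 2 * u) (N.rep-⟦⟧ c) (N.rep-⟦⟧ (+ 2 * u)))
            (subst (λ z → + (p ℕ.^ suc β) ∣ z - 1ℤ) (rearr c u) Y)
            where
            rearr : ∀ c u → + 2 * c * u ≡ c * (+ 2 * u)
            rearr = solve-∀

    -- A root s for x - y modulo `p` gives the root i s for y - x, which `square⇒adj` lifts.
    adj-sym : ∀ x y → PaleyAdj (p ℕ.^ suc β) x y → PaleyAdj (p ℕ.^ suc β) y x
    adj-sym x y adj = flip-sign (adj⇒square x y adj)
      where
      flip-sign : ∃[ s ] s ≢ 0# × red x ⊝ red y ≡ s ⊗ s → PaleyAdj (p ℕ.^ suc β) y x
      flip-sign (s , s≢0 , eq) = square⇒adj y x (i ⊗ s) (⊗≢0 √-1≢0 s≢0) (begin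
        red y ⊝ red x         ≡⟨ solve 2 (λ x y → y :- x := :- con 1ℤ :* (x :- y)) refl (red x) (red y) ⟩
        ⊖ 1# ⊗ (red x ⊝ red y) ≡⟨ cong₂ _⊗_ (sym i²) eq ⟩
        i ⊗ i ⊗ (s ⊗ s)       ≡⟨ solve 2 (λ i s → i :* i :* (s :* s) := i :* s :* (i :* s)) refl i s ⟩
        i ⊗ s ⊗ (i ⊗ s) ∎)

    adj-irrefl : ∀ x → ¬ PaleyAdj (p ℕ.^ suc β) x x
    adj-irrefl x adj = zero-square (adj⇒square x x adj)
      where
      zero-square : ¬ (∃[ s ] s ≢ 0# × red x ⊝ red x ≡ s ⊗ s)
      zero-square (s , s≢0 , eq) = ⊗≢0 s≢0 s≢0 (trans (sym eq) (solve 1 (λ x → x :- x := con 0ℤ) refl (red x)))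

    e-adj : ∀ x y → e (red x ⊝ red y) ≡ + 2 * ι (does (G (p ℕ.^ suc β) x y))
    e-adj x y with G (p ℕ.^ suc β) x y
    ... | yes adj = on-square (adj⇒square x y adj)
      where
      on-square : ∃[ s ] s ≢ 0# × red x ⊝ red y ≡ s ⊗ s → e (red x ⊝ red y) ≡ + 2
      on-square (s , s≢0 , eq) = trans (cong e eq) (cong₂ (λ a b → 1ℤ - a + b) (δ-≢ (⊗≢0 s≢0 s≢0)) (χ-square s≢0))
    ... | no ¬adj = off-square (classify (red x ⊝ red y))
      where
      off-square : Class (red x ⊝ red y) → e (red x ⊝ red y) ≡ 0ℤ
      off-square (isZero eq) = trans (cong e eq) (cong₂ (λ a b → 1ℤ - a + b) (δ-≡ {0#} refl) χ-0)
      off-square (square s s≢0 eq) = contradiction (square⇒adj x y s s≢0 eq) ¬adj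
      off-square (nonsquare ns) = cong₂ (λ a b → 1ℤ - a + b) (δ-≢ (nonsquare≢0 ns)) (χ-nonsquare ns)

    1536*𝒦₄ : ∀ m → + p ≡ 1ℤ + + 4 * m → ∀ a b → + p ≡ a * a + b * b → 2 ℕ∣.∣ ∣ a ∣ →
      + 1536 * + 𝒦 4 (G (p ℕ.^ suc β)) ≡
        (+ (p ℕ.^ β)) ^ 4 * (+ p * ((+ p - 1ℤ) * ((+ p - + 9) * (+ p - + 9) - + 4 * (a * a))))
    1536*𝒦₄ m p≡1+4m a b p≡a²+b² 2∣a = begin
      + 1536 * + 𝒦 4 (G (p ℕ.^ suc β))
        -- 24 = 4! orders the clique, and 64 = 2 ^ `pairs 4` turns the six adjacency indicators into
        -- values of `e`.
        ≡⟨ ℤ.*-assoc (+ 64) (+ 24) (+ 𝒦 4 (G (p ℕ.^ suc β))) ⟩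
      + 64 * (+ 24 * + 𝒦 4 (G (p ℕ.^ suc β)))
        ≡⟨ cong (+ 64 *_) (𝒦-tupleSum (G (p ℕ.^ suc β)) (λ {x} {y} → adj-sym x y) adj-irrefl 4) ⟩
      + 64 * tupleSum 4 (λ _ → 1ℤ) (λ x y → ι (does (G (p ℕ.^ suc β) x y)))
        ≡⟨ tupleSum-scale 4 (+ 2) (λ _ → 1ℤ) (λ x y → ι (does (G (p ℕ.^ suc β) x y)))
            (λ x y → e (red x ⊝ red y)) e-adj ⟨
      tupleSum 4 (λ _ → 1ℤ) (λ x y → e (red x ⊝ red y))
        ≡⟨ tupleSum-pullback red (+ (p ℕ.^ β)) sum-red 4 (λ _ → 1ℤ) (λ x y → e (x ⊝ y)) ⟩
      (+ (p ℕ.^ β)) ^ 4 * tupleSum 4 (λ _ → 1ℤ) (λ x y → e (x ⊝ y))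
        ≡⟨ cong ((+ (p ℕ.^ β)) ^ 4 *_) tupleSum-e ⟩
      (+ (p ℕ.^ β)) ^ 4 * (+ p * ((+ p - 1ℤ) * Q))
        ≡⟨ cong (λ z → (+ (p ℕ.^ β)) ^ 4 * (+ p * ((+ p - 1ℤ) * z))) (Q-value p-prime m p≡1+4m a b p≡a²+b² 2∣a) ⟩
      _ ∎

-- Powers of p and the quotient by 1536

pos-^ : ∀ m n → + (m ℕ.^ n) ≡ (+ m) ^ n
pos-^ m zero = refl
pos-^ m (suc n) = trans (ℤ.pos-* m (m ℕ.^ n)) (cong (+ m *_) (pos-^ m n))

1536*𝒦₄-formula : ∀ p β → Prime p → p ℕ.% 4 ≡ 1 → ∀ a b → + p ≡ a ^ 2 + b ^ 2 → + 2 ∣ a →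
  + 1536 * + 𝒦 4 (G (p ℕ.^ suc β)) ≡
    (+ p) ^ (4 ℕ.* suc β ℕ.∸ 3) * (+ p - + 1) * ((+ p - + 9) ^ 2 - + 4 * a ^ 2)
1536*𝒦₄-formula p β p-prime p%4≡1 a b p≡a^2+b^2 2∣a = begin
  + 1536 * + 𝒦 4 (G (p ℕ.^ suc β))
    ≡⟨ 1536*𝒦₄ 2≢0 (proj₁ √-1) (proj₂ √-1) (+ (p ℕ./ 4)) p≡1+4m a b p≡a²+b² (∣⇒∣ᵤ 2∣a) ⟩
  (+ (p ℕ.^ β)) ^ 4 * (+ p * ((+ p - 1ℤ) * ((+ p - + 9) * (+ p - + 9) - + 4 * (a * a))))
    ≡⟨ cong₂ (λ x y → x * (+ p * ((+ p - 1ℤ) * y))) power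
         (sym (cong₂ (λ x y → x - + 4 * y) (square (+ p - + 9)) (square a))) ⟩
  (+ p) ^ (4 ℕ.* β) * (+ p * ((+ p - 1ℤ) * ((+ p - + 9) ^ 2 - + 4 * a ^ 2)))
    ≡⟨ rearr ((+ p) ^ (4 ℕ.* β)) (+ p) (+ p - 1ℤ) ((+ p - + 9) ^ 2 - + 4 * a ^ 2) ⟩
  (+ p) ^ suc (4 ℕ.* β) * (+ p - 1ℤ) * ((+ p - + 9) ^ 2 - + 4 * a ^ 2)
    -- 4 (β + 1) is 4 + 4 β, so the truncated subtraction computes to 1 + 4 β: four factors p ^ β
    -- from the fibres and one p from the translations.
    ≡⟨ cong (λ k → (+ p) ^ (k ℕ.∸ 3) * (+ p - 1ℤ) * ((+ p - + 9) ^ 2 - + 4 * a ^ 2)) (ℕ.*-suc 4 β) ⟨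
  (+ p) ^ (4 ℕ.* suc β ℕ.∸ 3) * (+ p - + 1) * ((+ p - + 9) ^ 2 - + 4 * a ^ 2) ∎
  where
  open Clique₄ p-prime β using (1536*𝒦₄)
  module R = PrimeResidue p-prime
  square : ∀ x → x ^ 2 ≡ x * x
  square x = cong (x *_) (ℤ.*-identityʳ x)
  p≡a²+b² : + p ≡ a * a + b * b
  p≡a²+b² = trans p≡a^2+b^2 (cong₂ _+_ (square a) (square b))
  √-1 = R.√-1-exists a b p≡a²+b²
  2≢0 : R.⟦ + 2 ⟧ ≢ R.⟦ 0ℤ ⟧
  2≢0 e = ∤2 p p-prime p%4≡1 (∣⇒∣ᵤ (R.⟦⟧≡0 e))
    where
    ∤2 : ∀ p → Prime p → p ℕ.% 4 ≡ 1 → ¬ (p ℕ∣.∣ 2)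
    ∤2 0 _ () _
    ∤2 1 1-prime _ _ = ¬prime[1] 1-prime
    ∤2 2 _ () _
    ∤2 (suc (suc (suc p))) _ _ p∣2 with ℕ∣.∣⇒≤ p∣2
    ... | ℕ.s≤s (ℕ.s≤s ())
  p≡1+4m : + p ≡ 1ℤ + + 4 * + (p ℕ./ 4)
  p≡1+4m = begin
    + p                                      ≡⟨ cong +_ (m≡m%n+[m/n]*n p 4) ⟩
    + (p ℕ.% 4 ℕ.+ p ℕ./ 4 ℕ.* 4)            ≡⟨ cong (λ r → + (r ℕ.+ p ℕ./ 4 ℕ.* 4)) p%4≡1 ⟩
    1ℤ + + (p ℕ./ 4 ℕ.* 4)                   ≡⟨ cong (λ z → 1ℤ + z)
        (trans (ℤ.pos-* (p ℕ./ 4) 4) (ℤ.*-comm (+ (p ℕ./ 4)) (+ 4))) ⟩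
    1ℤ + + 4 * + (p ℕ./ 4) ∎
  power : (+ (p ℕ.^ β)) ^ 4 ≡ (+ p) ^ (4 ℕ.* β)
  power = begin
    (+ (p ℕ.^ β)) ^ 4     ≡⟨ cong (_^ 4) (pos-^ p β) ⟩
    ((+ p) ^ β) ^ 4       ≡⟨ ℤ.^-*-assoc (+ p) β 4 ⟩
    (+ p) ^ (β ℕ.* 4)     ≡⟨ cong ((+ p) ^_) (ℕ.*-comm β 4) ⟩
    (+ p) ^ (4 ℕ.* β) ∎
  rearr : ∀ x p y z → x * (p * (y * z)) ≡ p * x * y * z
  rearr = solve-∀

-- Both sides are images of unnormalised fractions, where equality is cross-multiplication;
-- integrality of the quotient is thus carried by `dk≡z` itself.
/-cancel : ∀ d k z .{{_ : ℕ.NonZero d}} → + d * k ≡ z → k / 1 ≡ z / d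
/-cancel (suc d) k z dk≡z = fromℚᵘ-cong {mkℚᵘ k 0} {mkℚᵘ z d}
  (*≡* (trans (ℤ.*-comm k (+ suc d)) (trans dk≡z (sym (ℤ.*-identityʳ z)))))

corollary1p5 : (p α : ℕ) → Prime p → p ℕ.% 4 ≡ 1 → 1 ℕ.≤ α →
    (a b : ℤ) → + p ≡ a ^ 2 + b ^ 2 → + 2 ∣ a →
    + (𝒦 4 (G (p ℕ.^ α))) / 1
    ≡ ((+ p) ^ (4 ℕ.* α ℕ.∸ 3) * (+ p - + 1) * ((+ p - + 9) ^ 2 - + 4 * a ^ 2)) / 1536
corollary1p5 p (suc β) p-prime p%4≡1 _ a b p≡a²+b² 2∣a =
  /-cancel 1536 (+ 𝒦 4 (G (p ℕ.^ suc β)))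
    ((+ p) ^ (4 ℕ.* suc β ℕ.∸ 3) * (+ p - + 1) * ((+ p - + 9) ^ 2 - + 4 * a ^ 2))
    (1536*𝒦₄-formula p β p-prime p%4≡1 a b p≡a²+b² 2∣a)
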